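{- Let $p\geq 7$ be a prime with $p\equiv 3$ or $7\pmod{8}$. Then for all integers $n\geq 0$, \[a_{p-6}\left(pn+\frac{13(p^2-1)}{24}\right)\equiv 0\pmod{p}.\]
   Context: For a positive integer $c$, a generalized cubic partition of $n$ is a partition of $n$ whose even parts may appear in $c$ different colors; $a_c(n)$ denotes the number of such partitions of $n$, with $a_c(0)=1$. Equivalently, writing $f_m=\prod_{k\geq 1}(1-q^{mk})$ for $|q|<1$, \[\sum_{n=0}^\infty a_c(n)q^n=\frac{1}{f_1 f_2^{\,c-1}}.\] -}

module Defs where

open import Data.Nat using (ℕ; zero; suc; _+_; _*_; _∸_; _≤?_)
open import Data.Nat.Base using (_%_)
open import Data.List using (List; []; _∷_; _++_; replicate)
open import Relation.Nullary using (yes; no)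

colours : ℕ → ℕ → ℕ
colours c m with m % 2
... | zero  = c
... | suc _ = 1

partKinds : ℕ → ℕ → List ℕ
partKinds c zero    = []
partKinds c (suc k) = replicate (colours c (suc k)) (suc k) ++ partKinds c k

-- countMulti ks n : number of multisets of elements of the list ks (elements
-- treated as distinct kinds, each with the given size) whose sizes sum to n.
-- Equivalently, the number of tuples (e_1,...,e_r) of naturals with
-- sum e_i * s_i = n.
mutual
  countMulti : List ℕ → ℕ → ℕ
  countMulti []       zero    = 1
  countMulti []       (suc _) = 0
  countMulti (s ∷ ks) n       = useTimes s ks n n

  useTimes : ℕ → List ℕ → ℕ → ℕ → ℕ
  useTimes s ks n zero = countMulti ks n
  useTimes s ks n (suc j) with suc j * s ≤? n
  ... | yes _ = countMulti ks (n ∸ suc j * s) + useTimes s ks n j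
  ... | no  _ = useTimes s ks n j

-- a_c(n): number of partitions of n in which even parts may appear in c colours.
-- Parts are positive (sizes 1..n suffice for a partition of n).
a : ℕ → ℕ → ℕ
a c n = countMulti (partKinds c n) n

{-# OPTIONS --safe #-}
-- Write f_k = ∏(1 − q^{km}) and W = D f₁(−q) · f₁(q) − f₁(−q) · D f₁(q), where D = q d/dq.  The key identity is
-- W f₂ = 2 q f₄⁷.  For c = p − 6 it turns the generating function A = 1/(f₁ f₂^{p−7}) of a_c into
-- 2 q A(q²) = W / f₄^p, and modulo p the series 1/f₄^p only involves powers of q^p.  By the pentagonal number
-- theorem f₁ is supported on exponents j such that 24 j + 1 is a square.  Hence a pair (j , k) contributes to the
-- coefficient of W at n with u² = 24 j + 1, v² = 24 k + 1, u² + v² = 24 n + 2; if p divides 24 n + 2 then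
-- p divides u and v because p ≡ 3 mod 4, so that 24 W has a coefficient divisible by p at n.
--
-- The key identity says D log (f₁(−q)/f₁(q)) = 2 q ψ(q²)⁴ with ψ = f₂²/f₁.  Gauss' φ(−q) = f₁²/f₂ reduces it to
-- D log (α/β) = (α² − β²)/2 for α = φ(q)², β = φ(−q)².  Under q ↦ q² the pair (α , β) undergoes one step of the
-- arithmetic-geometric mean, so the defect V of this equation satisfies a relation between V(q) and V(q²)
-- which forces V = 0 once its first two coefficients vanish.
module Submission where

open import Defs
open import Data.Nat using (ℕ; zero; suc; _+_; _*_; _∸_; _^_; _≤_; _<_; _/_; _≤?_; _<?_; z≤n; s≤s; NonZero)
open import Data.Nat.Primality using (Prime; euclidsLemma; prime⇒irreducible)
open import Data.Nat.Divisibility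
  using (_∣_; divides; _∣?_; n∣m*n; ∣m+n∣m⇒∣n; ∣m⇒∣m*n; ∣n⇒∣m*n; ∣⇒≤; _∣0)
open import Data.Nat.Base using (_%_)
open import Data.Nat.Combinatorics
  using (_C_; nC1≡n; nCn≡1; nCk≡nC[n∸k]; k>n⇒nCk≡0; nCk+nC[k+1]≡[n+1]C[k+1])
import Data.Nat.DivMod as DivMod
import Data.Nat.Properties as ℕₚ
import Data.Nat.Solver as ℕSolver
open import Data.Integer using (ℤ; +_; 0ℤ; 1ℤ; -1ℤ; ∣_∣)
  renaming (_+_ to _+ᶻ_; _*_ to _*ᶻ_; -_ to -ᶻ_; _≟_ to _≟ᶻ_)
open import Data.Integer.Divisibility.Signed using (∣ᵤ⇒∣; ∣⇒∣ᵤ) renaming (_∣_ to _∣ᶻ_)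
import Data.Integer.Divisibility.Signed as ℤᵈ
import Data.Integer.Properties as ℤₚ
open import Data.Integer.Solver using () renaming (module +-*-Solver to ℤSolver)
open import Data.List using (List; []; _∷_; _++_; replicate)
open import Data.Maybe.Base as Maybe using (Maybe)
open import Data.Product using (_×_; _,_; ∃)
open import Data.Sum using (_⊎_; inj₁; inj₂; [_,_]′)
open import Algebra.Bundles using (CommutativeRing)
open import Algebra.Solver.Ring.AlmostCommutativeRing
  using (fromCommutativeRing; _-Raw-AlmostCommutative⟶_)
import Algebra.Solver.Ring as RingSolver
open import Algebra.Structures using (IsCommutativeRing)
open import Function using (id; _∘_)
open import Relation.Binary using (IsEquivalence; Setoid)
open import Relation.Binary.PropositionalEquality
import Relation.Binary.Reasoning.Setoid as SetoidReasoning
open import Relation.Nullary using (¬_; yes; no; contradiction; dec⇒maybe)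

-- The ring of formal power series

-- Quotients are multiplied out: 2, 4 and 8 are not units over ℤ, so factors with nonzero constant
-- term are cancelled instead of inverted. Infinite products and theta series are limits of
-- polynomials, and identities between them are checked modulo every power of q; those for f₁ and
-- φ(-q) come from finite telescoping sums. The relation forced by the AGM step is β(q²) V(q²) = q
-- ψ(q⁴)² V(q). If V had order N ≥ 2, the sides would have the different orders 2N and N + 1; N = 1
-- is excluded by computing the coefficient of q. The same comparison of orders yields ψ f₁ = f₂²
-- from ψ(q)² = φ(q) ψ(q²). The constants fit as follows. W f₂ = 2 q f₄⁷ gives 2 q / (f₂ f₄^(c-1)) =
-- W / f₄^(c+6), and c + 6 is p. The coefficient of q^N in A stands at q^(2N+1) in q A(q²), and 24
-- (2N + 1) + 2 = 48 N + 26; for N = p n + 13 (p² - 1)/24 this is 48 p n + 26 p², a multiple of p.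

Series : Set
Series = ℕ → ℤ

infix 4 _≈_
-- Wrapping the pointwise equality in a record lets unification recover `f` and `g` from the type of
-- an equation.
record _≈_ (f g : Series) : Set where
  constructor pointwise
  field at : ∀ n → f n ≡ g n
open _≈_

≈-refl : ∀ {f} → f ≈ f
≈-refl = pointwise λ _ → refl

≈-sym : ∀ {f g} → f ≈ g → g ≈ f
≈-sym e = pointwise λ n → sym (at e n)

≈-trans : ∀ {f g h} → f ≈ g → g ≈ h → f ≈ h
≈-trans e e′ = pointwise λ n → trans (at e n) (at e′ n)

tail : Series → Series
tail f n = f (suc n)

const : ℤ → Series
const k zero    = k
const k (suc _) = 0ℤ

infixl 6 _⊕_
infixl 7 _⊛_
infix  8 ⊖_

_⊕_ : Series → Series → Series
(f ⊕ g) n = f n +ᶻ g n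

⊖_ : Series → Series
(⊖ f) n = -ᶻ f n

-- The Cauchy product, unfolded along f = f(0) + q · `tail f`; proofs about coefficients become
-- inductions without finite sums.
_⊛_ : Series → Series → Series
(f ⊛ g) zero    = f 0 *ᶻ g 0
(f ⊛ g) (suc n) = f 0 *ᶻ g (suc n) +ᶻ (tail f ⊛ g) n

⊛-at-cong : ∀ n {f f′ g g′} → (∀ i → i ≤ n → f i ≡ f′ i) → (∀ i → i ≤ n → g i ≡ g′ i) →
  (f ⊛ g) n ≡ (f′ ⊛ g′) n
⊛-at-cong zero    ef eg = cong₂ _*ᶻ_ (ef 0 z≤n) (eg 0 z≤n)
⊛-at-cong (suc n) ef eg = cong₂ _+ᶻ_
  (cong₂ _*ᶻ_ (ef 0 z≤n) (eg (suc n) ℕₚ.≤-refl))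
  (⊛-at-cong n (λ i i≤n → ef (suc i) (s≤s i≤n)) (λ i i≤n → eg i (ℕₚ.m≤n⇒m≤1+n i≤n)))

⊕-cong : ∀ {f f′ g g′} → f ≈ f′ → g ≈ g′ → f ⊕ g ≈ f′ ⊕ g′
⊕-cong e e′ = pointwise λ n → cong₂ _+ᶻ_ (at e n) (at e′ n)

⊛-cong : ∀ {f f′ g g′} → f ≈ f′ → g ≈ g′ → f ⊛ g ≈ f′ ⊛ g′
⊛-cong e e′ = pointwise λ n → ⊛-at-cong n (λ i _ → at e i) (λ i _ → at e′ i)

⊖-cong : ∀ {f f′} → f ≈ f′ → ⊖ f ≈ ⊖ f′
⊖-cong e = pointwise λ n → cong -ᶻ_ (at e n)

⊕-congˡ : ∀ f {g h} → g ≈ h → f ⊕ g ≈ f ⊕ h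
⊕-congˡ f e = ⊕-cong (≈-refl {f}) e

⊕-congʳ : ∀ f {g h} → g ≈ h → g ⊕ f ≈ h ⊕ f
⊕-congʳ f e = ⊕-cong e (≈-refl {f})

⊛-congˡ : ∀ f {g h} → g ≈ h → f ⊛ g ≈ f ⊛ h
⊛-congˡ f e = ⊛-cong (≈-refl {f}) e

⊛-congʳ : ∀ f {g h} → g ≈ h → g ⊛ f ≈ h ⊛ f
⊛-congʳ f e = ⊛-cong e (≈-refl {f})

scale : ℤ → Series → Series
scale k f n = k *ᶻ f n

⊛-distribʳ-at : ∀ n f g h → ((f ⊕ g) ⊛ h) n ≡ (f ⊛ h) n +ᶻ (g ⊛ h) n
⊛-distribʳ-at zero    f g h = ℤₚ.*-distribʳ-+ (h 0) (f 0) (g 0)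
⊛-distribʳ-at (suc n) f g h = trans
  (cong ((f 0 +ᶻ g 0) *ᶻ h (suc n) +ᶻ_) (⊛-distribʳ-at n (tail f) (tail g) h))
  (solve 5 (λ a b c d e → (a :+ b) :* c :+ (d :+ e) := (a :* c :+ d) :+ (b :* c :+ e)) refl
    (f 0) (g 0) (h (suc n)) _ _)
  where open ℤSolver

scale-⊛-at : ∀ n k f g → (scale k f ⊛ g) n ≡ k *ᶻ (f ⊛ g) n
scale-⊛-at zero    k f g = ℤₚ.*-assoc k (f 0) (g 0)
scale-⊛-at (suc n) k f g = trans
  (cong (k *ᶻ f 0 *ᶻ g (suc n) +ᶻ_) (scale-⊛-at n k (tail f) g))
  (solve 4 (λ k a b c → k :* a :* b :+ k :* c := k :* (a :* b :+ c)) refl k (f 0) (g (suc n)) _)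
  where open ℤSolver

⊛-suc-at : ∀ n f g → (f ⊛ g) (suc n) ≡ f (suc n) *ᶻ g 0 +ᶻ (f ⊛ tail g) n
⊛-suc-at zero    f g = ℤₚ.+-comm (f 0 *ᶻ g 1) (f 1 *ᶻ g 0)
⊛-suc-at (suc n) f g = trans
  (cong (f 0 *ᶻ g (suc (suc n)) +ᶻ_) (⊛-suc-at n (tail f) g))
  (solve 3 (λ a b c → a :+ (b :+ c) := b :+ (a :+ c)) refl
    (f 0 *ᶻ g (suc (suc n))) (f (suc (suc n)) *ᶻ g 0) _)
  where open ℤSolver

⊛-comm-at : ∀ n f g → (f ⊛ g) n ≡ (g ⊛ f) n
⊛-comm-at zero    f g = ℤₚ.*-comm (f 0) (g 0)
⊛-comm-at (suc n) f g = trans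
  (cong₂ _+ᶻ_ (ℤₚ.*-comm (f 0) (g (suc n))) (⊛-comm-at n (tail f) g))
  (sym (⊛-suc-at n g f))

⊛-assoc-at : ∀ n f g h → ((f ⊛ g) ⊛ h) n ≡ (f ⊛ (g ⊛ h)) n
⊛-assoc-at zero    f g h = ℤₚ.*-assoc (f 0) (g 0) (h 0)
⊛-assoc-at (suc n) f g h = begin
  f 0 *ᶻ g 0 *ᶻ h (suc n) +ᶻ ((scale (f 0) (tail g) ⊕ (tail f ⊛ g)) ⊛ h) n
    ≡⟨ cong (f 0 *ᶻ g 0 *ᶻ h (suc n) +ᶻ_) (⊛-distribʳ-at n (scale (f 0) (tail g)) (tail f ⊛ g) h) ⟩
  f 0 *ᶻ g 0 *ᶻ h (suc n) +ᶻ ((scale (f 0) (tail g) ⊛ h) n +ᶻ ((tail f ⊛ g) ⊛ h) n)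
    ≡⟨ cong₂ (λ x y → f 0 *ᶻ g 0 *ᶻ h (suc n) +ᶻ (x +ᶻ y))
         (scale-⊛-at n (f 0) (tail g) h) (⊛-assoc-at n (tail f) g h) ⟩
  f 0 *ᶻ g 0 *ᶻ h (suc n) +ᶻ (f 0 *ᶻ (tail g ⊛ h) n +ᶻ (tail f ⊛ (g ⊛ h)) n)
    ≡⟨ solve 5 (λ a b c d e → a :* b :* c :+ (a :* d :+ e) := a :* (b :* c :+ d) :+ e) refl
         (f 0) (g 0) (h (suc n)) _ _ ⟩
  f 0 *ᶻ (g 0 *ᶻ h (suc n) +ᶻ (tail g ⊛ h) n) +ᶻ (tail f ⊛ (g ⊛ h)) n ∎
  where open ≡-Reasoning
        open ℤSolver

⊛-zeroˡ-at : ∀ n f → (const 0ℤ ⊛ f) n ≡ 0ℤ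
⊛-zeroˡ-at zero    f = refl
⊛-zeroˡ-at (suc n) f = trans (ℤₚ.+-identityˡ _)
  (trans (⊛-at-cong n {g = f} (λ { zero _ → refl ; (suc _) _ → refl }) (λ _ _ → refl)) (⊛-zeroˡ-at n f))

const-⊛-at : ∀ k f n → (const k ⊛ f) n ≡ k *ᶻ f n
const-⊛-at k f zero    = refl
const-⊛-at k f (suc n) = trans
  (cong (k *ᶻ f (suc n) +ᶻ_)
    (trans (⊛-at-cong n {g = f} (λ { zero _ → refl ; (suc _) _ → refl }) (λ _ _ → refl)) (⊛-zeroˡ-at n f)))
  (ℤₚ.+-identityʳ _)

⊛-identityˡ : ∀ f → const 1ℤ ⊛ f ≈ f
⊛-identityˡ f = pointwise λ n → trans (const-⊛-at 1ℤ f n) (ℤₚ.*-identityˡ (f n))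

⊛-comm : ∀ f g → f ⊛ g ≈ g ⊛ f
⊛-comm f g = pointwise λ n → ⊛-comm-at n f g

⊛-distribʳ : ∀ h f g → (f ⊕ g) ⊛ h ≈ (f ⊛ h) ⊕ (g ⊛ h)
⊛-distribʳ h f g = pointwise λ n → ⊛-distribʳ-at n f g h

⊕-identityˡ : ∀ f → const 0ℤ ⊕ f ≈ f
⊕-identityˡ f = pointwise λ { zero → ℤₚ.+-identityˡ (f 0) ; (suc n) → ℤₚ.+-identityˡ (f (suc n)) }

⊕-comm : ∀ f g → f ⊕ g ≈ g ⊕ f
⊕-comm f g = pointwise λ n → ℤₚ.+-comm (f n) (g n)

⊖-inverseˡ : ∀ f → (⊖ f) ⊕ f ≈ const 0ℤ
⊖-inverseˡ f = pointwise λ { zero → ℤₚ.+-inverseˡ (f 0) ; (suc n) → ℤₚ.+-inverseˡ (f (suc n)) }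

≈-isEquivalence : IsEquivalence _≈_
≈-isEquivalence = record { refl = ≈-refl ; sym = ≈-sym ; trans = ≈-trans }

⊕-⊛-isCommutativeRing : IsCommutativeRing _≈_ _⊕_ _⊛_ ⊖_ (const 0ℤ) (const 1ℤ)
⊕-⊛-isCommutativeRing = record
  { isRing = record
    { +-isAbelianGroup = record
      { isGroup = record
        { isMonoid = record
          { isSemigroup = record
            { isMagma = record { isEquivalence = ≈-isEquivalence ; ∙-cong = ⊕-cong }
            ; assoc = λ f g h → pointwise λ n → ℤₚ.+-assoc (f n) (g n) (h n)
            }
          ; identity = ⊕-identityˡ , λ f → ≈-trans (⊕-comm f _) (⊕-identityˡ f)
          }
        ; inverse = ⊖-inverseˡ , λ f → ≈-trans (⊕-comm f _) (⊖-inverseˡ f)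
        ; ⁻¹-cong = ⊖-cong
        }
      ; comm = ⊕-comm
      }
    ; *-cong = ⊛-cong
    ; *-assoc = λ f g h → pointwise λ n → ⊛-assoc-at n f g h
    ; *-identity = ⊛-identityˡ , λ f → ≈-trans (⊛-comm f _) (⊛-identityˡ f)
    ; distrib = (λ h f g → ≈-trans (⊛-comm h _) (≈-trans (⊛-distribʳ h f g)
                  (⊕-cong (⊛-comm f h) (⊛-comm g h))))
              , ⊛-distribʳ
    }
  ; *-comm = ⊛-comm
  }

seriesRing : CommutativeRing _ _
seriesRing = record { isCommutativeRing = ⊕-⊛-isCommutativeRing }

open CommutativeRing seriesRing using () renaming (setoid to ≈-setoid; semiring to seriesSemiring; commutativeSemiring to seriesCommutativeSemiring)
open import Algebra.Properties.Semiring.Exp seriesSemiring using () renaming (_^_ to _^ˢ_; ^-homo-* to ^ˢ-homo-*)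
open import Algebra.Properties.CommutativeSemiring.Exp seriesCommutativeSemiring using () renaming (^-distrib-* to ^ˢ-distrib-⊛)

-- With ℤ as the coefficient ring, the solver computes with numerals `const k` instead of treating
-- them as atoms.
const-morphism : CommutativeRing.rawRing ℤₚ.+-*-commutativeRing -Raw-AlmostCommutative⟶ fromCommutativeRing seriesRing
const-morphism = record
  { ⟦_⟧    = const
  ; +-homo = λ j k → pointwise λ { zero → refl ; (suc _) → refl }
  ; *-homo = λ j k → pointwise λ { zero → refl
                                 ; (suc n) → sym (trans (const-⊛-at j (const k) (suc n)) (ℤₚ.*-zeroʳ j)) }
  ; -‿homo = λ j → pointwise λ { zero → refl ; (suc _) → refl }
  ; 0-homo = ≈-refl
  ; 1-homo = ≈-refl
  }

const-≈? : ∀ j k → Maybe (const j ≈ const k)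
const-≈? j k = Maybe.map (λ { refl → ≈-refl }) (dec⇒maybe (j ≟ᶻ k))

module SeriesSolver = RingSolver
  (CommutativeRing.rawRing ℤₚ.+-*-commutativeRing) (fromCommutativeRing seriesRing) const-morphism const-≈?

-- Truncated equality and limits

infix 4 _≈[_]_
-- Congruence modulo q^(n+1).
record _≈[_]_ (f : Series) (n : ℕ) (g : Series) : Set where
  constructor pointwise
  field at≤ : ∀ i → i ≤ n → f i ≡ g i
open _≈[_]_

≈[]-setoid : ℕ → Setoid _ _
≈[]-setoid n = record
  { Carrier = Series
  ; _≈_ = λ f g → f ≈[ n ] g
  ; isEquivalence = record
    { refl = pointwise λ _ _ → refl
    ; sym = λ e → pointwise λ i i≤n → sym (at≤ e i i≤n)
    ; trans = λ e e′ → pointwise λ i i≤n → trans (at≤ e i i≤n) (at≤ e′ i i≤n)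
    }
  }

module _ {n : ℕ} where
  open Setoid (≈[]-setoid n) public using () renaming (refl to ≈[]-refl; sym to ≈[]-sym; trans to ≈[]-trans)

≈⇒≈[] : ∀ {n f g} → f ≈ g → f ≈[ n ] g
≈⇒≈[] e = pointwise λ i _ → at e i

≈[]⇒≈ : ∀ {f g} → (∀ n → f ≈[ n ] g) → f ≈ g
≈[]⇒≈ e = pointwise λ n → at≤ (e n) n ℕₚ.≤-refl

≈[]-weaken : ∀ {m n f g} → m ≤ n → f ≈[ n ] g → f ≈[ m ] g
≈[]-weaken m≤n e = pointwise λ i i≤m → at≤ e i (ℕₚ.≤-trans i≤m m≤n)

⊕-cong[] : ∀ {n f f′ g g′} → f ≈[ n ] f′ → g ≈[ n ] g′ → f ⊕ g ≈[ n ] f′ ⊕ g′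
⊕-cong[] e e′ = pointwise λ i i≤n → cong₂ _+ᶻ_ (at≤ e i i≤n) (at≤ e′ i i≤n)

⊛-cong[] : ∀ {n f f′ g g′} → f ≈[ n ] f′ → g ≈[ n ] g′ → f ⊛ g ≈[ n ] f′ ⊛ g′
⊛-cong[] e e′ = pointwise λ i i≤n → ⊛-at-cong i
  (λ j j≤i → at≤ e j (ℕₚ.≤-trans j≤i i≤n)) (λ j j≤i → at≤ e′ j (ℕₚ.≤-trans j≤i i≤n))

^-cong[] : ∀ {n f f′} k → f ≈[ n ] f′ → f ^ˢ k ≈[ n ] f′ ^ˢ k
^-cong[] zero    e = ≈[]-refl
^-cong[] (suc k) e = ⊛-cong[] e (^-cong[] k e)

^-cong : ∀ {f f′} k → f ≈ f′ → f ^ˢ k ≈ f′ ^ˢ k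
^-cong k e = ≈[]⇒≈ λ n → ^-cong[] k (≈⇒≈[] e)

-- The diagonal is the q-adic limit as soon as `u` is coherent, since coefficient i no longer
-- changes from `u i` on.
limit : (ℕ → Series) → Series
limit u n = u n n

Coherent : (ℕ → Series) → Set
Coherent u = ∀ n → u (suc n) ≈[ n ] u n

limit-≈[] : ∀ {u} → Coherent u → ∀ n → limit u ≈[ n ] u n
limit-≈[] {u} coh n = pointwise λ i i≤n →
  sym (subst (λ m → u m i ≡ u i i) (ℕₚ.m∸n+n≡m i≤n) (stable i (n ∸ i)))
  where
  stable : ∀ i k → u (k + i) i ≡ u i i
  stable i zero    = refl
  stable i (suc k) = trans (at≤ (coh (k + i)) i (ℕₚ.m≤n+m i k)) (stable i k)

q : Series
q zero          = 0ℤ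
q (suc zero)    = 1ℤ
q (suc (suc _)) = 0ℤ

const-1-shift : ∀ n → const 1ℤ n ≡ q (suc n)
const-1-shift zero    = refl
const-1-shift (suc n) = refl

q⊛-suc : ∀ f n → (q ⊛ f) (suc n) ≡ f n
q⊛-suc f n = trans (ℤₚ.+-identityˡ _)
  (trans (⊛-at-cong n {g = f} (λ { zero _ → refl ; (suc _) _ → refl }) (λ _ _ → refl)) (at (⊛-identityˡ f) n))

⊛-assoc : ∀ f g h → (f ⊛ g) ⊛ h ≈ f ⊛ (g ⊛ h)
⊛-assoc f g h = pointwise λ n → ⊛-assoc-at n f g h

q^⊛-below : ∀ k f {i} → i < k → (q ^ˢ k ⊛ f) i ≡ 0ℤ
q^⊛-below (suc k) f {zero}  _         = trans (at (⊛-assoc q (q ^ˢ k) f) 0) refl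
q^⊛-below (suc k) f {suc i} (s≤s i<k) =
  trans (at (⊛-assoc q (q ^ˢ k) f) (suc i)) (trans (q⊛-suc (q ^ˢ k ⊛ f) i) (q^⊛-below k f i<k))

q^⊛-shift : ∀ k f i → (q ^ˢ k ⊛ f) (k + i) ≡ f i
q^⊛-shift zero    f i = at (⊛-identityˡ f) i
q^⊛-shift (suc k) f i =
  trans (at (⊛-assoc q (q ^ˢ k) f) (suc (k + i))) (trans (q⊛-suc (q ^ˢ k ⊛ f) (k + i)) (q^⊛-shift k f i))

q-cancel : ∀ {f g} → q ⊛ f ≈ q ⊛ g → f ≈ g
q-cancel {f} {g} e = pointwise λ n → trans (sym (q⊛-suc f n)) (trans (at e (suc n)) (q⊛-suc g n))

-- Orders of vanishing and cancellation

Vanish : ℕ → Series → Set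
Vanish n f = ∀ i → i ≤ n → f i ≡ 0ℤ

Vanish-suc : ∀ {n f} → Vanish n f → f (suc n) ≡ 0ℤ → Vanish (suc n) f
Vanish-suc {n} v e i i≤1+n with ℕₚ.m≤n⇒m<n∨m≡n i≤1+n
... | inj₁ (s≤s i≤n) = v i i≤n
... | inj₂ refl      = e

⊛-vanish : ∀ {n V} g → Vanish n V → Vanish n (g ⊛ V)
⊛-vanish g v zero    0≤n   = trans (cong (g 0 *ᶻ_) (v 0 0≤n)) (ℤₚ.*-zeroʳ (g 0))
⊛-vanish {n} g v (suc i) 1+i≤n = cong₂ _+ᶻ_
  (trans (cong (g 0 *ᶻ_) (v (suc i) 1+i≤n)) (ℤₚ.*-zeroʳ (g 0)))
  (⊛-vanish (tail g) v i (ℕₚ.<⇒≤ 1+i≤n))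

⊛-leading : ∀ {n V} g → Vanish n V → (g ⊛ V) (suc n) ≡ g 0 *ᶻ V (suc n)
⊛-leading {n} {V} g v =
  trans (cong (g 0 *ᶻ V (suc n) +ᶻ_) (⊛-vanish (tail g) v n ℕₚ.≤-refl)) (ℤₚ.+-identityʳ _)

*-zero-cancelˡ : ∀ {i} j → i ≢ 0ℤ → i *ᶻ j ≡ 0ℤ → j ≡ 0ℤ
*-zero-cancelˡ {i} j i≢0 ij≡0 = [ (λ i≡0 → contradiction i≡0 i≢0) , id ]′ (ℤₚ.i*j≡0⇒i≡0∨j≡0 i ij≡0)

-- A nonzero series has an order.
≈0-induction : ∀ {V} → V 0 ≡ 0ℤ → (∀ n → Vanish n V → V (suc n) ≡ 0ℤ) → V ≈ const 0ℤ
≈0-induction {V} base step = pointwise λ { zero → base ; (suc n) → vanish (suc n) (suc n) ℕₚ.≤-refl }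
  where
  vanish : ∀ n → Vanish n V
  vanish zero    zero z≤n = base
  vanish (suc n) = Vanish-suc (vanish n) (step n (vanish n))

-- ℤ is a domain, so the lowest coefficient of the product is `g 0` times that of `V`. Non-units
-- such as 8 or f₂ · 4 can thus be cancelled.
⊛-zero-cancelˡ : ∀ g {V} → g 0 ≢ 0ℤ → g ⊛ V ≈ const 0ℤ → V ≈ const 0ℤ
⊛-zero-cancelˡ g {V} g₀≢0 gV≈0 = ≈0-induction
  (*-zero-cancelˡ (V 0) g₀≢0 (at gV≈0 0))
  (λ n v → *-zero-cancelˡ (V (suc n)) g₀≢0 (trans (sym (⊛-leading g v)) (at gV≈0 (suc n))))

x⊖y≈0⇒x≈y : ∀ {f g} → f ⊕ (⊖ g) ≈ const 0ℤ → f ≈ g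
x⊖y≈0⇒x≈y {f} {g} e = begin
  f               ≈⟨ solve 2 (λ f g → f := (f :- g) :+ g) ≈-refl f g ⟩
  f ⊕ (⊖ g) ⊕ g   ≈⟨ ⊕-cong e ≈-refl ⟩
  const 0ℤ ⊕ g    ≈⟨ ⊕-identityˡ g ⟩
  g               ∎
  where open SetoidReasoning ≈-setoid
        open SeriesSolver

x≈y⇒x⊖y≈0 : ∀ {f g} → f ≈ g → f ⊕ (⊖ g) ≈ const 0ℤ
x≈y⇒x⊖y≈0 {f} {g} e = ≈-trans (⊕-cong e ≈-refl) (≈-trans (⊕-comm g (⊖ g)) (⊖-inverseˡ g))

⊛-cancelˡ : ∀ g {f h} → g 0 ≢ 0ℤ → g ⊛ f ≈ g ⊛ h → f ≈ h
⊛-cancelˡ g {f} {h} g₀≢0 e = x⊖y≈0⇒x≈y (⊛-zero-cancelˡ g g₀≢0 (≈-trans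
  (solve 3 (λ f g h → g :* (f :- h) := g :* f :- g :* h) ≈-refl f g h) (x≈y⇒x⊖y≈0 e)))
  where open SeriesSolver

-- The derivation q d/dq

D : Series → Series
D f n = + n *ᶻ f n

D-cong : ∀ {f g} → f ≈ g → D f ≈ D g
D-cong e = pointwise λ n → cong (+ n *ᶻ_) (at e n)

D-suc : ∀ f n → D f (suc n) ≡ f (suc n) +ᶻ D (tail f) n
D-suc f n = ℤₚ.suc-* (+ n) (f (suc n))

D-⊛-at : ∀ n f g → D (f ⊛ g) n ≡ (D f ⊛ g) n +ᶻ (f ⊛ D g) n
D-⊛-at zero f g = sym (trans (ℤₚ.+-identityˡ _) (ℤₚ.*-zeroʳ (f 0)))
D-⊛-at (suc n) f g = begin
  D (f ⊛ g) (suc n)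
    ≡⟨ D-suc (f ⊛ g) n ⟩
  f 0 *ᶻ g (suc n) +ᶻ (tail f ⊛ g) n +ᶻ (+ n) *ᶻ (f 0 *ᶻ g (suc n) +ᶻ (tail f ⊛ g) n)
    ≡⟨ cong (f 0 *ᶻ g (suc n) +ᶻ (tail f ⊛ g) n +ᶻ_) (ℤₚ.*-distribˡ-+ (+ n) _ _) ⟩
  f 0 *ᶻ g (suc n) +ᶻ (tail f ⊛ g) n +ᶻ ((+ n) *ᶻ (f 0 *ᶻ g (suc n)) +ᶻ D (tail f ⊛ g) n)
    ≡⟨ cong (λ z → f 0 *ᶻ g (suc n) +ᶻ (tail f ⊛ g) n +ᶻ ((+ n) *ᶻ (f 0 *ᶻ g (suc n)) +ᶻ z)) (D-⊛-at n (tail f) g) ⟩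
  f 0 *ᶻ g (suc n) +ᶻ (tail f ⊛ g) n +ᶻ ((+ n) *ᶻ (f 0 *ᶻ g (suc n)) +ᶻ ((D (tail f) ⊛ g) n +ᶻ (tail f ⊛ D g) n))
    ≡⟨ solve 6 (λ m a b c d e → a :* b :+ c :+ (m :* (a :* b) :+ (d :+ e))
          := con 0ℤ :+ (c :+ d) :+ (a :* (b :+ m :* b) :+ e)) refl
          (+ n) (f 0) (g (suc n)) ((tail f ⊛ g) n) ((D (tail f) ⊛ g) n) ((tail f ⊛ D g) n) ⟩
  0ℤ +ᶻ ((tail f ⊛ g) n +ᶻ (D (tail f) ⊛ g) n) +ᶻ (f 0 *ᶻ (g (suc n) +ᶻ D (tail g) n) +ᶻ (tail f ⊛ D g) n)
    ≡⟨ cong₂ (λ x y → 0ℤ +ᶻ x +ᶻ (f 0 *ᶻ y +ᶻ (tail f ⊛ D g) n))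
         (trans (sym (⊛-distribʳ-at n (tail f) (D (tail f)) g))
           (⊛-at-cong n {g = g} (λ i _ → sym (D-suc f i)) (λ _ _ → refl)))
         (sym (D-suc g n)) ⟩
  (D f ⊛ g) (suc n) +ᶻ (f ⊛ D g) (suc n) ∎
  where open ≡-Reasoning
        open ℤSolver

D-⊛ : ∀ f g → D (f ⊛ g) ≈ D f ⊛ g ⊕ f ⊛ D g
D-⊛ f g = pointwise λ n → D-⊛-at n f g

D-const : ∀ k → D (const k) ≈ const 0ℤ
D-const k = pointwise λ { zero → refl ; (suc n) → ℤₚ.*-zeroʳ (+ suc n) }

D-^ : ∀ f k → D (f ^ˢ suc k) ≈ const (+ suc k) ⊛ (f ^ˢ k ⊛ D f)
D-^ f zero    = begin
  D (f ⊛ const 1ℤ)                     ≈⟨ D-cong (≈-trans (⊛-comm f _) (⊛-identityˡ f)) ⟩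
  D f                                  ≈⟨ solve 1 (λ x → x := con 1ℤ :* (con 1ℤ :* x)) ≈-refl (D f) ⟩
  const 1ℤ ⊛ (const 1ℤ ⊛ D f)          ∎
  where open SetoidReasoning ≈-setoid
        open SeriesSolver
D-^ f (suc k) = begin
  D (f ⊛ f ^ˢ suc k)
    ≈⟨ D-⊛ f (f ^ˢ suc k) ⟩
  D f ⊛ f ^ˢ suc k ⊕ f ⊛ D (f ^ˢ suc k)
    ≈⟨ ⊕-cong (≈-refl {D f ⊛ f ^ˢ suc k}) (⊛-cong (≈-refl {f}) (D-^ f k)) ⟩
  D f ⊛ (f ⊛ f ^ˢ k) ⊕ f ⊛ (const (+ suc k) ⊛ (f ^ˢ k ⊛ D f))
    ≈⟨ solve 4 (λ d f g c → d :* (f :* g) :+ f :* (c :* (g :* d)) := (con 1ℤ :+ c) :* (f :* g :* d))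
         ≈-refl (D f) f (f ^ˢ k) (const (+ suc k)) ⟩
  (const 1ℤ ⊕ const (+ suc k)) ⊛ (f ⊛ f ^ˢ k ⊛ D f)
    ≈⟨ ⊛-cong (pointwise λ { zero → refl ; (suc _) → refl }) ≈-refl ⟩
  const (+ suc (suc k)) ⊛ (f ^ˢ suc k ⊛ D f) ∎
  where open SetoidReasoning ≈-setoid
        open SeriesSolver

-- neg f is f(−q) and sub₂ f is f(q²).
neg : Series → Series
neg f zero    = f 0
neg f (suc n) = -ᶻ neg (tail f) n

sub₂ : Series → Series
sub₂ f zero          = f 0
sub₂ f (suc zero)    = 0ℤ
sub₂ f (suc (suc n)) = sub₂ (tail f) n

neg-at-cong : ∀ n {f g} → f ≈[ n ] g → neg f n ≡ neg g n
neg-at-cong zero    e = at≤ e 0 z≤n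
neg-at-cong (suc n) e = cong -ᶻ_ (neg-at-cong n (pointwise λ i i≤n → at≤ e (suc i) (s≤s i≤n)))

neg-cong[] : ∀ {n f g} → f ≈[ n ] g → neg f ≈[ n ] neg g
neg-cong[] e = pointwise λ i i≤n → neg-at-cong i (≈[]-weaken i≤n e)

neg-cong : ∀ {f g} → f ≈ g → neg f ≈ neg g
neg-cong e = pointwise λ n → neg-at-cong n (≈⇒≈[] e)

neg-⊕-at : ∀ n f g → neg (f ⊕ g) n ≡ neg f n +ᶻ neg g n
neg-⊕-at zero    f g = refl
neg-⊕-at (suc n) f g = trans (cong -ᶻ_ (neg-⊕-at n (tail f) (tail g))) (ℤₚ.neg-distrib-+ (neg (tail f) n) (neg (tail g) n))

neg-⊕ : ∀ f g → neg (f ⊕ g) ≈ neg f ⊕ neg g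
neg-⊕ f g = pointwise λ n → neg-⊕-at n f g

neg-scale-at : ∀ n k f → neg (λ i → k *ᶻ f i) n ≡ k *ᶻ neg f n
neg-scale-at zero    k f = refl
neg-scale-at (suc n) k f = trans (cong -ᶻ_ (neg-scale-at n k (tail f))) (ℤₚ.neg-distribʳ-* k _)

neg-⊛-at : ∀ n f g → neg (f ⊛ g) n ≡ (neg f ⊛ neg g) n
neg-⊛-at zero    f g = refl
neg-⊛-at (suc n) f g = begin
  -ᶻ neg ((λ i → f 0 *ᶻ tail g i) ⊕ (tail f ⊛ g)) n
    ≡⟨ cong -ᶻ_ (neg-⊕-at n (λ i → f 0 *ᶻ tail g i) (tail f ⊛ g)) ⟩
  -ᶻ (neg (λ i → f 0 *ᶻ tail g i) n +ᶻ neg (tail f ⊛ g) n)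
    ≡⟨ cong₂ (λ x y → -ᶻ (x +ᶻ y)) (neg-scale-at n (f 0) (tail g)) (neg-⊛-at n (tail f) g) ⟩
  -ᶻ (f 0 *ᶻ neg (tail g) n +ᶻ (neg (tail f) ⊛ neg g) n)
    ≡⟨ solve 3 (λ a b c → :- (a :* b :+ c) := a :* (:- b) :+ con (-1ℤ) :* c) refl (f 0) _ _ ⟩
  f 0 *ᶻ neg g (suc n) +ᶻ -1ℤ *ᶻ (neg (tail f) ⊛ neg g) n
    ≡⟨ cong (f 0 *ᶻ neg g (suc n) +ᶻ_) (sym (scale-⊛-at n -1ℤ (neg (tail f)) (neg g))) ⟩
  f 0 *ᶻ neg g (suc n) +ᶻ ((λ i → -1ℤ *ᶻ neg (tail f) i) ⊛ neg g) n
    ≡⟨ cong (f 0 *ᶻ neg g (suc n) +ᶻ_)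
         (⊛-at-cong n {g = neg g} (λ i _ → ℤₚ.-1*i≡-i (neg (tail f) i)) (λ _ _ → refl)) ⟩
  (neg f ⊛ neg g) (suc n) ∎
  where open ≡-Reasoning
        open ℤSolver

neg-⊛ : ∀ f g → neg (f ⊛ g) ≈ neg f ⊛ neg g
neg-⊛ f g = pointwise λ n → neg-⊛-at n f g

neg-const : ∀ k → neg (const k) ≈ const k
neg-const k = pointwise λ { zero → refl ; (suc n) → cong -ᶻ_ (trans (neg-at-cong n (≈⇒≈[] zeros)) (neg-0 n)) }
  where
  zeros : tail (const k) ≈ const 0ℤ
  zeros = pointwise λ { zero → refl ; (suc _) → refl }
  neg-0 : ∀ n → neg (const 0ℤ) n ≡ 0ℤ
  neg-0 zero    = refl
  neg-0 (suc n) = cong -ᶻ_ (trans (neg-at-cong n (pointwise λ { zero _ → refl ; (suc _) _ → refl })) (neg-0 n))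

neg-q : neg q ≈ ⊖ q
neg-q = pointwise λ { zero → refl
                    ; (suc n) → cong -ᶻ_ (trans (neg-at-cong n (pointwise λ { zero _ → refl ; (suc _) _ → refl }))
                        (trans (at (neg-const 1ℤ) n) (const-1-shift n))) }

neg-⊖ : ∀ f → neg (⊖ f) ≈ ⊖ neg f
neg-⊖ f = pointwise λ n → go n f
  where
  go : ∀ n f → neg (⊖ f) n ≡ -ᶻ neg f n
  go zero    f = refl
  go (suc n) f = cong -ᶻ_ (go n (tail f))

neg-involutive : ∀ f → neg (neg f) ≈ f
neg-involutive f = pointwise λ n → go n f
  where
  go : ∀ n f → neg (neg f) n ≡ f n
  go zero    f = refl
  go (suc n) f = trans (cong -ᶻ_ (at (neg-⊖ (neg (tail f))) n))
    (trans (ℤₚ.neg-involutive _) (go n (tail f)))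

neg-sub₂ : ∀ f → neg (sub₂ f) ≈ sub₂ f
neg-sub₂ f = pointwise λ n → go n f
  where
  go : ∀ n f → neg (sub₂ f) n ≡ sub₂ f n
  go zero          f = refl
  go (suc zero)    f = refl
  go (suc (suc n)) f = trans (ℤₚ.neg-involutive _) (go n (tail f))

sub₂-double : ∀ f n → sub₂ f (n + n) ≡ f n
sub₂-double f zero    = refl
sub₂-double f (suc n) = trans (cong (sub₂ f ∘ suc) (ℕₚ.+-suc n n)) (sub₂-double (tail f) n)

sub₂-cases : ∀ f n → sub₂ f n ≡ 0ℤ ⊎ ∃ λ k → n ≡ k + k × sub₂ f n ≡ f k
sub₂-cases f zero          = inj₂ (0 , refl , refl)
sub₂-cases f (suc zero)    = inj₁ refl
sub₂-cases f (suc (suc n)) with sub₂-cases (tail f) n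
... | inj₁ z = inj₁ z
... | inj₂ (k , n≡k+k , e) = inj₂ (suc k , cong suc (trans (cong suc n≡k+k) (sym (ℕₚ.+-suc k k))) , e)

sub₂-at-cong : ∀ n {f g} → f ≈[ n ] g → sub₂ f n ≡ sub₂ g n
sub₂-at-cong zero          e = at≤ e 0 z≤n
sub₂-at-cong (suc zero)    e = refl
sub₂-at-cong (suc (suc n)) e =
  sub₂-at-cong n (pointwise λ i i≤n → at≤ e (suc i) (s≤s (ℕₚ.m≤n⇒m≤1+n i≤n)))

sub₂-cong[] : ∀ {n f g} → f ≈[ n ] g → sub₂ f ≈[ n ] sub₂ g
sub₂-cong[] e = pointwise λ i i≤n → sub₂-at-cong i (≈[]-weaken i≤n e)

sub₂-cong : ∀ {f g} → f ≈ g → sub₂ f ≈ sub₂ g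
sub₂-cong e = pointwise λ n → sub₂-at-cong n (≈⇒≈[] e)

sub₂-injective : ∀ {f g} → sub₂ f ≈ sub₂ g → f ≈ g
sub₂-injective {f} {g} e = pointwise λ n →
  trans (sym (sub₂-double f n)) (trans (at e (n + n)) (sub₂-double g n))

sub₂-⊕-at : ∀ n f g → sub₂ (f ⊕ g) n ≡ sub₂ f n +ᶻ sub₂ g n
sub₂-⊕-at zero          f g = refl
sub₂-⊕-at (suc zero)    f g = refl
sub₂-⊕-at (suc (suc n)) f g = sub₂-⊕-at n (tail f) (tail g)

sub₂-⊕ : ∀ f g → sub₂ (f ⊕ g) ≈ sub₂ f ⊕ sub₂ g
sub₂-⊕ f g = pointwise λ n → sub₂-⊕-at n f g

sub₂-⊖ : ∀ f → sub₂ (⊖ f) ≈ ⊖ sub₂ f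
sub₂-⊖ f = pointwise λ n → go n f
  where
  go : ∀ n f → sub₂ (⊖ f) n ≡ -ᶻ sub₂ f n
  go zero          f = refl
  go (suc zero)    f = refl
  go (suc (suc n)) f = go n (tail f)

sub₂-scale-at : ∀ n k f → sub₂ (λ i → k *ᶻ f i) n ≡ k *ᶻ sub₂ f n
sub₂-scale-at zero          k f = refl
sub₂-scale-at (suc zero)    k f = sym (ℤₚ.*-zeroʳ k)
sub₂-scale-at (suc (suc n)) k f = sub₂-scale-at n k (tail f)

sub₂-⊛-at : ∀ n f g → sub₂ (f ⊛ g) n ≡ (sub₂ f ⊛ sub₂ g) n
sub₂-⊛-at zero          f g = refl
sub₂-⊛-at (suc zero)    f g = sym (cong (_+ᶻ 0ℤ) (ℤₚ.*-zeroʳ (f 0)))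
sub₂-⊛-at (suc (suc n)) f g = begin
  sub₂ ((λ i → f 0 *ᶻ tail g i) ⊕ (tail f ⊛ g)) n
    ≡⟨ sub₂-⊕-at n (λ i → f 0 *ᶻ tail g i) (tail f ⊛ g) ⟩
  sub₂ (λ i → f 0 *ᶻ tail g i) n +ᶻ sub₂ (tail f ⊛ g) n
    ≡⟨ cong₂ _+ᶻ_ (sub₂-scale-at n (f 0) (tail g))
         (trans (sub₂-⊛-at n (tail f) g) (sym (ℤₚ.+-identityˡ _))) ⟩
  (sub₂ f ⊛ sub₂ g) (suc (suc n)) ∎
  where open ≡-Reasoning

sub₂-⊛ : ∀ f g → sub₂ (f ⊛ g) ≈ sub₂ f ⊛ sub₂ g
sub₂-⊛ f g = pointwise λ n → sub₂-⊛-at n f g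

sub₂-const : ∀ k → sub₂ (const k) ≈ const k
sub₂-const k = pointwise λ { zero → refl ; (suc zero) → refl ; (suc (suc n)) → zeros n }
  where
  zeros : ∀ n → sub₂ (tail (const k)) n ≡ 0ℤ
  zeros zero          = refl
  zeros (suc zero)    = refl
  zeros (suc (suc n)) = zeros n

sub₂-^ : ∀ f k → sub₂ (f ^ˢ k) ≈ sub₂ f ^ˢ k
sub₂-^ f zero    = sub₂-const 1ℤ
sub₂-^ f (suc k) = ≈-trans (sub₂-⊛ f (f ^ˢ k)) (⊛-cong ≈-refl (sub₂-^ f k))

sub₂-q : sub₂ q ≈ q ⊛ q
sub₂-q = pointwise λ { zero → refl ; (suc zero) → refl
                     ; (suc (suc n)) → trans
                         (trans (sub₂-at-cong n (pointwise λ { zero _ → refl ; (suc _) _ → refl }))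
                           (trans (at (sub₂-const 1ℤ) n) (const-1-shift n)))
                         (sym (q⊛-suc q (suc n))) }

-- The chain rule for q ↦ q².
D-sub₂ : ∀ f → D (sub₂ f) ≈ const (+ 2) ⊛ sub₂ (D f)
D-sub₂ f = pointwise λ n → trans (go n) (sym (const-⊛-at (+ 2) (sub₂ (D f)) n))
  where
  D-shift : ∀ n f → sub₂ (D f) (suc (suc n)) ≡ sub₂ f (suc (suc n)) +ᶻ sub₂ (D (tail f)) n
  D-shift n f = trans (sub₂-at-cong n (pointwise λ i _ → D-suc f i)) (sub₂-⊕-at n (tail f) (D (tail f)))
  go′ : ∀ n f → D (sub₂ f) n ≡ + 2 *ᶻ sub₂ (D f) n
  go′ zero          f = refl
  go′ (suc zero)    f = refl
  go′ (suc (suc n)) f = begin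
    D (sub₂ f) (suc (suc n))
      ≡⟨ D-suc (sub₂ f) (suc n) ⟩
    sub₂ (tail f) n +ᶻ D (tail (sub₂ f)) (suc n)
      ≡⟨ cong (sub₂ (tail f) n +ᶻ_) (D-suc (tail (sub₂ f)) n) ⟩
    sub₂ (tail f) n +ᶻ (sub₂ (tail f) n +ᶻ D (sub₂ (tail f)) n)
      ≡⟨ cong (λ z → sub₂ (tail f) n +ᶻ (sub₂ (tail f) n +ᶻ z)) (go′ n (tail f)) ⟩
    sub₂ (tail f) n +ᶻ (sub₂ (tail f) n +ᶻ + 2 *ᶻ sub₂ (D (tail f)) n)
      ≡⟨ solve 2 (λ a b → a :+ (a :+ con (+ 2) :* b) := con (+ 2) :* (a :+ b)) refl (sub₂ (tail f) n) _ ⟩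
    + 2 *ᶻ (sub₂ (tail f) n +ᶻ sub₂ (D (tail f)) n)
      ≡⟨ cong (+ 2 *ᶻ_) (sym (D-shift n f)) ⟩
    + 2 *ᶻ sub₂ (D f) (suc (suc n)) ∎
    where open ≡-Reasoning
          open ℤSolver
  go : ∀ n → D (sub₂ f) n ≡ + 2 *ᶻ sub₂ (D f) n
  go n = go′ n f

-- Order at least n + 1 becomes order at least 2n + 2. This doubling drives both uniqueness
-- arguments, for `V≈0` and for `ψf₁≈f₂²`.
sub₂-vanish : ∀ {n f} → Vanish n f → Vanish (suc (n + n)) (sub₂ f)
sub₂-vanish {n} {f} v i i≤ with sub₂-cases f i
... | inj₁ z = z
... | inj₂ (k , refl , e) = trans e (v k (halve k n i≤))
  where
  halve : ∀ k n → k + k ≤ suc (n + n) → k ≤ n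
  halve zero    n       _ = z≤n
  halve (suc k) zero    (s≤s p) = contradiction (subst (_≤ 0) (ℕₚ.+-suc k k) p) λ ()
  halve (suc k) (suc n) (s≤s p) = s≤s (halve k n
    (ℕₚ.≤-pred (subst₂ _≤_ (ℕₚ.+-suc k k) (cong suc (ℕₚ.+-suc n n)) p)))

-- The pentagonal number theorem

one two : Series
one = const 1ℤ
two = const (+ 2)

≡⇒≈ : ∀ {f g : Series} → f ≡ g → f ≈ g
≡⇒≈ refl = ≈-refl

q^-split : ∀ {k} m n → k ≡ m + n → q ^ˢ k ≈ q ^ˢ m ⊛ q ^ˢ n
q^-split m n refl = ^ˢ-homo-* q m n

1-q^ 1+q^ : ℕ → Series
1-q^ k = one ⊕ (⊖ q ^ˢ k)
1+q^ k = one ⊕ q ^ˢ k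

sgn : ℕ → Series
sgn zero    = one
sgn (suc n) = ⊖ sgn n

tri : ℕ → ℕ
tri zero    = zero
tri (suc n) = suc n + tri n

-- The quotient of partial products P(s + d) / P(s), defined without division.
Q : ℕ → ℕ → Series
Q s zero    = one
Q s (suc d) = Q s d ⊛ 1-q^ (s + suc d)

Q-first : ∀ s d → Q s (suc d) ≈ 1-q^ (suc s) ⊛ Q (suc s) d
Q-first s zero = ≈-trans (⊛-congˡ one (≡⇒≈ (cong 1-q^ (ℕₚ.+-comm s 1)))) (⊛-comm one (1-q^ (suc s)))
Q-first s (suc d) = begin
  Q s (suc d) ⊛ 1-q^ (s + suc (suc d))
    ≈⟨ ⊛-cong (Q-first s d) (≡⇒≈ (cong 1-q^ (ℕₚ.+-suc s (suc d)))) ⟩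
  1-q^ (suc s) ⊛ Q (suc s) d ⊛ 1-q^ (suc s + suc d)
    ≈⟨ ⊛-assoc (1-q^ (suc s)) (Q (suc s) d) (1-q^ (suc s + suc d)) ⟩
  1-q^ (suc s) ⊛ Q (suc s) (suc d) ∎
  where open SetoidReasoning ≈-setoid

-- The terms have s + d = n constant along the sum. Carrying the distance d = n - s to the end as an
-- argument avoids truncated subtraction.
sumFrom : (ℕ → ℕ → Series) → ℕ → ℕ → Series
sumFrom u s zero    = u s zero
sumFrom u s (suc d) = u s (suc d) ⊕ sumFrom u (suc s) d

-- Creative telescoping. With n = s + d, the hypothesis for a single term reads u(n+1, s) + g(n, s)
-- = c(n) u(n, s) + g(n, s+1), so the certificates g cancel in the sum over s. The base case holds
-- the end of the range, where the sum for n + 1 has one term more, and leaves the remainder r(n).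
telescope : (u g : ℕ → ℕ → Series) (c r : ℕ → Series) →
  (∀ s → u s 1 ⊕ u (suc s) 0 ⊕ g s 0 ≈ c (s + 0) ⊛ u s 0 ⊕ r (s + 0)) →
  (∀ s d → u s (suc (suc d)) ⊕ g s (suc d) ≈ c (s + suc d) ⊛ u s (suc d) ⊕ g (suc s) d) →
  ∀ s d → sumFrom u s (suc d) ⊕ g s d ≈ c (s + d) ⊛ sumFrom u s d ⊕ r (s + d)
telescope u g c r base step s zero    = base s
telescope u g c r base step s (suc d) = begin
  u s (suc (suc d)) ⊕ S₁ ⊕ g s (suc d)
    ≈⟨ solve 3 (λ x y z → x :+ y :+ z := (x :+ z) :+ y) ≈-refl (u s (suc (suc d))) S₁ (g s (suc d)) ⟩
  u s (suc (suc d)) ⊕ g s (suc d) ⊕ S₁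
    ≈⟨ ⊕-congʳ S₁ (step s d) ⟩
  c n ⊛ u s (suc d) ⊕ g (suc s) d ⊕ S₁
    ≈⟨ solve 3 (λ x y z → x :+ y :+ z := x :+ (z :+ y)) ≈-refl (c n ⊛ u s (suc d)) (g (suc s) d) S₁ ⟩
  c n ⊛ u s (suc d) ⊕ (S₁ ⊕ g (suc s) d)
    ≈⟨ ⊕-congˡ (c n ⊛ u s (suc d)) (≈-trans (telescope u g c r base step (suc s) d)
         (≡⇒≈ (cong (λ m → c m ⊛ S₀ ⊕ r m) (sym (ℕₚ.+-suc s d))))) ⟩
  c n ⊛ u s (suc d) ⊕ (c n ⊛ S₀ ⊕ r n)
    ≈⟨ solve 4 (λ c x y r → c :* x :+ (c :* y :+ r) := c :* (x :+ y) :+ r) ≈-refl (c n) (u s (suc d)) S₀ (r n) ⟩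
  c n ⊛ (u s (suc d) ⊕ S₀) ⊕ r n ∎
  where
  open SetoidReasoning ≈-setoid
  open SeriesSolver
  n = s + suc d
  S₁ = sumFrom u (suc s) (suc d)
  S₀ = sumFrom u (suc s) d

⊛q^-vanish : ∀ f {n k} → n < k → Vanish n (f ⊛ q ^ˢ k)
⊛q^-vanish f {k = k} n<k i i≤n = trans (at (⊛-comm f (q ^ˢ k)) i) (q^⊛-below k f (ℕₚ.≤-<-trans i≤n n<k))

sumFrom-vanish : (u : ℕ → ℕ → Series) → (∀ s d → Vanish (suc s + d) (u (suc s) d)) →
  ∀ s d → Vanish (suc s + d) (sumFrom u (suc s) d)
sumFrom-vanish u v s zero    = v s zero
sumFrom-vanish u v s (suc d) i i≤ = cong₂ _+ᶻ_ (v s (suc d) i i≤)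
  (sumFrom-vanish u v (suc s) d i (subst (i ≤_) (cong suc (ℕₚ.+-suc s d)) i≤))

⊕-vanish : ∀ {n} f {g} → Vanish n g → f ⊕ g ≈[ n ] f
⊕-vanish f v = pointwise λ i i≤n → trans (cong (f i +ᶻ_) (v i i≤n)) (ℤₚ.+-identityʳ (f i))

P : ℕ → Series
P = Q 0

⊛1-q^-near : ∀ f n → f ⊛ 1-q^ (suc n) ≈[ n ] f
⊛1-q^-near f n = ≈[]-trans
  (≈⇒≈[] (solve 2 (λ f x → f :* (con 1ℤ :- x) := f :+ (:- f) :* x) ≈-refl f (q ^ˢ suc n)))
  (⊕-vanish f (⊛q^-vanish (⊖ f) (ℕₚ.n<1+n n)))
  where open SeriesSolver

P-coherent : Coherent P
P-coherent n = ⊛1-q^-near (P n) n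

f₁ : Series
f₁ = limit P

f₁-≈[] : ∀ n → f₁ ≈[ n ] P n
f₁-≈[] = limit-≈[] P-coherent

-- Shanks' finite form of the pentagonal number theorem.
pentTerm : ℕ → ℕ → Series
pentTerm s d = sgn s ⊛ Q s d ⊛ q ^ˢ (s * (s + d) + tri s)

-- With k = m + 1 the exponents are the generalized pentagonal numbers k(3k - 1)/2 and k(3k + 1)/2.
pent : ℕ → Series
pent m = sgn (suc m) ⊛ (q ^ˢ (suc m * m + tri (suc m)) ⊕ q ^ˢ (suc m * suc m + tri (suc m)))

-- The certificate is (1 - q^s) times the term itself; the multiplier is 1, so the sums for n and n
-- + 1 differ by the remainder once the certificate vanishes at s = 0.
pent-telescope : ∀ s d → sumFrom pentTerm s (suc d) ⊕ 1-q^ s ⊛ pentTerm s d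
  ≈ one ⊛ sumFrom pentTerm s d ⊕ pent (s + d)
pent-telescope = telescope pentTerm (λ s d → 1-q^ s ⊛ pentTerm s d) (λ _ → one) pent base step
  where
  open SetoidReasoning ≈-setoid
  open SeriesSolver
  open ℕSolver.+-*-Solver using () renaming (solve to solveℕ; _:+_ to _⊹_; _:*_ to _✶_; con to conℕ; _:=_ to _≐_)

  base : ∀ s → pentTerm s 1 ⊕ pentTerm (suc s) 0 ⊕ 1-q^ s ⊛ pentTerm s 0
    ≈ one ⊛ pentTerm s 0 ⊕ pent (s + 0)
  base s rewrite ℕₚ.+-identityʳ s = begin
    σ ⊛ (one ⊛ 1-q^ (s + 1)) ⊛ q ^ˢ (s * (s + 1) + tri s)
      ⊕ ⊖ σ ⊛ one ⊛ E₂ ⊕ (one ⊕ ⊖ x) ⊛ (σ ⊛ one ⊛ e)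
      ≈⟨ ⊕-congʳ ((one ⊕ ⊖ x) ⊛ (σ ⊛ one ⊛ e)) (⊕-congʳ (⊖ σ ⊛ one ⊛ E₂)
           (⊛-cong (⊛-congˡ σ (⊛-congˡ one (≡⇒≈ (cong 1-q^ (ℕₚ.+-comm s 1)))))
             (q^-split s (s * s + tri s)
               (solveℕ 2 (λ s t → s ✶ (s ⊹ conℕ 1) ⊹ t ≐ s ⊹ (s ✶ s ⊹ t)) refl s (tri s))))) ⟩
    σ ⊛ (one ⊛ (one ⊕ ⊖ y)) ⊛ (x ⊛ e) ⊕ ⊖ σ ⊛ one ⊛ E₂ ⊕ (one ⊕ ⊖ x) ⊛ (σ ⊛ one ⊛ e)
      ≈⟨ solve 5 (λ σ x y e E → σ :* (con 1ℤ :* (con 1ℤ :- y)) :* (x :* e) :+ (:- σ) :* con 1ℤ :* E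
            :+ (con 1ℤ :- x) :* (σ :* con 1ℤ :* e)
            := con 1ℤ :* (σ :* con 1ℤ :* e) :+ (:- σ) :* (y :* (x :* e) :+ E)) ≈-refl σ x y e E₂ ⟩
    one ⊛ (σ ⊛ one ⊛ e) ⊕ ⊖ σ ⊛ (y ⊛ (x ⊛ e) ⊕ E₂)
      ≈⟨ ⊕-congˡ (one ⊛ (σ ⊛ one ⊛ e)) (⊛-congˡ (⊖ σ) (⊕-congʳ E₂ (≈-sym
           (≈-trans (q^-split (suc s) (s + (s * s + tri s))
             (solveℕ 2 (λ s t → (conℕ 1 ⊹ s) ✶ s ⊹ ((conℕ 1 ⊹ s) ⊹ t) ≐ (conℕ 1 ⊹ s) ⊹ (s ⊹ (s ✶ s ⊹ t))) refl s (tri s)))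
             (⊛-congˡ y (q^-split s (s * s + tri s) refl)))))) ⟩
    one ⊛ (σ ⊛ one ⊛ e) ⊕ pent s ∎
    where
    σ = sgn s
    x = q ^ˢ s
    y = q ^ˢ suc s
    e = q ^ˢ (s * s + tri s)
    E₂ = q ^ˢ (suc s * suc s + tri (suc s))

  step : ∀ s d → pentTerm s (suc (suc d)) ⊕ 1-q^ s ⊛ pentTerm s (suc d)
    ≈ one ⊛ pentTerm s (suc d) ⊕ 1-q^ (suc s) ⊛ pentTerm (suc s) d
  step s d = begin
    σ ⊛ (R ⊛ (one ⊕ ⊖ z)) ⊛ q ^ˢ (s * (s + suc (suc d)) + tri s) ⊕ (one ⊕ ⊖ x) ⊛ (σ ⊛ R ⊛ e)
      ≈⟨ ⊕-congʳ ((one ⊕ ⊖ x) ⊛ (σ ⊛ R ⊛ e)) (⊛-congˡ (σ ⊛ (R ⊛ (one ⊕ ⊖ z))) (q^-split s (s * (s + suc d) + tri s)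
           (solveℕ 3 (λ s d t → s ✶ (s ⊹ (conℕ 2 ⊹ d)) ⊹ t ≐ s ⊹ (s ✶ (s ⊹ (conℕ 1 ⊹ d)) ⊹ t)) refl s d (tri s)))) ⟩
    σ ⊛ (R ⊛ (one ⊕ ⊖ z)) ⊛ (x ⊛ e) ⊕ (one ⊕ ⊖ x) ⊛ (σ ⊛ R ⊛ e)
      ≈⟨ solve 5 (λ σ R x z e → σ :* (R :* (con 1ℤ :- z)) :* (x :* e) :+ (con 1ℤ :- x) :* (σ :* R :* e)
           := con 1ℤ :* (σ :* R :* e) :+ (:- σ) :* R :* (z :* (x :* e))) ≈-refl σ R x z e ⟩
    one ⊛ (σ ⊛ R ⊛ e) ⊕ ⊖ σ ⊛ R ⊛ (z ⊛ (x ⊛ e))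
      ≈⟨ ⊕-congˡ (one ⊛ (σ ⊛ R ⊛ e)) (⊛-cong (⊛-congˡ (⊖ σ) (Q-first s d)) (≈-sym
           (≈-trans (q^-split (s + suc (suc d)) (s + (s * (s + suc d) + tri s))
             (solveℕ 3 (λ s d t → (conℕ 1 ⊹ s) ✶ (conℕ 1 ⊹ s ⊹ d) ⊹ ((conℕ 1 ⊹ s) ⊹ t)
               ≐ (s ⊹ (conℕ 2 ⊹ d)) ⊹ (s ⊹ (s ✶ (s ⊹ (conℕ 1 ⊹ d)) ⊹ t))) refl s d (tri s)))
             (⊛-congˡ z (q^-split s (s * (s + suc d) + tri s) refl))))) ⟩
    one ⊛ (σ ⊛ R ⊛ e) ⊕ ⊖ σ ⊛ (1-q^ (suc s) ⊛ Q (suc s) d) ⊛ q ^ˢ (suc s * (suc s + d) + tri (suc s))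
      ≈⟨ solve 5 (λ a σ c R e → a :+ (:- σ) :* (c :* R) :* e := a :+ c :* ((:- σ) :* R :* e)) ≈-refl
           (one ⊛ (σ ⊛ R ⊛ e)) σ (1-q^ (suc s)) (Q (suc s) d) (q ^ˢ (suc s * (suc s + d) + tri (suc s))) ⟩
    one ⊛ pentTerm s (suc d) ⊕ 1-q^ (suc s) ⊛ pentTerm (suc s) d ∎
    where
    σ = sgn s
    R = Q s (suc d)
    x = q ^ˢ s
    z = q ^ˢ (s + suc (suc d))
    e = q ^ˢ (s * (s + suc d) + tri s)

-- Applied to the certificate at the start s = 0 of a telescoped sum, this leaves only the
-- contribution of the end.
1-q^0⊛ : ∀ f → 1-q^ 0 ⊛ f ≈ const 0ℤ
1-q^0⊛ f = solve 1 (λ f → (con 1ℤ :- con 1ℤ) :* f := con 0ℤ) ≈-refl f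
  where open SeriesSolver

pentSum : ℕ → Series
pentSum n = sumFrom pentTerm 0 n

pentSum-suc : ∀ n → pentSum (suc n) ≈ pentSum n ⊕ pent n
pentSum-suc n = begin
  pentSum (suc n)
    ≈⟨ solve 1 (λ x → x := x :+ con 0ℤ) ≈-refl (pentSum (suc n)) ⟩
  pentSum (suc n) ⊕ const 0ℤ
    ≈⟨ ⊕-congˡ (pentSum (suc n)) (≈-sym (1-q^0⊛ (pentTerm 0 n))) ⟩
  pentSum (suc n) ⊕ 1-q^ 0 ⊛ pentTerm 0 n
    ≈⟨ pent-telescope 0 n ⟩
  one ⊛ pentSum n ⊕ pent n
    ≈⟨ ⊕-congʳ (pent n) (⊛-identityˡ (pentSum n)) ⟩
  pentSum n ⊕ pent n ∎
  where open SetoidReasoning ≈-setoid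
        open SeriesSolver

-- For s ≥ 1 the exponent s(s + d) + s(s + 1)/2 exceeds n = s + d, so only the term P n at s = 0
-- survives modulo q^(n+1).
pentSum-≈[]-P : ∀ n → pentSum n ≈[ n ] P n
pentSum-≈[]-P n = ≈[]-trans (head n) (≈⇒≈[] (solve 1 (λ x → con 1ℤ :* x :* con 1ℤ := x) ≈-refl (P n)))
  where
  open SeriesSolver
  small : ∀ s d → Vanish (suc s + d) (pentTerm (suc s) d)
  small s d = ⊛q^-vanish (sgn (suc s) ⊛ Q (suc s) d) (ℕₚ.≤-trans
    (ℕₚ.≤-reflexive (ℕₚ.+-comm 1 (suc s + d)))
    (ℕₚ.+-mono-≤ (ℕₚ.m≤m+n (suc s + d) (s * (suc s + d))) (s≤s (z≤n {s + tri s}))))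
  head : ∀ n → pentSum n ≈[ n ] pentTerm 0 n
  head zero    = ≈[]-refl
  head (suc n) = ⊕-vanish (pentTerm 0 (suc n)) (sumFrom-vanish pentTerm small 0 n)

-- Exponents of pentagonal type

-- A condition on exponents alone is stable under sums, signs and q ↦ -q, hence passes from the
-- monomials to f₁ and f₁(-q).
PentagonalSupport : Series → Set
PentagonalSupport f = ∀ j → f j ≡ 0ℤ ⊎ ∃ λ u → 24 * j + 1 ≡ u * u

⊕-support : ∀ {f g} → PentagonalSupport f → PentagonalSupport g → PentagonalSupport (f ⊕ g)
⊕-support sf sg j with sf j | sg j
... | inj₂ sq | _       = inj₂ sq
... | inj₁ _  | inj₂ sq = inj₂ sq
... | inj₁ z  | inj₁ z′ = inj₁ (cong₂ _+ᶻ_ z z′)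

≈-support : ∀ {f g} → f ≈ g → PentagonalSupport f → PentagonalSupport g
≈-support e sf j with sf j
... | inj₁ z  = inj₁ (trans (sym (at e j)) z)
... | inj₂ sq = inj₂ sq

⊖-support : ∀ {f} → PentagonalSupport f → PentagonalSupport (⊖ f)
⊖-support sf j with sf j
... | inj₁ z  = inj₁ (cong -ᶻ_ z)
... | inj₂ sq = inj₂ sq

sgn-support : ∀ n {f} → PentagonalSupport f → PentagonalSupport (sgn n ⊛ f)
sgn-support zero    {f} sf = ≈-support (≈-sym (⊛-identityˡ f)) sf
sgn-support (suc n) {f} sf = ≈-support
  (solve 2 (λ s f → :- (s :* f) := (:- s) :* f) ≈-refl (sgn n) f) (⊖-support (sgn-support n sf))
  where open SeriesSolver

neg-support : ∀ {f} → PentagonalSupport f → PentagonalSupport (neg f)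
neg-support {f} sf j with sf j
... | inj₂ sq = inj₂ sq
... | inj₁ z  = inj₁ (go j f z)
  where
  go : ∀ j f → f j ≡ 0ℤ → neg f j ≡ 0ℤ
  go zero    f z = z
  go (suc j) f z = cong -ᶻ_ (go j (tail f) z)

q^-support : ∀ k {u} → 24 * k + 1 ≡ u * u → PentagonalSupport (q ^ˢ k)
q^-support k {u} sq j with go k j
  where
  go : ∀ k j → (q ^ˢ k) j ≡ 0ℤ ⊎ j ≡ k
  go zero    zero    = inj₂ refl
  go zero    (suc j) = inj₁ refl
  go (suc k) zero    = inj₁ refl
  go (suc k) (suc j) with go k j
  ... | inj₁ z = inj₁ (trans (q⊛-suc (q ^ˢ k) j) z)
  ... | inj₂ e = inj₂ (cong suc e)
... | inj₁ z    = inj₁ z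
... | inj₂ refl = inj₂ (u , sq)

2*tri : ∀ n → tri n + tri n ≡ n * suc n
2*tri zero    = refl
2*tri (suc n) = trans (solve 2 (λ n t → (con 1 :+ n :+ t) :+ (con 1 :+ n :+ t) := (t :+ t) :+ (con 2 :+ (n :+ n))) refl n (tri n))
  (trans (cong (_+ (2 + (n + n))) (2*tri n))
    (solve 1 (λ n → n :* (con 1 :+ n) :+ (con 2 :+ (n :+ n)) := (con 1 :+ n) :* (con 2 :+ n)) refl n))
  where open ℕSolver.+-*-Solver

-- Completing the square: 24 · k(3k ∓ 1)/2 + 1 = (6k ∓ 1)² with k = m + 1, which gives the roots 5 +
-- 6m and 7 + 6m.
pent-support : ∀ m → PentagonalSupport (pent m)
pent-support m = sgn-support (suc m) (⊕-support
  (q^-support (suc m * m + tri (suc m)) {5 + 6 * m} (complete-square (suc m * m)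
    (solve 1 (λ m → con 24 :* ((con 1 :+ m) :* m) :+ con 12 :* ((con 1 :+ m) :* (con 2 :+ m)) :+ con 1
      := (con 5 :+ con 6 :* m) :* (con 5 :+ con 6 :* m)) refl m)))
  (q^-support (suc m * suc m + tri (suc m)) {7 + 6 * m} (complete-square (suc m * suc m)
    (solve 1 (λ m → con 24 :* ((con 1 :+ m) :* (con 1 :+ m)) :+ con 12 :* ((con 1 :+ m) :* (con 2 :+ m)) :+ con 1
      := (con 7 :+ con 6 :* m) :* (con 7 :+ con 6 :* m)) refl m))))
  where
  open ℕSolver.+-*-Solver
  -- Since 24 = 12 · 2, the triangular number enters only through its double, a polynomial in m.
  complete-square : ∀ a {v} → 24 * a + 12 * (suc m * suc (suc m)) + 1 ≡ v → 24 * (a + tri (suc m)) + 1 ≡ v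
  complete-square a e = trans
    (solve 2 (λ a t → con 24 :* (a :+ t) :+ con 1 := con 24 :* a :+ con 12 :* (t :+ t) :+ con 1) refl a (tri (suc m)))
    (trans (cong (λ z → 24 * a + 12 * z + 1) (2*tri (suc m))) e)

f₁-support : PentagonalSupport f₁
f₁-support j with pentSum-support j j
  where
  pentSum-support : ∀ n → PentagonalSupport (pentSum n)
  pentSum-support zero    = ≈-support (solve 1 (λ x → x := con 1ℤ :* con 1ℤ :* x) ≈-refl one) (q^-support 0 {1} refl)
    where open SeriesSolver
  pentSum-support (suc n) = ≈-support (≈-sym (pentSum-suc n)) (⊕-support (pentSum-support n) (pent-support n))
... | inj₁ z  = inj₁ (trans (sym (at≤ (pentSum-≈[]-P j) j ℕₚ.≤-refl)) z)
... | inj₂ sq = inj₂ sq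

-- Theta functions

-- The factor 2 at k = 0 spares the telescoping of gaussTerm a separate case s = 0.
M : ℕ → Series
M zero    = one
M (suc n) = 1+q^ n ⊛ M n

P⁺ : ℕ → Series
P⁺ zero    = one
P⁺ (suc n) = P⁺ n ⊛ 1+q^ (suc n)

M-suc : ∀ n → M (suc n) ≈ two ⊛ P⁺ n
M-suc zero    = solve 0 ((con 1ℤ :+ con 1ℤ) :* con 1ℤ := con (+ 2) :* con 1ℤ) ≈-refl
  where open SeriesSolver
M-suc (suc n) = begin
  1+q^ (suc n) ⊛ M (suc n)         ≈⟨ ⊛-congˡ (1+q^ (suc n)) (M-suc n) ⟩
  1+q^ (suc n) ⊛ (two ⊛ P⁺ n)      ≈⟨ solve 3 (λ a b c → a :* (b :* c) := b :* (c :* a)) ≈-refl (1+q^ (suc n)) two (P⁺ n) ⟩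
  two ⊛ P⁺ (suc n)                 ∎
  where open SetoidReasoning ≈-setoid
        open SeriesSolver

-- Summand of a finite form of Gauss' φ(-q) = ∏ (1 - q^k)/(1 + q^k). With n = s + d fixed, the sum
-- is `P⁺ n ⊛ altSquares n` exactly, while modulo q^(n+1) it is P n.
gaussTerm : ℕ → ℕ → Series
gaussTerm s d = sgn s ⊛ Q s d ⊛ M s ⊛ q ^ˢ (s * suc (s + d))

gaussLast : ℕ → Series
gaussLast m = sgn (suc m) ⊛ M (suc (suc m)) ⊛ q ^ˢ (suc m * suc m)

-- The certificate has the same shape as in the pentagonal case, but the multiplier is now 1 +
-- q^(n+1); iterated, it builds up `P⁺`.
gauss-telescope : ∀ s d → sumFrom gaussTerm s (suc d) ⊕ 1-q^ s ⊛ gaussTerm s d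
  ≈ 1+q^ (suc (s + d)) ⊛ sumFrom gaussTerm s d ⊕ gaussLast (s + d)
gauss-telescope = telescope gaussTerm (λ s d → 1-q^ s ⊛ gaussTerm s d) (λ m → 1+q^ (suc m)) gaussLast base step
  where
  open SetoidReasoning ≈-setoid
  open SeriesSolver
  open ℕSolver.+-*-Solver using () renaming (solve to solveℕ; _:+_ to _⊹_; _:*_ to _✶_; con to conℕ; _:=_ to _≐_)

  base : ∀ s → gaussTerm s 1 ⊕ gaussTerm (suc s) 0 ⊕ 1-q^ s ⊛ gaussTerm s 0
    ≈ 1+q^ (suc (s + 0)) ⊛ gaussTerm s 0 ⊕ gaussLast (s + 0)
  base s rewrite ℕₚ.+-identityʳ s = begin
    σ ⊛ (one ⊛ 1-q^ (s + 1)) ⊛ m ⊛ q ^ˢ (s * suc (s + 1))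
      ⊕ ⊖ σ ⊛ one ⊛ (1+q^ s ⊛ m) ⊛ q ^ˢ (suc s * suc (suc s)) ⊕ (one ⊕ ⊖ x) ⊛ (σ ⊛ one ⊛ m ⊛ e)
      ≈⟨ ⊕-congʳ ((one ⊕ ⊖ x) ⊛ (σ ⊛ one ⊛ m ⊛ e)) (⊕-cong
           (⊛-cong (⊛-congʳ m (⊛-congˡ σ (⊛-congˡ one (≡⇒≈ (cong 1-q^ (ℕₚ.+-comm s 1))))))
             (q^-split s (s * suc s) (solveℕ 1 (λ s → s ✶ (conℕ 1 ⊹ (s ⊹ conℕ 1)) ≐ s ⊹ s ✶ (conℕ 1 ⊹ s)) refl s)))
           (⊛-congˡ (⊖ σ ⊛ one ⊛ (1+q^ s ⊛ m)) (≈-trans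
             (q^-split (suc s) (suc s + s * suc s)
               (solveℕ 1 (λ s → (conℕ 1 ⊹ s) ✶ (conℕ 2 ⊹ s) ≐ (conℕ 1 ⊹ s) ⊹ ((conℕ 1 ⊹ s) ⊹ s ✶ (conℕ 1 ⊹ s))) refl s))
             (⊛-congˡ y (q^-split (suc s) (s * suc s) refl))))) ⟩
    σ ⊛ (one ⊛ (one ⊕ ⊖ y)) ⊛ m ⊛ (x ⊛ e) ⊕ ⊖ σ ⊛ one ⊛ ((one ⊕ x) ⊛ m) ⊛ (y ⊛ (y ⊛ e))
      ⊕ (one ⊕ ⊖ x) ⊛ (σ ⊛ one ⊛ m ⊛ e)
      ≈⟨ solve 5 (λ σ m x y e → σ :* (con 1ℤ :* (con 1ℤ :- y)) :* m :* (x :* e)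
             :+ (:- σ) :* con 1ℤ :* ((con 1ℤ :+ x) :* m) :* (y :* (y :* e)) :+ (con 1ℤ :- x) :* (σ :* con 1ℤ :* m :* e)
           := (con 1ℤ :+ y) :* (σ :* con 1ℤ :* m :* e) :+ (:- σ) :* ((con 1ℤ :+ y) :* ((con 1ℤ :+ x) :* m)) :* (y :* e))
           ≈-refl σ m x y e ⟩
    (one ⊕ y) ⊛ (σ ⊛ one ⊛ m ⊛ e) ⊕ ⊖ σ ⊛ M (suc (suc s)) ⊛ (y ⊛ e)
      ≈⟨ ⊕-congˡ ((one ⊕ y) ⊛ (σ ⊛ one ⊛ m ⊛ e)) (⊛-congˡ (⊖ σ ⊛ M (suc (suc s)))
           (≈-sym (q^-split (suc s) (s * suc s) refl))) ⟩
    (one ⊕ y) ⊛ (σ ⊛ one ⊛ m ⊛ e) ⊕ gaussLast s ∎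
    where
    σ = sgn s
    m = M s
    x = q ^ˢ s
    y = q ^ˢ suc s
    e = q ^ˢ (s * suc s)

  step : ∀ s d → gaussTerm s (suc (suc d)) ⊕ 1-q^ s ⊛ gaussTerm s (suc d)
    ≈ 1+q^ (suc (s + suc d)) ⊛ gaussTerm s (suc d) ⊕ 1-q^ (suc s) ⊛ gaussTerm (suc s) d
  step s d = begin
    σ ⊛ (R ⊛ 1-q^ (s + suc (suc d))) ⊛ m ⊛ q ^ˢ (s * suc (s + suc (suc d))) ⊕ (one ⊕ ⊖ x) ⊛ (σ ⊛ R ⊛ m ⊛ e)
      ≈⟨ ⊕-congʳ ((one ⊕ ⊖ x) ⊛ (σ ⊛ R ⊛ m ⊛ e)) (⊛-cong
           (⊛-congʳ m (⊛-congˡ σ (⊛-congˡ R (≡⇒≈ (cong 1-q^ (ℕₚ.+-suc s (suc d)))))))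
           (q^-split s (s * suc (s + suc d))
             (solveℕ 2 (λ s d → s ✶ (conℕ 1 ⊹ (s ⊹ (conℕ 2 ⊹ d))) ≐ s ⊹ s ✶ (conℕ 1 ⊹ (s ⊹ (conℕ 1 ⊹ d)))) refl s d))) ⟩
    σ ⊛ (R ⊛ (one ⊕ ⊖ y)) ⊛ m ⊛ (x ⊛ e) ⊕ (one ⊕ ⊖ x) ⊛ (σ ⊛ R ⊛ m ⊛ e)
      ≈⟨ solve 6 (λ σ R m x y e → σ :* (R :* (con 1ℤ :- y)) :* m :* (x :* e) :+ (con 1ℤ :- x) :* (σ :* R :* m :* e)
           := (con 1ℤ :+ y) :* (σ :* R :* m :* e) :+ (:- σ) :* R :* ((con 1ℤ :+ x) :* m) :* (y :* e)) ≈-refl σ R m x y e ⟩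
    (one ⊕ y) ⊛ (σ ⊛ R ⊛ m ⊛ e) ⊕ ⊖ σ ⊛ R ⊛ ((one ⊕ x) ⊛ m) ⊛ (y ⊛ e)
      ≈⟨ ⊕-congˡ ((one ⊕ y) ⊛ (σ ⊛ R ⊛ m ⊛ e)) (⊛-cong
           (⊛-congʳ ((one ⊕ x) ⊛ m) (⊛-congˡ (⊖ σ) (Q-first s d)))
           (≈-sym (q^-split (suc (s + suc d)) (s * suc (s + suc d))
             (solveℕ 2 (λ s d → (conℕ 1 ⊹ s) ✶ (conℕ 2 ⊹ (s ⊹ d))
               ≐ (conℕ 1 ⊹ (s ⊹ (conℕ 1 ⊹ d))) ⊹ s ✶ (conℕ 1 ⊹ (s ⊹ (conℕ 1 ⊹ d)))) refl s d)))) ⟩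
    (one ⊕ y) ⊛ (σ ⊛ R ⊛ m ⊛ e) ⊕ ⊖ σ ⊛ (1-q^ (suc s) ⊛ Q (suc s) d) ⊛ M (suc s) ⊛ e′
      ≈⟨ solve 6 (λ a σ c R m e → a :+ (:- σ) :* (c :* R) :* m :* e := a :+ c :* ((:- σ) :* R :* m :* e)) ≈-refl
           ((one ⊕ y) ⊛ (σ ⊛ R ⊛ m ⊛ e)) σ (1-q^ (suc s)) (Q (suc s) d) (M (suc s)) e′ ⟩
    (one ⊕ y) ⊛ gaussTerm s (suc d) ⊕ 1-q^ (suc s) ⊛ gaussTerm (suc s) d ∎
    where
    σ = sgn s
    R = Q s (suc d)
    m = M s
    x = q ^ˢ s
    y = q ^ˢ suc (s + suc d)
    e = q ^ˢ (s * suc (s + suc d))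
    e′ = q ^ˢ (suc s * suc (suc s + d))

altSquares : ℕ → Series
altSquares zero    = one
altSquares (suc n) = altSquares n ⊕ two ⊛ (sgn (suc n) ⊛ q ^ˢ (suc n * suc n))

gaussSum : ∀ n → sumFrom gaussTerm 0 n ≈ P⁺ n ⊛ altSquares n
gaussSum zero = solve 0 (con 1ℤ :* con 1ℤ :* con 1ℤ :* con 1ℤ := con 1ℤ :* con 1ℤ) ≈-refl
  where open SeriesSolver
gaussSum (suc n) = begin
  sumFrom gaussTerm 0 (suc n)
    ≈⟨ solve 1 (λ x → x := x :+ con 0ℤ) ≈-refl (sumFrom gaussTerm 0 (suc n)) ⟩
  sumFrom gaussTerm 0 (suc n) ⊕ const 0ℤ
    ≈⟨ ⊕-congˡ (sumFrom gaussTerm 0 (suc n)) (≈-sym (1-q^0⊛ (gaussTerm 0 n))) ⟩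
  sumFrom gaussTerm 0 (suc n) ⊕ 1-q^ 0 ⊛ gaussTerm 0 n
    ≈⟨ gauss-telescope 0 n ⟩
  1+q^ (suc n) ⊛ sumFrom gaussTerm 0 n ⊕ sgn (suc n) ⊛ M (suc (suc n)) ⊛ q ^ˢ (suc n * suc n)
    ≈⟨ ⊕-cong (⊛-congˡ (1+q^ (suc n)) (gaussSum n))
         (⊛-congʳ (q ^ˢ (suc n * suc n)) (⊛-congˡ (sgn (suc n)) (M-suc (suc n)))) ⟩
  1+q^ (suc n) ⊛ (P⁺ n ⊛ altSquares n) ⊕ sgn (suc n) ⊛ (two ⊛ P⁺ (suc n)) ⊛ q ^ˢ (suc n * suc n)
    ≈⟨ solve 6 (λ c p a s t e → c :* (p :* a) :+ s :* (t :* (p :* c)) :* e := p :* c :* (a :+ t :* (s :* e))) ≈-refl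
         (1+q^ (suc n)) (P⁺ n) (altSquares n) (sgn (suc n)) two (q ^ˢ (suc n * suc n)) ⟩
  P⁺ (suc n) ⊛ altSquares (suc n) ∎
  where open SetoidReasoning ≈-setoid
        open SeriesSolver

-- For s ≥ 1 the exponent s(s + d + 1) is larger than n = s + d.
gaussSum-≈[]-P : ∀ n → sumFrom gaussTerm 0 n ≈[ n ] P n
gaussSum-≈[]-P n = ≈[]-trans (head n) (≈⇒≈[] (solve 1 (λ x → con 1ℤ :* x :* con 1ℤ :* con 1ℤ := x) ≈-refl (P n)))
  where
  open SeriesSolver
  small : ∀ s d → Vanish (suc s + d) (gaussTerm (suc s) d)
  small s d = ⊛q^-vanish (sgn (suc s) ⊛ Q (suc s) d ⊛ M (suc s)) (ℕₚ.m≤m+n (suc (suc s + d)) (s * suc (suc s + d)))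
  head : ∀ n → sumFrom gaussTerm 0 n ≈[ n ] gaussTerm 0 n
  head zero    = ≈[]-refl
  head (suc n) = ⊕-vanish (gaussTerm 0 (suc n)) (sumFrom-vanish gaussTerm small 0 n)

squares : ℕ → Series
squares zero    = one
squares (suc n) = squares n ⊕ two ⊛ q ^ˢ (suc n * suc n)

triangles : ℕ → Series
triangles zero    = one
triangles (suc n) = triangles n ⊕ q ^ˢ tri (suc n)

n≤tri : ∀ n → n ≤ tri n
n≤tri zero    = z≤n
n≤tri (suc n) = ℕₚ.m≤m+n (suc n) (tri n)

squares-coherent : Coherent squares
squares-coherent n = ⊕-vanish (squares n) (⊛q^-vanish two {k = suc n * suc n} (s≤s (ℕₚ.m≤m+n n (n * suc n))))

triangles-coherent : Coherent triangles
triangles-coherent n = ⊕-vanish (triangles n) λ i i≤n →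
  trans (at (≈-sym (⊛-identityˡ (q ^ˢ tri (suc n)))) i) (⊛q^-vanish one (n≤tri (suc n)) i i≤n)

-- Ramanujan's theta functions: φ(q) is the sum of q^(k²) over all integers k, and ψ(q) is the sum
-- of q^(k(k+1)/2) over k ≥ 0.
φ ψ : Series
φ = limit squares
ψ = limit triangles

sgn-+ : ∀ m n → sgn (m + n) ≈ sgn m ⊛ sgn n
sgn-+ zero    n = ≈-sym (⊛-identityˡ (sgn n))
sgn-+ (suc m) n = ≈-trans (⊖-cong (sgn-+ m n))
  (solve 2 (λ a b → :- (a :* b) := (:- a) :* b) ≈-refl (sgn m) (sgn n))
  where open SeriesSolver

sgn² : ∀ n → sgn n ⊛ sgn n ≈ one
sgn² zero    = ⊛-identityˡ one
sgn² (suc n) = ≈-trans (solve 1 (λ a → (:- a) :* (:- a) := a :* a) ≈-refl (sgn n)) (sgn² n)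
  where open SeriesSolver

-- The integer n² has the parity of n; hence φ(-q) has the alternating signs of `altSquares`.
sgn-square : ∀ n → sgn (n * n) ≈ sgn n
sgn-square zero    = ≈-refl
sgn-square (suc n) = ⊖-cong (begin
  sgn (n + n * suc n)                  ≈⟨ ≡⇒≈ (cong (λ k → sgn (n + k)) (ℕₚ.*-suc n n)) ⟩
  sgn (n + (n + n * n))                ≈⟨ ≈-trans (sgn-+ n (n + n * n)) (⊛-congˡ (sgn n) (sgn-+ n (n * n))) ⟩
  sgn n ⊛ (sgn n ⊛ sgn (n * n))        ≈⟨ ≈-sym (⊛-assoc (sgn n) (sgn n) (sgn (n * n))) ⟩
  sgn n ⊛ sgn n ⊛ sgn (n * n)          ≈⟨ ⊛-cong (sgn² n) (sgn-square n) ⟩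
  one ⊛ sgn n                          ≈⟨ ⊛-identityˡ (sgn n) ⟩
  sgn n                                ∎)
  where open SetoidReasoning ≈-setoid

neg-q^ : ∀ k → neg (q ^ˢ k) ≈ sgn k ⊛ q ^ˢ k
neg-q^ zero    = ≈-trans (neg-const 1ℤ) (≈-sym (⊛-identityˡ one))
neg-q^ (suc k) = begin
  neg (q ⊛ q ^ˢ k)                ≈⟨ neg-⊛ q (q ^ˢ k) ⟩
  neg q ⊛ neg (q ^ˢ k)            ≈⟨ ⊛-cong neg-q (neg-q^ k) ⟩
  (⊖ q) ⊛ (sgn k ⊛ q ^ˢ k)        ≈⟨ solve 3 (λ q s e → (:- q) :* (s :* e) := (:- s) :* (q :* e)) ≈-refl q (sgn k) (q ^ˢ k) ⟩
  sgn (suc k) ⊛ q ^ˢ suc k        ∎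
  where open SetoidReasoning ≈-setoid
        open SeriesSolver

sub₂-q^ : ∀ k → sub₂ (q ^ˢ k) ≈ q ^ˢ (k + k)
sub₂-q^ zero    = sub₂-const 1ℤ
sub₂-q^ (suc k) = begin
  sub₂ (q ⊛ q ^ˢ k)               ≈⟨ sub₂-⊛ q (q ^ˢ k) ⟩
  sub₂ q ⊛ sub₂ (q ^ˢ k)          ≈⟨ ⊛-cong sub₂-q (sub₂-q^ k) ⟩
  q ⊛ q ⊛ q ^ˢ (k + k)            ≈⟨ ⊛-assoc q q (q ^ˢ (k + k)) ⟩
  q ^ˢ suc (suc (k + k))          ≈⟨ ≡⇒≈ (cong (λ m → q ^ˢ suc m) (sym (ℕₚ.+-suc k k))) ⟩
  q ^ˢ (suc k + suc k)            ∎
  where open SetoidReasoning ≈-setoid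

neg-squares : ∀ n → neg (squares n) ≈ altSquares n
neg-squares zero    = neg-const 1ℤ
neg-squares (suc n) = ≈-trans (neg-⊕ (squares n) (two ⊛ q ^ˢ (suc n * suc n))) (⊕-cong (neg-squares n)
  (≈-trans (neg-⊛ two (q ^ˢ (suc n * suc n))) (⊛-cong (neg-const (+ 2))
    (≈-trans (neg-q^ (suc n * suc n)) (⊛-congʳ (q ^ˢ (suc n * suc n)) (sgn-square (suc n)))))))

sub₂-1-q^ : ∀ k → sub₂ (1-q^ k) ≈ 1-q^ (k + k)
sub₂-1-q^ k = ≈-trans (sub₂-⊕ one (⊖ q ^ˢ k))
  (⊕-cong (sub₂-const 1ℤ) (≈-trans (sub₂-⊖ (q ^ˢ k)) (⊖-cong (sub₂-q^ k))))

1-q^⊛1+q^ : ∀ k → 1-q^ k ⊛ 1+q^ k ≈ sub₂ (1-q^ k)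
1-q^⊛1+q^ k = begin
  1-q^ k ⊛ 1+q^ k                   ≈⟨ solve 1 (λ x → (con 1ℤ :- x) :* (con 1ℤ :+ x) := con 1ℤ :- x :* x) ≈-refl (q ^ˢ k) ⟩
  one ⊕ (⊖ (q ^ˢ k ⊛ q ^ˢ k))       ≈⟨ ⊕-congˡ one (⊖-cong (≈-sym (q^-split k k refl))) ⟩
  1-q^ (k + k)                      ≈⟨ ≈-sym (sub₂-1-q^ k) ⟩
  sub₂ (1-q^ k)                     ∎
  where open SetoidReasoning ≈-setoid
        open SeriesSolver

P⊛P⁺ : ∀ n → P n ⊛ P⁺ n ≈ sub₂ (P n)
P⊛P⁺ zero    = ≈-trans (⊛-identityˡ one) (≈-sym (sub₂-const 1ℤ))
P⊛P⁺ (suc n) = begin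
  P n ⊛ 1-q^ (suc n) ⊛ (P⁺ n ⊛ 1+q^ (suc n))
    ≈⟨ solve 4 (λ a b c d → a :* b :* (c :* d) := a :* c :* (b :* d)) ≈-refl (P n) (1-q^ (suc n)) (P⁺ n) (1+q^ (suc n)) ⟩
  P n ⊛ P⁺ n ⊛ (1-q^ (suc n) ⊛ 1+q^ (suc n))
    ≈⟨ ⊛-cong (P⊛P⁺ n) (1-q^⊛1+q^ (suc n)) ⟩
  sub₂ (P n) ⊛ sub₂ (1-q^ (suc n))
    ≈⟨ ≈-sym (sub₂-⊛ (P n) (1-q^ (suc n))) ⟩
  sub₂ (P (suc n)) ∎
  where open SetoidReasoning ≈-setoid
        open SeriesSolver

f₂ f₄ f₁⁻ φ⁻ : Series
f₂ = sub₂ f₁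
f₄ = sub₂ f₂
f₁⁻ = neg f₁
φ⁻ = neg φ

-- The finite form says P n ≡ P⁺ n · φ(-q) modulo q^(n+1). Multiplication by P n turns P n · P⁺ n
-- into P n at q², a truncation of f₂.
gauss : φ⁻ ⊛ f₂ ≈ f₁ ⊛ f₁
gauss = ≈[]⇒≈ λ n → let open SetoidReasoning (≈[]-setoid n) in begin
  φ⁻ ⊛ f₂
    ≈⟨ ⊛-cong[] (neg-cong[] (limit-≈[] squares-coherent n)) (sub₂-cong[] (f₁-≈[] n)) ⟩
  neg (squares n) ⊛ sub₂ (P n)
    ≈⟨ ≈⇒≈[] (⊛-cong (neg-squares n) (≈-sym (P⊛P⁺ n))) ⟩
  altSquares n ⊛ (P n ⊛ P⁺ n)
    ≈⟨ ≈⇒≈[] (solve 3 (λ a b c → a :* (b :* c) := b :* (c :* a)) ≈-refl (altSquares n) (P n) (P⁺ n)) ⟩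
  P n ⊛ (P⁺ n ⊛ altSquares n)
    ≈⟨ ≈⇒≈[] (⊛-congˡ (P n) (≈-sym (gaussSum n))) ⟩
  P n ⊛ sumFrom gaussTerm 0 n
    ≈⟨ ⊛-cong[] (≈[]-refl {x = P n}) (gaussSum-≈[]-P n) ⟩
  P n ⊛ P n
    ≈⟨ ⊛-cong[] (≈[]-sym (f₁-≈[] n)) (≈[]-sym (f₁-≈[] n)) ⟩
  f₁ ⊛ f₁ ∎
  where open SeriesSolver

neg-1-q^ : ∀ k → neg (1-q^ k) ≈ one ⊕ (⊖ (sgn k ⊛ q ^ˢ k))
neg-1-q^ k = ≈-trans (neg-⊕ one (⊖ q ^ˢ k))
  (⊕-cong (neg-const 1ℤ) (≈-trans (neg-⊖ (q ^ˢ k)) (⊖-cong (neg-q^ k))))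

neg-1-q^-odd : ∀ n → neg (1-q^ (suc (n + n))) ≈ 1+q^ (suc (n + n))
neg-1-q^-odd n = begin
  neg (1-q^ (suc (n + n)))
    ≈⟨ neg-1-q^ (suc (n + n)) ⟩
  one ⊕ (⊖ ((⊖ sgn (n + n)) ⊛ q ^ˢ suc (n + n)))
    ≈⟨ solve 2 (λ s e → con 1ℤ :- (:- s) :* e := con 1ℤ :+ s :* e) ≈-refl (sgn (n + n)) (q ^ˢ suc (n + n)) ⟩
  one ⊕ sgn (n + n) ⊛ q ^ˢ suc (n + n)
    ≈⟨ ⊕-congˡ one (≈-trans (⊛-congʳ (q ^ˢ suc (n + n)) (≈-trans (sgn-+ n n) (sgn² n))) (⊛-identityˡ (q ^ˢ suc (n + n)))) ⟩
  1+q^ (suc (n + n)) ∎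
  where open SetoidReasoning ≈-setoid
        open SeriesSolver

P-double-suc : ∀ n → P (suc n + suc n) ≈ P (n + n) ⊛ 1-q^ (suc (n + n)) ⊛ sub₂ (1-q^ (suc n))
P-double-suc n = ≈-trans (≡⇒≈ (cong P (cong suc (ℕₚ.+-suc n n))))
  (⊛-congˡ (P (n + n) ⊛ 1-q^ (suc (n + n)))
    (≈-trans (≡⇒≈ (cong 1-q^ (cong suc (sym (ℕₚ.+-suc n n))))) (≈-sym (sub₂-1-q^ (suc n)))))

-- Under q ↦ -q an odd factor 1 - q^k becomes 1 + q^k and an even one stays. The odd factors
-- therefore pair to 1 - q^(2k) with k odd, and P n at q⁴ supplies the missing even k of P(2n) at
-- q². The even length 2n keeps the two parities in step.
P-double : ∀ n → neg (P (n + n)) ⊛ P (n + n) ⊛ sub₂ (sub₂ (P n)) ≈ sub₂ (P n) ⊛ sub₂ (P n) ⊛ sub₂ (P (n + n))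
P-double zero = ⊛-cong (⊛-cong (≈-trans (neg-const 1ℤ) (≈-sym (sub₂-const 1ℤ))) (≈-sym (sub₂-const 1ℤ))) (sub₂-cong (sub₂-const 1ℤ))
P-double (suc n) = begin
  neg (P (suc n + suc n)) ⊛ P (suc n + suc n) ⊛ sub₂ (sub₂ (P n ⊛ v))
    ≈⟨ ⊛-cong (⊛-cong
         (≈-trans (neg-cong (P-double-suc n)) (≈-trans (neg-⊛ (p ⊛ o) (sub₂ v))
           (⊛-cong (≈-trans (neg-⊛ p o) (⊛-congˡ (neg p) (neg-1-q^-odd n))) (neg-sub₂ v))))
         (P-double-suc n))
         (≈-trans (sub₂-cong (sub₂-⊛ (P n) v)) (sub₂-⊛ (sub₂ (P n)) (sub₂ v))) ⟩
  neg p ⊛ o⁺ ⊛ sub₂ v ⊛ (p ⊛ o ⊛ sub₂ v) ⊛ (sub₂ (sub₂ (P n)) ⊛ sub₂ (sub₂ v))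
    ≈⟨ solve 7 (λ a b v p o r w → a :* b :* v :* (p :* o :* v) :* (r :* w) := (a :* p :* r) :* (v :* v) :* (o :* b) :* w) ≈-refl
         (neg p) o⁺ (sub₂ v) p o (sub₂ (sub₂ (P n))) (sub₂ (sub₂ v)) ⟩
  neg p ⊛ p ⊛ sub₂ (sub₂ (P n)) ⊛ (sub₂ v ⊛ sub₂ v) ⊛ (o ⊛ o⁺) ⊛ sub₂ (sub₂ v)
    ≈⟨ ⊛-congʳ (sub₂ (sub₂ v)) (⊛-cong (⊛-congʳ (sub₂ v ⊛ sub₂ v) (P-double n)) (1-q^⊛1+q^ (suc (n + n)))) ⟩
  sub₂ (P n) ⊛ sub₂ (P n) ⊛ sub₂ p ⊛ (sub₂ v ⊛ sub₂ v) ⊛ sub₂ o ⊛ sub₂ (sub₂ v)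
    ≈⟨ solve 5 (λ a p v o w → a :* a :* p :* (v :* v) :* o :* w := (a :* v) :* (a :* v) :* (p :* o :* w)) ≈-refl
         (sub₂ (P n)) (sub₂ p) (sub₂ v) (sub₂ o) (sub₂ (sub₂ v)) ⟩
  sub₂ (P n) ⊛ sub₂ v ⊛ (sub₂ (P n) ⊛ sub₂ v) ⊛ (sub₂ p ⊛ sub₂ o ⊛ sub₂ (sub₂ v))
    ≈⟨ ⊛-cong (⊛-cong (≈-sym (sub₂-⊛ (P n) v)) (≈-sym (sub₂-⊛ (P n) v)))
         (≈-trans (⊛-congʳ (sub₂ (sub₂ v)) (≈-sym (sub₂-⊛ p o)))
           (≈-trans (≈-sym (sub₂-⊛ (p ⊛ o) (sub₂ v))) (sub₂-cong (≈-sym (P-double-suc n))))) ⟩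
  sub₂ (P (suc n)) ⊛ sub₂ (P (suc n)) ⊛ sub₂ (P (suc n + suc n)) ∎
  where
  open SetoidReasoning ≈-setoid
  open SeriesSolver
  p = P (n + n)
  o = 1-q^ (suc (n + n))
  o⁺ = 1+q^ (suc (n + n))
  v = 1-q^ (suc n)

f₁⁻f₁f₄≈f₂³ : f₁⁻ ⊛ f₁ ⊛ f₄ ≈ f₂ ⊛ f₂ ⊛ f₂
f₁⁻f₁f₄≈f₂³ = ≈[]⇒≈ λ n → let open SetoidReasoning (≈[]-setoid n)
                              near₂ = ≈[]-weaken (ℕₚ.m≤m+n n n) (f₁-≈[] (n + n)) in begin
  f₁⁻ ⊛ f₁ ⊛ f₄
    ≈⟨ ⊛-cong[] (⊛-cong[] (neg-cong[] near₂) near₂) (sub₂-cong[] (sub₂-cong[] (f₁-≈[] n))) ⟩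
  neg (P (n + n)) ⊛ P (n + n) ⊛ sub₂ (sub₂ (P n))
    ≈⟨ ≈⇒≈[] (P-double n) ⟩
  sub₂ (P n) ⊛ sub₂ (P n) ⊛ sub₂ (P (n + n))
    ≈⟨ ≈[]-sym (⊛-cong[] (⊛-cong[] (sub₂-cong[] (f₁-≈[] n)) (sub₂-cong[] (f₁-≈[] n))) (sub₂-cong[] near₂)) ⟩
  f₂ ⊛ f₂ ⊛ f₂ ∎

sub₄ sub₈ : Series → Series
sub₄ f = sub₂ (sub₂ f)
sub₈ f = sub₂ (sub₄ f)

sub₄-q^ : ∀ k → sub₄ (q ^ˢ k) ≈ q ^ˢ (4 * k)
sub₄-q^ k = ≈-trans (sub₂-cong (sub₂-q^ k)) (≈-trans (sub₂-q^ (k + k))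
  (≡⇒≈ (cong (q ^ˢ_) (solve 1 (λ k → k :+ k :+ (k :+ k) := con 4 :* k) refl k))))
  where open ℕSolver.+-*-Solver

-- Separate the squares by parity: (2k)² = 4k², and (2k + 1)² = 8 · k(k + 1)/2 + 1.
squares-odd : ∀ n → squares (suc (n + n)) ≈ sub₄ (squares n) ⊕ two ⊛ q ⊛ sub₈ (triangles n)
squares-odd zero = begin
  one ⊕ two ⊛ (q ⊛ one)
    ≈⟨ solve 1 (λ q → con 1ℤ :+ con (+ 2) :* (q :* con 1ℤ) := con 1ℤ :+ con (+ 2) :* q :* con 1ℤ) ≈-refl q ⟩
  one ⊕ two ⊛ q ⊛ one
    ≈⟨ ≈-sym (⊕-cong sub₄-one (⊛-congˡ (two ⊛ q) (≈-trans (sub₂-cong sub₄-one) (sub₂-const 1ℤ)))) ⟩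
  sub₄ one ⊕ two ⊛ q ⊛ sub₈ one ∎
  where open SetoidReasoning ≈-setoid
        open SeriesSolver
        sub₄-one : sub₄ one ≈ one
        sub₄-one = ≈-trans (sub₂-cong (sub₂-const 1ℤ)) (sub₂-const 1ℤ)
squares-odd (suc n) = begin
  squares (suc (suc n + suc n))
    ≈⟨ ≡⇒≈ (cong squares (cong (suc ∘ suc) (ℕₚ.+-suc n n))) ⟩
  squares (suc (n + n)) ⊕ two ⊛ q ^ˢ (suc (suc (n + n)) * suc (suc (n + n)))
    ⊕ two ⊛ q ^ˢ (suc (suc (suc (n + n))) * suc (suc (suc (n + n))))
    ≈⟨ ⊕-cong (⊕-cong (squares-odd n) (⊛-congˡ two (even-square))) (⊛-congˡ two odd-square) ⟩
  A ⊕ two ⊛ q ⊛ B ⊕ two ⊛ A′ ⊕ two ⊛ (q ⊛ B′)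
    ≈⟨ solve 6 (λ A B A′ B′ t q → A :+ t :* q :* B :+ t :* A′ :+ t :* (q :* B′) := (A :+ t :* A′) :+ t :* q :* (B :+ B′)) ≈-refl A B A′ B′ two q ⟩
  A ⊕ two ⊛ A′ ⊕ two ⊛ q ⊛ (B ⊕ B′)
    ≈⟨ ≈-sym (⊕-cong sub₄-step (⊛-congˡ (two ⊛ q) sub₈-step)) ⟩
  sub₄ (squares (suc n)) ⊕ two ⊛ q ⊛ sub₈ (triangles (suc n)) ∎
  where
  open SetoidReasoning ≈-setoid
  open SeriesSolver
  open ℕSolver.+-*-Solver using () renaming (solve to solveℕ; _:+_ to _⊹_; _:*_ to _✶_; con to conℕ; _:=_ to _≐_)
  A A′ B B′ : Series
  A = sub₄ (squares n)
  B = sub₈ (triangles n)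
  A′ = sub₄ (q ^ˢ (suc n * suc n))
  B′ = sub₈ (q ^ˢ tri (suc n))
  even-square : q ^ˢ (suc (suc (n + n)) * suc (suc (n + n))) ≈ A′
  even-square = ≈-trans (≡⇒≈ (cong (q ^ˢ_) (solveℕ 1 (λ n → (conℕ 2 ⊹ (n ⊹ n)) ✶ (conℕ 2 ⊹ (n ⊹ n))
    ≐ conℕ 4 ✶ ((conℕ 1 ⊹ n) ✶ (conℕ 1 ⊹ n))) refl n))) (≈-sym (sub₄-q^ (suc n * suc n)))
  odd-square : q ^ˢ (suc (suc (suc (n + n))) * suc (suc (suc (n + n)))) ≈ q ⊛ B′
  odd-square = ≈-trans (≡⇒≈ (cong (q ^ˢ_) (trans
    (solveℕ 1 (λ n → (conℕ 3 ⊹ (n ⊹ n)) ✶ (conℕ 3 ⊹ (n ⊹ n)) ≐ conℕ 1 ⊹ conℕ 4 ✶ ((conℕ 1 ⊹ n) ✶ (conℕ 2 ⊹ n))) refl n)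
    (cong (λ z → suc (4 * z)) (sym (2*tri (suc n)))))))
    (⊛-congˡ q (≈-sym (≈-trans (sub₂-cong (sub₄-q^ (tri (suc n)))) (≈-trans (sub₂-q^ (4 * tri (suc n)))
      (≡⇒≈ (cong (q ^ˢ_) (sym (ℕₚ.*-distribˡ-+ 4 (tri (suc n)) (tri (suc n))))))))))
  sub₄-step : sub₄ (squares (suc n)) ≈ A ⊕ two ⊛ A′
  sub₄-step = ≈-trans (sub₂-cong (≈-trans (sub₂-⊕ (squares n) (two ⊛ q ^ˢ (suc n * suc n)))
      (⊕-congˡ (sub₂ (squares n)) (≈-trans (sub₂-⊛ two (q ^ˢ (suc n * suc n))) (⊛-congʳ (sub₂ (q ^ˢ (suc n * suc n))) (sub₂-const (+ 2)))))))
    (≈-trans (sub₂-⊕ (sub₂ (squares n)) (two ⊛ sub₂ (q ^ˢ (suc n * suc n))))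
      (⊕-congˡ A (≈-trans (sub₂-⊛ two (sub₂ (q ^ˢ (suc n * suc n)))) (⊛-congʳ A′ (sub₂-const (+ 2))))))
  sub₈-step : sub₈ (triangles (suc n)) ≈ B ⊕ B′
  sub₈-step = ≈-trans (sub₂-cong (≈-trans (sub₂-cong (sub₂-⊕ (triangles n) (q ^ˢ tri (suc n))))
      (sub₂-⊕ (sub₂ (triangles n)) (sub₂ (q ^ˢ tri (suc n))))))
    (sub₂-⊕ (sub₄ (triangles n)) (sub₄ (q ^ˢ tri (suc n))))

φ-dissection : φ ≈ sub₄ φ ⊕ two ⊛ q ⊛ sub₈ ψ
φ-dissection = ≈[]⇒≈ λ n → let open SetoidReasoning (≈[]-setoid n) in begin
  φ
    ≈⟨ ≈[]-weaken (ℕₚ.m≤n⇒m≤1+n (ℕₚ.m≤m+n n n)) (limit-≈[] squares-coherent (suc (n + n))) ⟩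
  squares (suc (n + n))
    ≈⟨ ≈⇒≈[] (squares-odd n) ⟩
  sub₄ (squares n) ⊕ two ⊛ q ⊛ sub₈ (triangles n)
    ≈⟨ ≈[]-sym (⊕-cong[] (sub₂-cong[] (sub₂-cong[] (limit-≈[] squares-coherent n)))
         (⊛-cong[] (≈[]-refl {x = two ⊛ q}) (sub₂-cong[] (sub₂-cong[] (sub₂-cong[] (limit-≈[] triangles-coherent n)))))) ⟩
  sub₄ φ ⊕ two ⊛ q ⊛ sub₈ ψ ∎

-- The arithmetic-geometric mean and the Wronskian

module _ where

  open SeriesSolver
  open SetoidReasoning ≈-setoid

  four eight : Series
  four  = const (+ 4)
  eight = const (+ 8)

  gauss⁺ : φ ⊛ f₂ ≈ f₁⁻ ⊛ f₁⁻
  gauss⁺ = begin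
    φ ⊛ f₂              ≈⟨ ≈-sym (⊛-cong (neg-involutive φ) (neg-sub₂ f₁)) ⟩
    neg φ⁻ ⊛ neg f₂     ≈⟨ ≈-sym (neg-⊛ φ⁻ f₂) ⟩
    neg (φ⁻ ⊛ f₂)       ≈⟨ neg-cong gauss ⟩
    neg (f₁ ⊛ f₁)       ≈⟨ neg-⊛ f₁ f₁ ⟩
    f₁⁻ ⊛ f₁⁻           ∎

  gauss₂ : sub₂ φ⁻ ⊛ f₄ ≈ f₂ ⊛ f₂
  gauss₂ = ≈-trans (≈-sym (sub₂-⊛ φ⁻ f₂)) (≈-trans (sub₂-cong gauss) (sub₂-⊛ f₁ f₁))

  -- By Gauss both sides are products of f's: the left one is (f₁(-q) f₁ / f₂)², the right one (f₂²
  -- / f₄)², and f₁(-q) f₁ = f₂³ / f₄.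
  φφ⁻ : φ ⊛ φ⁻ ≈ sub₂ φ⁻ ⊛ sub₂ φ⁻
  φφ⁻ = ⊛-cancelˡ (f₂ ⊛ f₂ ⊛ f₄ ⊛ f₄) (λ ()) (begin
    f₂ ⊛ f₂ ⊛ f₄ ⊛ f₄ ⊛ (φ ⊛ φ⁻)
      ≈⟨ solve 4 (λ s t p m → s :* s :* t :* t :* (p :* m) := (p :* s) :* (m :* s) :* t :* t) ≈-refl f₂ f₄ φ φ⁻ ⟩
    φ ⊛ f₂ ⊛ (φ⁻ ⊛ f₂) ⊛ f₄ ⊛ f₄
      ≈⟨ ⊛-congʳ f₄ (⊛-congʳ f₄ (⊛-cong gauss⁺ gauss)) ⟩
    f₁⁻ ⊛ f₁⁻ ⊛ (f₁ ⊛ f₁) ⊛ f₄ ⊛ f₄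
      ≈⟨ solve 3 (λ m f t → m :* m :* (f :* f) :* t :* t := (m :* f :* t) :* (m :* f :* t)) ≈-refl f₁⁻ f₁ f₄ ⟩
    f₁⁻ ⊛ f₁ ⊛ f₄ ⊛ (f₁⁻ ⊛ f₁ ⊛ f₄)
      ≈⟨ ⊛-cong f₁⁻f₁f₄≈f₂³ f₁⁻f₁f₄≈f₂³ ⟩
    f₂ ⊛ f₂ ⊛ f₂ ⊛ (f₂ ⊛ f₂ ⊛ f₂)
      ≈⟨ solve 1 (λ s → s :* s :* s :* (s :* s :* s) := s :* s :* ((s :* s) :* (s :* s))) ≈-refl f₂ ⟩
    f₂ ⊛ f₂ ⊛ (f₂ ⊛ f₂ ⊛ (f₂ ⊛ f₂))
      ≈⟨ ⊛-congˡ (f₂ ⊛ f₂) (≈-sym (⊛-cong gauss₂ gauss₂)) ⟩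
    f₂ ⊛ f₂ ⊛ (sub₂ φ⁻ ⊛ f₄ ⊛ (sub₂ φ⁻ ⊛ f₄))
      ≈⟨ solve 3 (λ s t m → s :* s :* (m :* t :* (m :* t)) := s :* s :* t :* t :* (m :* m)) ≈-refl f₂ f₄ (sub₂ φ⁻) ⟩
    f₂ ⊛ f₂ ⊛ f₄ ⊛ f₄ ⊛ (sub₂ φ⁻ ⊛ sub₂ φ⁻) ∎)

  φ⁻-dissection : φ⁻ ≈ sub₄ φ ⊕ (⊖ (two ⊛ q ⊛ sub₈ ψ))
  φ⁻-dissection = begin
    neg φ
      ≈⟨ neg-cong φ-dissection ⟩
    neg (sub₄ φ ⊕ two ⊛ q ⊛ sub₈ ψ)
      ≈⟨ neg-⊕ (sub₄ φ) (two ⊛ q ⊛ sub₈ ψ) ⟩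
    neg (sub₄ φ) ⊕ neg (two ⊛ q ⊛ sub₈ ψ)
      ≈⟨ ⊕-cong (neg-sub₂ (sub₂ φ)) (≈-trans (neg-⊛ (two ⊛ q) (sub₈ ψ))
           (⊛-cong (≈-trans (neg-⊛ two q) (⊛-cong (neg-const (+ 2)) neg-q)) (neg-sub₂ (sub₄ ψ)))) ⟩
    sub₄ φ ⊕ two ⊛ (⊖ q) ⊛ sub₈ ψ
      ≈⟨ solve 3 (λ α q β → α :+ con (+ 2) :* (:- q) :* β := α :- con (+ 2) :* q :* β) ≈-refl (sub₄ φ) q (sub₈ ψ) ⟩
    sub₄ φ ⊕ (⊖ (two ⊛ q ⊛ sub₈ ψ)) ∎

  -- After q ↦ q² the left side is φ(q) φ(-q) by `φφ⁻`. Its two dissections are conjugate, so their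
  -- product is a difference of squares.
  φ⁻² : φ⁻ ⊛ φ⁻ ≈ sub₂ φ ⊛ sub₂ φ ⊕ (⊖ (four ⊛ q ⊛ (sub₄ ψ ⊛ sub₄ ψ)))
  φ⁻² = sub₂-injective (begin
    sub₂ (φ⁻ ⊛ φ⁻)
      ≈⟨ ≈-trans (sub₂-⊛ φ⁻ φ⁻) (≈-sym φφ⁻) ⟩
    φ ⊛ φ⁻
      ≈⟨ ⊛-cong φ-dissection φ⁻-dissection ⟩
    (A ⊕ two ⊛ q ⊛ B) ⊛ (A ⊕ (⊖ (two ⊛ q ⊛ B)))
      ≈⟨ solve 3 (λ α q β → (α :+ con (+ 2) :* q :* β) :* (α :- con (+ 2) :* q :* β)
           := α :* α :- con (+ 4) :* (q :* q) :* (β :* β)) ≈-refl A q B ⟩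
    A ⊛ A ⊕ (⊖ (four ⊛ (q ⊛ q) ⊛ (B ⊛ B)))
      ≈⟨ ≈-sym (⊕-cong (sub₂-⊛ (sub₂ φ) (sub₂ φ)) (≈-trans (sub₂-⊖ (four ⊛ q ⊛ (sub₄ ψ ⊛ sub₄ ψ)))
           (⊖-cong (≈-trans (sub₂-⊛ (four ⊛ q) (sub₄ ψ ⊛ sub₄ ψ))
             (⊛-cong (≈-trans (sub₂-⊛ four q) (⊛-cong (sub₂-const (+ 4)) sub₂-q)) (sub₂-⊛ (sub₄ ψ) (sub₄ ψ))))))) ⟩
    sub₂ (sub₂ φ ⊛ sub₂ φ) ⊕ sub₂ (⊖ (four ⊛ q ⊛ (sub₄ ψ ⊛ sub₄ ψ)))
      ≈⟨ ≈-sym (sub₂-⊕ (sub₂ φ ⊛ sub₂ φ) (⊖ (four ⊛ q ⊛ (sub₄ ψ ⊛ sub₄ ψ)))) ⟩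
    sub₂ (sub₂ φ ⊛ sub₂ φ ⊕ (⊖ (four ⊛ q ⊛ (sub₄ ψ ⊛ sub₄ ψ)))) ∎)
    where
    A B : Series
    A = sub₄ φ
    B = sub₈ ψ

  φ² : φ ⊛ φ ≈ sub₂ φ ⊛ sub₂ φ ⊕ four ⊛ q ⊛ (sub₄ ψ ⊛ sub₄ ψ)
  φ² = begin
    φ ⊛ φ
      ≈⟨ ≈-sym (⊛-cong (neg-involutive φ) (neg-involutive φ)) ⟩
    neg φ⁻ ⊛ neg φ⁻
      ≈⟨ ≈-sym (neg-⊛ φ⁻ φ⁻) ⟩
    neg (φ⁻ ⊛ φ⁻)
      ≈⟨ neg-cong φ⁻² ⟩
    neg (p₂ ⊛ p₂ ⊕ (⊖ (four ⊛ q ⊛ (s₄ ⊛ s₄))))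
      ≈⟨ ≈-trans (neg-⊕ (p₂ ⊛ p₂) (⊖ (four ⊛ q ⊛ (s₄ ⊛ s₄)))) (⊕-cong
           (≈-trans (neg-⊛ p₂ p₂) (⊛-cong (neg-sub₂ φ) (neg-sub₂ φ)))
           (≈-trans (neg-⊖ (four ⊛ q ⊛ (s₄ ⊛ s₄))) (⊖-cong (≈-trans (neg-⊛ (four ⊛ q) (s₄ ⊛ s₄))
             (⊛-cong (≈-trans (neg-⊛ four q) (⊛-cong (neg-const (+ 4)) neg-q))
               (≈-trans (neg-⊛ s₄ s₄) (⊛-cong (neg-sub₂ (sub₂ ψ)) (neg-sub₂ (sub₂ ψ))))))))) ⟩
    p₂ ⊛ p₂ ⊕ (⊖ (four ⊛ (⊖ q) ⊛ (s₄ ⊛ s₄)))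
      ≈⟨ solve 3 (λ p q s → p :* p :- con (+ 4) :* (:- q) :* (s :* s) := p :* p :+ con (+ 4) :* q :* (s :* s)) ≈-refl p₂ q s₄ ⟩
    p₂ ⊛ p₂ ⊕ four ⊛ q ⊛ (s₄ ⊛ s₄) ∎
    where
    p₂ s₄ : Series
    p₂ = sub₂ φ
    s₄ = sub₄ ψ

  -- Compute φ(q)² - φ(-q)² twice: the formulas for the squares give 8 q ψ(q⁴)², the dissections
  -- give 8 q φ(q⁴) ψ(q⁸). Then q⁴ is replaced by q.
  ψ² : ψ ⊛ ψ ≈ φ ⊛ sub₂ ψ
  ψ² = sub₂-injective (sub₂-injective (begin
    sub₄ (ψ ⊛ ψ)
      ≈⟨ ≈-trans (sub₂-cong (sub₂-⊛ ψ ψ)) (sub₂-⊛ (sub₂ ψ) (sub₂ ψ)) ⟩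
    s₄ ⊛ s₄
      ≈⟨ q-cancel (⊛-cancelˡ eight (λ ()) (begin
           eight ⊛ (q ⊛ (s₄ ⊛ s₄))
             ≈⟨ solve 3 (λ p q s → con (+ 8) :* (q :* (s :* s))
                  := (p :* p :+ con (+ 4) :* q :* (s :* s)) :- (p :* p :- con (+ 4) :* q :* (s :* s))) ≈-refl p₂ q s₄ ⟩
           p₂ ⊛ p₂ ⊕ four ⊛ q ⊛ (s₄ ⊛ s₄) ⊕ (⊖ (p₂ ⊛ p₂ ⊕ (⊖ (four ⊛ q ⊛ (s₄ ⊛ s₄)))))
             ≈⟨ ≈-sym (⊕-cong φ² (⊖-cong φ⁻²)) ⟩
           φ ⊛ φ ⊕ (⊖ (φ⁻ ⊛ φ⁻))
             ≈⟨ ⊕-cong (⊛-cong φ-dissection φ-dissection) (⊖-cong (⊛-cong φ⁻-dissection φ⁻-dissection)) ⟩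
           (A ⊕ two ⊛ q ⊛ B) ⊛ (A ⊕ two ⊛ q ⊛ B) ⊕ (⊖ ((A ⊕ (⊖ (two ⊛ q ⊛ B))) ⊛ (A ⊕ (⊖ (two ⊛ q ⊛ B)))))
             ≈⟨ solve 3 (λ α q β → (α :+ con (+ 2) :* q :* β) :* (α :+ con (+ 2) :* q :* β)
                  :- (α :- con (+ 2) :* q :* β) :* (α :- con (+ 2) :* q :* β) := con (+ 8) :* (q :* (α :* β))) ≈-refl A q B ⟩
           eight ⊛ (q ⊛ (A ⊛ B)) ∎)) ⟩
    A ⊛ B
      ≈⟨ ≈-sym (≈-trans (sub₂-cong (sub₂-⊛ φ (sub₂ ψ))) (sub₂-⊛ (sub₂ φ) (sub₄ ψ))) ⟩
    sub₄ (φ ⊛ sub₂ ψ) ∎))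
    where
    A B p₂ s₄ : Series
    A = sub₄ φ
    B = sub₈ ψ
    p₂ = sub₂ φ
    s₄ = sub₄ ψ

  -- α and β are the arithmetic-geometric mean pair: α(q²) = (α + β)/2 and β(q²)² = α β.
  α β α′ β′ : Series
  α = φ ⊛ φ
  β = φ⁻ ⊛ φ⁻
  α′ = sub₂ α
  β′ = sub₂ β

  α′≈ : α′ ≈ sub₂ φ ⊛ sub₂ φ
  α′≈ = sub₂-⊛ φ φ

  α+β : two ⊛ α′ ≈ α ⊕ β
  α+β = begin
    two ⊛ α′
      ≈⟨ ⊛-congˡ two α′≈ ⟩
    two ⊛ (sub₂ φ ⊛ sub₂ φ)
      ≈⟨ solve 2 (λ p x → con (+ 2) :* (p :* p) := (p :* p :+ x) :+ (p :* p :- x)) ≈-refl (sub₂ φ) (four ⊛ q ⊛ (sub₄ ψ ⊛ sub₄ ψ)) ⟩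
    (sub₂ φ ⊛ sub₂ φ ⊕ four ⊛ q ⊛ (sub₄ ψ ⊛ sub₄ ψ)) ⊕ (sub₂ φ ⊛ sub₂ φ ⊕ (⊖ (four ⊛ q ⊛ (sub₄ ψ ⊛ sub₄ ψ))))
      ≈⟨ ≈-sym (⊕-cong φ² φ⁻²) ⟩
    α ⊕ β ∎

  α-β : α ⊕ (⊖ β) ≈ eight ⊛ (q ⊛ (sub₄ ψ ⊛ sub₄ ψ))
  α-β = ≈-trans (⊕-cong φ² (⊖-cong φ⁻²))
    (solve 3 (λ p q s → (p :+ con (+ 4) :* q :* s) :- (p :- con (+ 4) :* q :* s) := con (+ 8) :* (q :* s)) ≈-refl
      (sub₂ φ ⊛ sub₂ φ) q (sub₄ ψ ⊛ sub₄ ψ))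

  αβ : β′ ⊛ β′ ≈ α ⊛ β
  αβ = begin
    β′ ⊛ β′                         ≈⟨ ⊛-cong (≈-trans (sub₂-⊛ φ⁻ φ⁻) (≈-sym φφ⁻)) (≈-trans (sub₂-⊛ φ⁻ φ⁻) (≈-sym φφ⁻)) ⟩
    φ ⊛ φ⁻ ⊛ (φ ⊛ φ⁻)               ≈⟨ solve 2 (λ p m → p :* m :* (p :* m) := p :* p :* (m :* m)) ≈-refl φ φ⁻ ⟩
    α ⊛ β                           ∎

  D-square : ∀ f → D (f ⊛ f) ≈ two ⊛ (f ⊛ D f)
  D-square f = ≈-trans (D-⊛ f f) (solve 2 (λ f d → d :* f :+ f :* d := con (+ 2) :* (f :* d)) ≈-refl f (D f))

  D-⊕ : ∀ f g → D (f ⊕ g) ≈ D f ⊕ D g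
  D-⊕ f g = pointwise λ n → ℤₚ.*-distribˡ-+ (+ n) (f n) (g n)

  D-const-⊛ : ∀ k f → D (const k ⊛ f) ≈ const k ⊛ D f
  D-const-⊛ k f = ≈-trans (D-⊛ (const k) f) (≈-trans (⊕-congʳ (const k ⊛ D f) (⊛-congʳ f (D-const k)))
    (solve 2 (λ f g → con 0ℤ :* f :+ g := g) ≈-refl f (const k ⊛ D f)))

  wronskian : Series → Series → Series
  wronskian f g = D f ⊛ g ⊕ (⊖ (f ⊛ D g))

  -- V = 0 says D log (α/β) = (α² − β²)/2.
  V : Series
  V = two ⊛ wronskian α β ⊕ (⊖ (α ⊛ β ⊛ (α ⊛ α ⊕ (⊖ (β ⊛ β)))))

  -- The factor 2 in `V` is absorbed by the chain rule.
  sub₂-V : sub₂ V ≈ wronskian α′ β′ ⊕ (⊖ (α′ ⊛ β′ ⊛ (α′ ⊛ α′ ⊕ (⊖ (β′ ⊛ β′)))))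
  sub₂-V = begin
    sub₂ V
      ≈⟨ sub₂-⊕ (two ⊛ wronskian α β) (⊖ cubic) ⟩
    sub₂ (two ⊛ wronskian α β) ⊕ sub₂ (⊖ cubic)
      ≈⟨ ⊕-cong
           (≈-trans (sub₂-⊛ two (wronskian α β)) (⊛-cong (sub₂-const (+ 2))
             (≈-trans (sub₂-⊕ (D α ⊛ β) (⊖ (α ⊛ D β)))
               (⊕-cong (sub₂-⊛ (D α) β) (≈-trans (sub₂-⊖ (α ⊛ D β)) (⊖-cong (sub₂-⊛ α (D β))))))))
           (≈-trans (sub₂-⊖ cubic) (⊖-cong (≈-trans (sub₂-⊛ (α ⊛ β) (α ⊛ α ⊕ (⊖ (β ⊛ β)))) (⊛-cong (sub₂-⊛ α β)
             (≈-trans (sub₂-⊕ (α ⊛ α) (⊖ (β ⊛ β))) (⊕-cong (sub₂-⊛ α α) (≈-trans (sub₂-⊖ (β ⊛ β)) (⊖-cong (sub₂-⊛ β β)))))))))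
         ⟩
    two ⊛ (sub₂ (D α) ⊛ β′ ⊕ (⊖ (α′ ⊛ sub₂ (D β)))) ⊕ (⊖ cubic′)
      ≈⟨ solve 5 (λ x β′ α′ y c → con (+ 2) :* (x :* β′ :- α′ :* y) :- c := ((con (+ 2) :* x) :* β′ :- α′ :* (con (+ 2) :* y)) :- c)
           ≈-refl (sub₂ (D α)) β′ α′ (sub₂ (D β)) cubic′ ⟩
    two ⊛ sub₂ (D α) ⊛ β′ ⊕ (⊖ (α′ ⊛ (two ⊛ sub₂ (D β)))) ⊕ (⊖ cubic′)
      ≈⟨ ≈-sym (⊕-congʳ (⊖ cubic′) (⊕-cong (⊛-congʳ β′ (D-sub₂ α)) (⊖-cong (⊛-congˡ α′ (D-sub₂ β))))) ⟩
    wronskian α′ β′ ⊕ (⊖ cubic′) ∎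
    where
    cubic cubic′ : Series
    cubic = α ⊛ β ⊛ (α ⊛ α ⊕ (⊖ (β ⊛ β)))
    cubic′ = α′ ⊛ β′ ⊛ (α′ ⊛ α′ ⊕ (⊖ (β′ ⊛ β′)))

  -- Multiplied by 8 β(q²), the defect at q² depends only on 2α(q²), β(q²)² and their derivatives,
  -- that is, on α + β and αβ. The resulting expression factors as (α - β) V, and α - β = 8 q
  -- ψ(q⁴)².
  V-functional : β′ ⊛ sub₂ V ≈ q ⊛ (sub₄ ψ ⊛ sub₄ ψ ⊛ V)
  V-functional = ⊛-cancelˡ eight (λ ()) (begin
    eight ⊛ (β′ ⊛ sub₂ V)
      ≈⟨ ⊛-congˡ eight (⊛-congˡ β′ sub₂-V) ⟩
    eight ⊛ (β′ ⊛ (wronskian α′ β′ ⊕ (⊖ (α′ ⊛ β′ ⊛ (α′ ⊛ α′ ⊕ (⊖ (β′ ⊛ β′)))))))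
      ≈⟨ solve 4 (λ α β ȧ ḃ → con (+ 8) :* (β :* (ȧ :* β :- α :* ḃ :- α :* β :* (α :* α :- β :* β)))
           := con (+ 4) :* (con (+ 2) :* ȧ) :* (β :* β) :- con (+ 2) :* (con (+ 2) :* α) :* (con (+ 2) :* (β :* ḃ))
              :- (con (+ 2) :* α) :* (β :* β) :* ((con (+ 2) :* α) :* (con (+ 2) :* α) :- con (+ 4) :* (β :* β)))
           ≈-refl α′ β′ (D α′) (D β′) ⟩
    four ⊛ (two ⊛ D α′) ⊛ (β′ ⊛ β′) ⊕ (⊖ (two ⊛ (two ⊛ α′) ⊛ (two ⊛ (β′ ⊛ D β′))))
      ⊕ (⊖ (two ⊛ α′ ⊛ (β′ ⊛ β′) ⊛ (two ⊛ α′ ⊛ (two ⊛ α′) ⊕ (⊖ (four ⊛ (β′ ⊛ β′))))))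
      ≈⟨ ⊕-cong (⊕-cong (⊛-cong (⊛-congˡ four Dα+Dβ) αβ) (⊖-cong (⊛-cong (⊛-congˡ two α+β) Dαβ)))
           (⊖-cong (⊛-cong (⊛-cong α+β αβ) (⊕-cong (⊛-cong α+β α+β) (⊖-cong (⊛-congˡ four αβ))))) ⟩
    four ⊛ (D α ⊕ D β) ⊛ (α ⊛ β) ⊕ (⊖ (two ⊛ (α ⊕ β) ⊛ (D α ⊛ β ⊕ α ⊛ D β)))
      ⊕ (⊖ ((α ⊕ β) ⊛ (α ⊛ β) ⊛ ((α ⊕ β) ⊛ (α ⊕ β) ⊕ (⊖ (four ⊛ (α ⊛ β))))))
      ≈⟨ solve 4 (λ α β ȧ ḃ → con (+ 4) :* (ȧ :+ ḃ) :* (α :* β) :- con (+ 2) :* (α :+ β) :* (ȧ :* β :+ α :* ḃ)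
              :- (α :+ β) :* (α :* β) :* ((α :+ β) :* (α :+ β) :- con (+ 4) :* (α :* β))
           := (α :- β) :* (con (+ 2) :* (ȧ :* β :- α :* ḃ) :- α :* β :* (α :* α :- β :* β))) ≈-refl α β (D α) (D β) ⟩
    (α ⊕ (⊖ β)) ⊛ V
      ≈⟨ ⊛-congʳ V α-β ⟩
    eight ⊛ (q ⊛ (sub₄ ψ ⊛ sub₄ ψ)) ⊛ V
      ≈⟨ solve 4 (λ e q s v → e :* (q :* s) :* v := e :* (q :* (s :* v))) ≈-refl eight q (sub₄ ψ ⊛ sub₄ ψ) V ⟩
    eight ⊛ (q ⊛ (sub₄ ψ ⊛ sub₄ ψ ⊛ V)) ∎)
    where
    Dα+Dβ : two ⊛ D α′ ≈ D α ⊕ D β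
    Dα+Dβ = ≈-trans (≈-sym (D-const-⊛ (+ 2) α′)) (≈-trans (D-cong α+β) (D-⊕ α β))
    Dαβ : two ⊛ (β′ ⊛ D β′) ≈ D α ⊛ β ⊕ α ⊛ D β
    Dαβ = ≈-trans (≈-sym (D-square β′)) (≈-trans (D-cong αβ) (D-⊛ α β))

  -- If V vanishes through n ≥ 1, then V(q²) vanishes through 2n + 1 ≥ n + 2, whereas the
  -- coefficient of q^(n+2) in q ψ(q⁴)² V is V(n + 1).
  V≈0 : V ≈ const 0ℤ
  V≈0 = ≈0-induction refl step
    where
    step : ∀ n → Vanish n V → V (suc n) ≡ 0ℤ
    -- At q² the functional equation merely says V(1) = V(1), so this coefficient is computed.
    step zero    _ = refl
    step (suc m) v =
      trans (sym (ℤₚ.*-identityˡ (V (suc n))))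
      (trans (sym (⊛-leading (sub₄ ψ ⊛ sub₄ ψ) v))
      (trans (sym (q⊛-suc (sub₄ ψ ⊛ sub₄ ψ ⊛ V) (suc n)))
      (trans (sym (at V-functional (suc (suc n))))
        (⊛-vanish β′ (sub₂-vanish v) (suc (suc n)) (s≤s (ℕₚ.+-monoˡ-≤ n (s≤s (z≤n {m}))))))))
      where n = suc m

  wronskian-square : ∀ f g → wronskian (f ⊛ f) (g ⊛ g) ≈ two ⊛ (f ⊛ g) ⊛ wronskian f g
  wronskian-square f g = ≈-trans (⊕-cong (⊛-congʳ (g ⊛ g) (D-square f)) (⊖-cong (⊛-congˡ (f ⊛ f) (D-square g))))
    (solve 4 (λ f g ḟ ġ → con (+ 2) :* (f :* ḟ) :* (g :* g) :- f :* f :* (con (+ 2) :* (g :* ġ))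
      := con (+ 2) :* (f :* g) :* (ḟ :* g :- f :* ġ)) ≈-refl f g (D f) (D g))

  -- This is D log (φ(q)/φ(-q)) = 4 q ψ(q²)⁴. In V = 0 the right side has α² - β² = (α + β)(α - β) =
  -- 2 φ(q²)² · 8 q ψ(q⁴)², and φ(q²) ψ(q⁴) = ψ(q²)².
  wronskian-φ : wronskian φ φ⁻ ≈ four ⊛ q ⊛ (φ ⊛ φ⁻) ⊛ (sub₂ ψ ⊛ sub₂ ψ ⊛ (sub₂ ψ ⊛ sub₂ ψ))
  wronskian-φ = ⊛-cancelˡ (four ⊛ (φ ⊛ φ⁻)) (λ ()) (begin
    four ⊛ (φ ⊛ φ⁻) ⊛ w
      ≈⟨ solve 2 (λ p w → con (+ 4) :* p :* w := con (+ 2) :* (con (+ 2) :* p :* w)) ≈-refl (φ ⊛ φ⁻) w ⟩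
    two ⊛ (two ⊛ (φ ⊛ φ⁻) ⊛ w)
      ≈⟨ ⊛-congˡ two (≈-sym (wronskian-square φ φ⁻)) ⟩
    two ⊛ wronskian α β
      ≈⟨ x⊖y≈0⇒x≈y V≈0 ⟩
    α ⊛ β ⊛ (α ⊛ α ⊕ (⊖ (β ⊛ β)))
      ≈⟨ solve 2 (λ α β → α :* β :* (α :* α :- β :* β) := α :* β :* (α :+ β) :* (α :- β)) ≈-refl α β ⟩
    α ⊛ β ⊛ (α ⊕ β) ⊛ (α ⊕ (⊖ β))
      ≈⟨ ⊛-cong (⊛-congˡ (α ⊛ β) (≈-trans (≈-sym α+β) (⊛-congˡ two α′≈))) α-β ⟩
    φ ⊛ φ ⊛ (φ⁻ ⊛ φ⁻) ⊛ (two ⊛ (sub₂ φ ⊛ sub₂ φ)) ⊛ (eight ⊛ (q ⊛ (sub₄ ψ ⊛ sub₄ ψ)))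
      ≈⟨ solve 5 (λ p m s t q → p :* p :* (m :* m) :* (con (+ 2) :* (s :* s)) :* (con (+ 8) :* (q :* (t :* t)))
           := con (+ 4) :* (p :* m) :* (con (+ 4) :* q :* (p :* m) :* ((s :* t) :* (s :* t)))) ≈-refl φ φ⁻ (sub₂ φ) (sub₄ ψ) q ⟩
    four ⊛ (φ ⊛ φ⁻) ⊛ (four ⊛ q ⊛ (φ ⊛ φ⁻) ⊛ (sub₂ φ ⊛ sub₄ ψ ⊛ (sub₂ φ ⊛ sub₄ ψ)))
      ≈⟨ ⊛-congˡ (four ⊛ (φ ⊛ φ⁻)) (⊛-congˡ (four ⊛ q ⊛ (φ ⊛ φ⁻)) (≈-sym (⊛-cong ψ²′ ψ²′))) ⟩
    four ⊛ (φ ⊛ φ⁻) ⊛ (four ⊛ q ⊛ (φ ⊛ φ⁻) ⊛ (sub₂ ψ ⊛ sub₂ ψ ⊛ (sub₂ ψ ⊛ sub₂ ψ))) ∎)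
    where
    w : Series
    w = wronskian φ φ⁻
    ψ²′ : sub₂ ψ ⊛ sub₂ ψ ≈ sub₂ φ ⊛ sub₄ ψ
    ψ²′ = ≈-trans (≈-sym (sub₂-⊛ ψ ψ)) (≈-trans (sub₂-cong ψ²) (sub₂-⊛ φ (sub₂ ψ)))

  -- Both y = ψ f₁ and y = f₂² have constant term 1 and satisfy y² f₄² = f₂⁴ y(q²). Their difference
  -- x satisfies (y + z) f₄² x = f₂⁴ x(q²), where the factor of x on the left has constant term 2. A
  -- nonzero x of order N ≥ 1 would give the orders N and at least 2N.
  ψf₁≈f₂² : ψ ⊛ f₁ ≈ f₂ ⊛ f₂
  ψf₁≈f₂² = x⊖y≈0⇒x≈y (≈0-induction refl step)
    where
    y z x g h t : Series
    t = sub₂ ψ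
    y = ψ ⊛ f₁
    z = f₂ ⊛ f₂
    x = y ⊕ (⊖ z)
    g = (y ⊕ z) ⊛ (f₄ ⊛ f₄)
    h = f₂ ⊛ f₂ ⊛ (f₂ ⊛ f₂)
    y-eq : y ⊛ y ⊛ (f₄ ⊛ f₄) ≈ h ⊛ sub₂ y
    y-eq = ⊛-cancelˡ (f₂ ⊛ f₂) (λ ()) (begin
      f₂ ⊛ f₂ ⊛ (ψ ⊛ f₁ ⊛ (ψ ⊛ f₁) ⊛ (f₄ ⊛ f₄))
        ≈⟨ solve 4 (λ s p f r → s :* s :* (p :* f :* (p :* f) :* (r :* r)) := p :* p :* (s :* s :* (f :* f) :* (r :* r))) ≈-refl f₂ ψ f₁ f₄ ⟩
      ψ ⊛ ψ ⊛ (f₂ ⊛ f₂ ⊛ (f₁ ⊛ f₁) ⊛ (f₄ ⊛ f₄))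
        ≈⟨ ⊛-congʳ (f₂ ⊛ f₂ ⊛ (f₁ ⊛ f₁) ⊛ (f₄ ⊛ f₄)) ψ² ⟩
      φ ⊛ t ⊛ (f₂ ⊛ f₂ ⊛ (f₁ ⊛ f₁) ⊛ (f₄ ⊛ f₄))
        ≈⟨ solve 5 (λ p t s f r → p :* t :* (s :* s :* (f :* f) :* (r :* r)) := (p :* s) :* (f :* f :* (r :* r) :* (t :* s))) ≈-refl φ t f₂ f₁ f₄ ⟩
      φ ⊛ f₂ ⊛ (f₁ ⊛ f₁ ⊛ (f₄ ⊛ f₄) ⊛ (t ⊛ f₂))
        ≈⟨ ⊛-congʳ (f₁ ⊛ f₁ ⊛ (f₄ ⊛ f₄) ⊛ (t ⊛ f₂)) gauss⁺ ⟩
      f₁⁻ ⊛ f₁⁻ ⊛ (f₁ ⊛ f₁ ⊛ (f₄ ⊛ f₄) ⊛ (t ⊛ f₂))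
        ≈⟨ solve 4 (λ m f r y → m :* m :* (f :* f :* (r :* r) :* y) := (m :* f :* r) :* (m :* f :* r) :* y) ≈-refl f₁⁻ f₁ f₄ (t ⊛ f₂) ⟩
      f₁⁻ ⊛ f₁ ⊛ f₄ ⊛ (f₁⁻ ⊛ f₁ ⊛ f₄) ⊛ (t ⊛ f₂)
        ≈⟨ ⊛-cong (⊛-cong f₁⁻f₁f₄≈f₂³ f₁⁻f₁f₄≈f₂³) (≈-sym (sub₂-⊛ ψ f₁)) ⟩
      f₂ ⊛ f₂ ⊛ f₂ ⊛ (f₂ ⊛ f₂ ⊛ f₂) ⊛ sub₂ y
        ≈⟨ solve 2 (λ s y → s :* s :* s :* (s :* s :* s) :* y := s :* s :* (s :* s :* (s :* s) :* y)) ≈-refl f₂ (sub₂ y) ⟩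
      f₂ ⊛ f₂ ⊛ (h ⊛ sub₂ y) ∎)
    functional : g ⊛ x ≈ h ⊛ sub₂ x
    functional = begin
      g ⊛ x
        ≈⟨ solve 3 (λ y z r → (y :+ z) :* r :* (y :- z) := y :* y :* r :- z :* z :* r) ≈-refl y z (f₄ ⊛ f₄) ⟩
      y ⊛ y ⊛ (f₄ ⊛ f₄) ⊕ (⊖ (h ⊛ (f₄ ⊛ f₄)))
        ≈⟨ ⊕-cong y-eq (⊖-cong (⊛-congˡ h (≈-sym (sub₂-⊛ f₂ f₂)))) ⟩
      h ⊛ sub₂ y ⊕ (⊖ (h ⊛ sub₂ z))
        ≈⟨ solve 3 (λ h y z → h :* y :- h :* z := h :* (y :- z)) ≈-refl h (sub₂ y) (sub₂ z) ⟩
      h ⊛ (sub₂ y ⊕ (⊖ sub₂ z))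
        ≈⟨ ⊛-congˡ h (≈-sym (≈-trans (sub₂-⊕ y (⊖ z)) (⊕-congˡ (sub₂ y) (sub₂-⊖ z)))) ⟩
      h ⊛ sub₂ x ∎
    step : ∀ n → Vanish n x → x (suc n) ≡ 0ℤ
    step n v = *-zero-cancelˡ {+ 2} (x (suc n)) (λ ()) (trans (sym (⊛-leading g v))
      (trans (at functional (suc n)) (⊛-vanish h (sub₂-vanish v) (suc n) (s≤s (ℕₚ.m≤m+n n n)))))

  -- A common factor f₂ changes a Wronskian only by f₂², so Gauss' identities carry `wronskian-φ`
  -- over to f₁(-q)², f₁² and then to f₁(-q), f₁. The cancelled f₂³ f₄ makes room to insert f₁(-q)
  -- f₁ f₄ = f₂³ and ψ(q²) f₂ = f₄².
  wronskian-f₁ : wronskian f₁⁻ f₁ ⊛ f₂ ≈ two ⊛ q ⊛ f₄ ^ˢ 7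
  wronskian-f₁ = ⊛-cancelˡ (f₂ ⊛ f₂ ⊛ f₂ ⊛ f₄) (λ ()) (begin
    f₂ ⊛ f₂ ⊛ f₂ ⊛ f₄ ⊛ (W ⊛ f₂)
      ≈⟨ solve 3 (λ s r w → s :* s :* s :* r :* (w :* s) := w :* (s :* s :* (s :* s) :* r)) ≈-refl f₂ f₄ W ⟩
    W ⊛ (f₂ ⊛ f₂ ⊛ (f₂ ⊛ f₂) ⊛ f₄)
      ≈⟨ ⊛-congʳ (f₂ ⊛ f₂ ⊛ (f₂ ⊛ f₂) ⊛ f₄) W-eq ⟩
    two ⊛ q ⊛ (f₁⁻ ⊛ f₁) ⊛ (t ⊛ t ⊛ (t ⊛ t)) ⊛ (f₂ ⊛ f₂ ⊛ (f₂ ⊛ f₂) ⊛ f₄)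
      ≈⟨ solve 6 (λ q m f t s r → con (+ 2) :* q :* (m :* f) :* (t :* t :* (t :* t)) :* (s :* s :* (s :* s) :* r)
           := con (+ 2) :* q :* (m :* f :* r) :* ((t :* s) :* (t :* s) :* ((t :* s) :* (t :* s)))) ≈-refl q f₁⁻ f₁ t f₂ f₄ ⟩
    two ⊛ q ⊛ (f₁⁻ ⊛ f₁ ⊛ f₄) ⊛ (t ⊛ f₂ ⊛ (t ⊛ f₂) ⊛ (t ⊛ f₂ ⊛ (t ⊛ f₂)))
      ≈⟨ ⊛-cong (⊛-congˡ (two ⊛ q) f₁⁻f₁f₄≈f₂³) (⊛-cong (⊛-cong tf₂ tf₂) (⊛-cong tf₂ tf₂)) ⟩
    two ⊛ q ⊛ (f₂ ⊛ f₂ ⊛ f₂) ⊛ (f₄ ⊛ f₄ ⊛ (f₄ ⊛ f₄) ⊛ (f₄ ⊛ f₄ ⊛ (f₄ ⊛ f₄)))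
      ≈⟨ solve 3 (λ q s r → con (+ 2) :* q :* (s :* s :* s) :* (r :* r :* (r :* r) :* (r :* r :* (r :* r)))
           := s :* s :* s :* r :* (con (+ 2) :* q :* r :^ 7)) ≈-refl q f₂ f₄ ⟩
    f₂ ⊛ f₂ ⊛ f₂ ⊛ f₄ ⊛ (two ⊛ q ⊛ f₄ ^ˢ 7) ∎)
    where
    W t : Series
    W = wronskian f₁⁻ f₁
    t = sub₂ ψ
    tf₂ : t ⊛ f₂ ≈ f₄ ⊛ f₄
    tf₂ = ≈-trans (≈-sym (sub₂-⊛ ψ f₁)) (≈-trans (sub₂-cong ψf₁≈f₂²) (sub₂-⊛ f₂ f₂))
    wronskian-scale : wronskian (φ ⊛ f₂) (φ⁻ ⊛ f₂) ≈ f₂ ⊛ f₂ ⊛ wronskian φ φ⁻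
    wronskian-scale = ≈-trans
      (⊕-cong (⊛-congʳ (φ⁻ ⊛ f₂) (D-⊛ φ f₂)) (⊖-cong (⊛-congˡ (φ ⊛ f₂) (D-⊛ φ⁻ f₂))))
      (solve 6 (λ p m s ṗ ṁ ṡ → (ṗ :* s :+ p :* ṡ) :* (m :* s) :- p :* s :* (ṁ :* s :+ m :* ṡ)
        := s :* s :* (ṗ :* m :- p :* ṁ)) ≈-refl φ φ⁻ f₂ (D φ) (D φ⁻) (D f₂))
    W-eq : W ≈ two ⊛ q ⊛ (f₁⁻ ⊛ f₁) ⊛ (t ⊛ t ⊛ (t ⊛ t))
    W-eq = ⊛-cancelˡ (two ⊛ (f₁⁻ ⊛ f₁)) (λ ()) (begin
      two ⊛ (f₁⁻ ⊛ f₁) ⊛ W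
        ≈⟨ ≈-sym (wronskian-square f₁⁻ f₁) ⟩
      wronskian (f₁⁻ ⊛ f₁⁻) (f₁ ⊛ f₁)
        ≈⟨ ≈-sym (⊕-cong (⊛-cong (D-cong gauss⁺) gauss) (⊖-cong (⊛-cong gauss⁺ (D-cong gauss)))) ⟩
      wronskian (φ ⊛ f₂) (φ⁻ ⊛ f₂)
        ≈⟨ wronskian-scale ⟩
      f₂ ⊛ f₂ ⊛ wronskian φ φ⁻
        ≈⟨ ⊛-congˡ (f₂ ⊛ f₂) wronskian-φ ⟩
      f₂ ⊛ f₂ ⊛ (four ⊛ q ⊛ (φ ⊛ φ⁻) ⊛ (t ⊛ t ⊛ (t ⊛ t)))
        ≈⟨ solve 5 (λ s q p m u → s :* s :* (con (+ 4) :* q :* (p :* m) :* u) := con (+ 4) :* q :* ((p :* s) :* (m :* s)) :* u)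
             ≈-refl f₂ q φ φ⁻ (t ⊛ t ⊛ (t ⊛ t)) ⟩
      four ⊛ q ⊛ (φ ⊛ f₂ ⊛ (φ⁻ ⊛ f₂)) ⊛ (t ⊛ t ⊛ (t ⊛ t))
        ≈⟨ ⊛-congʳ (t ⊛ t ⊛ (t ⊛ t)) (⊛-congˡ (four ⊛ q) (⊛-cong gauss⁺ gauss)) ⟩
      four ⊛ q ⊛ (f₁⁻ ⊛ f₁⁻ ⊛ (f₁ ⊛ f₁)) ⊛ (t ⊛ t ⊛ (t ⊛ t))
        ≈⟨ solve 4 (λ q m f u → con (+ 4) :* q :* (m :* m :* (f :* f)) :* u
             := con (+ 2) :* (m :* f) :* (con (+ 2) :* q :* (m :* f) :* u)) ≈-refl q f₁⁻ f₁ (t ⊛ t ⊛ (t ⊛ t)) ⟩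
      two ⊛ (f₁⁻ ⊛ f₁) ⊛ (two ⊛ q ⊛ (f₁⁻ ⊛ f₁) ⊛ (t ⊛ t ⊛ (t ⊛ t))) ∎)

-- Generating functions of generalized cubic partitions

useTimes-small : ∀ {s n} ks f → n < s → useTimes s ks n f ≡ countMulti ks n
useTimes-small ks zero n<s = refl
useTimes-small {s} {n} ks (suc f) n<s with suc f * s ≤? n
... | yes le = contradiction n<s (ℕₚ.≤⇒≯ (ℕₚ.≤-trans (ℕₚ.m≤m+n s (f * s)) le))
... | no  _  = useTimes-small ks f n<s

-- The last argument of `useTimes` bounds the multiplicity of the first kind; as that kind has
-- positive size, no multiplicity above n fits.
useTimes-fuel : ∀ s ks n k → useTimes (suc s) ks n (k + n) ≡ useTimes (suc s) ks n n
useTimes-fuel s ks n zero = refl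
useTimes-fuel s ks n (suc k) with suc (k + n) * suc s ≤? n
... | yes le = contradiction le (ℕₚ.<⇒≱ (ℕₚ.≤-trans (s≤s (ℕₚ.m≤n+m n k)) (ℕₚ.m≤m*n (suc (k + n)) (suc s))))
... | no  _  = useTimes-fuel s ks n k

-- Either kind s does not occur, or removing one copy lowers the total by s and the bound by one.
useTimes-shift : ∀ s ks n f → useTimes s ks (s + n) (suc f) ≡ countMulti ks (s + n) + useTimes s ks n f
useTimes-shift s ks n zero with 1 * s ≤? s + n
... | no  gt = contradiction (subst (_≤ s + n) (sym (ℕₚ.+-identityʳ s)) (ℕₚ.m≤m+n s n)) gt
... | yes _  = trans (cong (λ m → countMulti ks m + countMulti ks (s + n)) (ℕₚ.[m+n]∸[m+o]≡n∸o s n 0))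
  (ℕₚ.+-comm (countMulti ks n) (countMulti ks (s + n)))
useTimes-shift s ks n (suc f) with suc (suc f) * s ≤? s + n | suc f * s ≤? n
... | yes le | no gt = contradiction (ℕₚ.+-cancelˡ-≤ s _ _ le) gt
... | no gt  | yes le = contradiction (ℕₚ.+-monoʳ-≤ s le) gt
... | no _   | no _   = useTimes-shift s ks n f
... | yes _  | yes _  = begin
  countMulti ks (s + n ∸ (s + suc f * s)) + useTimes s ks (s + n) (suc f)
    ≡⟨ cong₂ (λ m x → countMulti ks m + x) (ℕₚ.[m+n]∸[m+o]≡n∸o s n (suc f * s)) (useTimes-shift s ks n f) ⟩
  countMulti ks (n ∸ suc f * s) + (countMulti ks (s + n) + useTimes s ks n f)
    ≡⟨ x∙yz≈y∙xz (countMulti ks (n ∸ suc f * s)) (countMulti ks (s + n)) (useTimes s ks n f) ⟩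
  countMulti ks (s + n) + (countMulti ks (n ∸ suc f * s) + useTimes s ks n f) ∎
  where open ≡-Reasoning
        open import Algebra.Properties.CommutativeSemigroup ℕₚ.+-commutativeSemigroup using (x∙yz≈y∙xz)

countMulti-below : ∀ {s n} ks → n < s → countMulti (s ∷ ks) n ≡ countMulti ks n
countMulti-below {n = n} ks n<s = useTimes-small ks n n<s

countMulti-shift : ∀ s ks n → countMulti (suc s ∷ ks) (suc s + n) ≡ countMulti ks (suc s + n) + countMulti (suc s ∷ ks) n
countMulti-shift s ks n = trans (useTimes-shift (suc s) ks n (s + n))
  (cong (λ z → countMulti ks (suc s + n) + z) (useTimes-fuel s ks n s))

gen : List ℕ → Series
gen ks n = + countMulti ks n

gen-∷ : ∀ s ks → gen (suc s ∷ ks) ⊛ 1-q^ (suc s) ≈ gen ks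
gen-∷ s ks = ≈-trans
  (solve 2 (λ g x → g :* (con 1ℤ :- x) := g :- x :* g) ≈-refl (gen (suc s ∷ ks)) (q ^ˢ suc s))
  (pointwise coeff)
  where
  open SeriesSolver
  g = gen (suc s ∷ ks)
  coeff : ∀ n → (g ⊕ (⊖ (q ^ˢ suc s ⊛ g))) n ≡ gen ks n
  coeff n with n <? suc s
  ... | yes n<s = trans (cong₂ (λ x y → x +ᶻ (-ᶻ y)) (cong +_ (countMulti-below ks n<s)) (q^⊛-below (suc s) g n<s))
    (ℤₚ.+-identityʳ (gen ks n))
  ... | no n≮s = subst (λ m → (g ⊕ (⊖ (q ^ˢ suc s ⊛ g))) m ≡ gen ks m) (ℕₚ.m+[n∸m]≡n (ℕₚ.≮⇒≥ n≮s)) (begin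
    g (suc s + m) +ᶻ (-ᶻ (q ^ˢ suc s ⊛ g) (suc s + m))
      ≡⟨ cong₂ (λ x y → x +ᶻ (-ᶻ y)) (trans (cong +_ (countMulti-shift s ks m)) (ℤₚ.pos-+ (countMulti ks (suc s + m)) _))
           (q^⊛-shift (suc s) g m) ⟩
    gen ks (suc s + m) +ᶻ g m +ᶻ (-ᶻ g m)
      ≡⟨ ℤₚ.+-assoc (gen ks (suc s + m)) (g m) (-ᶻ g m) ⟩
    gen ks (suc s + m) +ᶻ (g m +ᶻ (-ᶻ g m))
      ≡⟨ trans (cong (gen ks (suc s + m) +ᶻ_) (ℤₚ.+-inverseʳ (g m))) (ℤₚ.+-identityʳ _) ⟩
    gen ks (suc s + m) ∎)
    where open ≡-Reasoning
          m = n ∸ suc s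

gen-replicate : ∀ m s ks → gen (replicate m (suc s) ++ ks) ⊛ 1-q^ (suc s) ^ˢ m ≈ gen ks
gen-replicate zero    s ks = ≈-trans (⊛-comm (gen ks) one) (⊛-identityˡ (gen ks))
gen-replicate (suc m) s ks = begin
  gen (suc s ∷ replicate m (suc s) ++ ks) ⊛ (1-q^ (suc s) ⊛ 1-q^ (suc s) ^ˢ m)
    ≈⟨ ≈-sym (⊛-assoc (gen (suc s ∷ replicate m (suc s) ++ ks)) (1-q^ (suc s)) (1-q^ (suc s) ^ˢ m)) ⟩
  gen (suc s ∷ replicate m (suc s) ++ ks) ⊛ 1-q^ (suc s) ⊛ 1-q^ (suc s) ^ˢ m
    ≈⟨ ⊛-congʳ (1-q^ (suc s) ^ˢ m) (gen-∷ s (replicate m (suc s) ++ ks)) ⟩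
  gen (replicate m (suc s) ++ ks) ⊛ 1-q^ (suc s) ^ˢ m
    ≈⟨ gen-replicate m s ks ⟩
  gen ks ∎
  where open SetoidReasoning ≈-setoid

denominator : ℕ → ℕ → Series
denominator c zero    = one
denominator c (suc k) = denominator c k ⊛ 1-q^ (suc k) ^ˢ colours c (suc k)

gen-partKinds : ∀ c n → gen (partKinds c n) ⊛ denominator c n ≈ one
gen-partKinds c zero    = ≈-trans (⊛-comm (gen []) one) (≈-trans (⊛-identityˡ (gen []))
  (pointwise λ { zero → refl ; (suc _) → refl }))
gen-partKinds c (suc n) = begin
  g ⊛ (denominator c n ⊛ x)     ≈⟨ solve 3 (λ g d x → g :* (d :* x) := g :* x :* d) ≈-refl g (denominator c n) x ⟩
  g ⊛ x ⊛ denominator c n       ≈⟨ ⊛-congʳ (denominator c n) (gen-replicate (colours c (suc n)) n (partKinds c n)) ⟩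
  gen (partKinds c n) ⊛ denominator c n  ≈⟨ gen-partKinds c n ⟩
  one ∎
  where
  open SetoidReasoning ≈-setoid
  open SeriesSolver
  g = gen (partKinds c (suc n))
  x = 1-q^ (suc n) ^ˢ colours c (suc n)

⊛1-q^^-near : ∀ f n m → f ⊛ 1-q^ (suc n) ^ˢ m ≈[ n ] f
⊛1-q^^-near f n zero    = ≈⇒≈[] (≈-trans (⊛-comm f one) (⊛-identityˡ f))
⊛1-q^^-near f n (suc m) = ≈[]-trans
  (≈⇒≈[] (≈-sym (⊛-assoc f (1-q^ (suc n)) (1-q^ (suc n) ^ˢ m))))
  (≈[]-trans (⊛1-q^^-near (f ⊛ 1-q^ (suc n)) n m) (⊛1-q^-near f n))

partitions : ℕ → Series
partitions c n = + a c n

-- The value `a c n` is the diagonal of a sequence of series, since its list of kinds grows with n.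
-- The sequence is coherent: new parts of size n + 1 only bring in a factor congruent to 1 modulo
-- q^(n+1).
partitions-≈[] : ∀ c n → partitions c ≈[ n ] gen (partKinds c n)
partitions-≈[] c = limit-≈[] {λ n → gen (partKinds c n)} λ n → ≈[]-trans
  (≈[]-sym (⊛1-q^^-near (gen (partKinds c (suc n))) n (colours c (suc n))))
  (≈⇒≈[] (gen-replicate (colours c (suc n)) n (partKinds c n)))

-- The k-th factor of f₂, equal to 1 for odd k; with c + 1 colours the k-th factor of the
-- denominator is 1 - q^k times its c-th power.
evenFactor : ℕ → Series
evenFactor k with k % 2
... | zero  = 1-q^ k
... | suc _ = one

evenFactor-even : ∀ k → k % 2 ≡ 0 → evenFactor k ≈ 1-q^ k
evenFactor-even k e with k % 2
... | zero = ≈-refl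

evenFactor-odd : ∀ k → k % 2 ≡ 1 → evenFactor k ≈ one
evenFactor-odd k e with k % 2
... | suc _ = ≈-refl

one^ : ∀ c → one ^ˢ c ≈ one
one^ zero    = ≈-refl
one^ (suc c) = ≈-trans (⊛-identityˡ (one ^ˢ c)) (one^ c)

colours-factor : ∀ c k → 1-q^ k ^ˢ colours (suc c) k ≈ 1-q^ k ⊛ evenFactor k ^ˢ c
colours-factor c k with k % 2
... | zero  = ≈-refl
... | suc _ = ⊛-congˡ (1-q^ k) (≈-sym (one^ c))

evenP : ℕ → Series
evenP zero    = one
evenP (suc k) = evenP k ⊛ evenFactor (suc k)

denominator-factor : ∀ c n → denominator (suc c) n ≈ P n ⊛ evenP n ^ˢ c
denominator-factor c zero    = ≈-sym (≈-trans (⊛-identityˡ (one ^ˢ c)) (one^ c))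
denominator-factor c (suc n) = begin
  denominator (suc c) n ⊛ 1-q^ (suc n) ^ˢ colours (suc c) (suc n)
    ≈⟨ ⊛-cong (denominator-factor c n) (colours-factor c (suc n)) ⟩
  P n ⊛ evenP n ^ˢ c ⊛ (1-q^ (suc n) ⊛ evenFactor (suc n) ^ˢ c)
    ≈⟨ solve 4 (λ p e x f → p :* e :* (x :* f) := p :* x :* (e :* f)) ≈-refl
         (P n) (evenP n ^ˢ c) (1-q^ (suc n)) (evenFactor (suc n) ^ˢ c) ⟩
  P (suc n) ⊛ (evenP n ^ˢ c ⊛ evenFactor (suc n) ^ˢ c)
    ≈⟨ ⊛-congˡ (P (suc n)) (≈-sym (^ˢ-distrib-⊛ (evenP n) (evenFactor (suc n)) c)) ⟩
  P (suc n) ⊛ evenP (suc n) ^ˢ c ∎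
  where open SetoidReasoning ≈-setoid
        open SeriesSolver

n+n≡n*2 : ∀ n → n + n ≡ n * 2
n+n≡n*2 n = trans (cong (λ m → n + m) (sym (ℕₚ.+-identityʳ n))) (ℕₚ.*-comm 2 n)

evenP-double : ∀ n → evenP (n + n) ≈ sub₂ (P n)
evenP-double zero    = ≈-sym (sub₂-const 1ℤ)
evenP-double (suc n) = begin
  evenP (suc n + suc n)
    ≈⟨ ≡⇒≈ (cong evenP (cong suc (ℕₚ.+-suc n n))) ⟩
  evenP (n + n) ⊛ evenFactor (suc (n + n)) ⊛ evenFactor (suc (suc (n + n)))
    ≈⟨ ⊛-cong (⊛-cong (evenP-double n) (evenFactor-odd (suc (n + n)) odd))
         (≈-trans (evenFactor-even (suc (suc (n + n))) even) (≡⇒≈ (cong 1-q^ (cong suc (sym (ℕₚ.+-suc n n)))))) ⟩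
  sub₂ (P n) ⊛ one ⊛ 1-q^ (suc n + suc n)
    ≈⟨ ⊛-cong (≈-trans (⊛-comm (sub₂ (P n)) one) (⊛-identityˡ (sub₂ (P n)))) (≈-sym (sub₂-1-q^ (suc n))) ⟩
  sub₂ (P n) ⊛ sub₂ (1-q^ (suc n))
    ≈⟨ ≈-sym (sub₂-⊛ (P n) (1-q^ (suc n))) ⟩
  sub₂ (P (suc n)) ∎
  where
  open SetoidReasoning ≈-setoid
  odd : suc (n + n) % 2 ≡ 1
  odd = trans (cong (λ m → suc m % 2) (n+n≡n*2 n)) (DivMod.[m+kn]%n≡m%n 1 n 2)
  even : suc (suc (n + n)) % 2 ≡ 0
  even = trans (cong (λ m → suc (suc m) % 2) (n+n≡n*2 n)) (DivMod.[m+kn]%n≡m%n 2 n 2)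

evenP-coherent : Coherent evenP
evenP-coherent n with suc n % 2
... | zero  = ⊛1-q^-near (evenP n) n
... | suc _ = ≈⇒≈[] (≈-trans (⊛-comm (evenP n) one) (⊛-identityˡ (evenP n)))

-- `evenP-double` concerns even lengths only, so coefficient i is compared at length 2i.
evenP-≈[] : ∀ n → f₂ ≈[ n ] evenP n
evenP-≈[] n = ≈[]-trans (≈⇒≈[] (pointwise λ i → begin
  f₂ i                ≡⟨ at≤ (sub₂-cong[] (f₁-≈[] i)) i ℕₚ.≤-refl ⟩
  sub₂ (P i) i        ≡⟨ at (evenP-double i) i ⟨
  evenP (i + i) i     ≡⟨ at≤ (limit-≈[] evenP-coherent (i + i)) i (ℕₚ.m≤m+n i i) ⟨
  limit evenP i       ∎)) (limit-≈[] evenP-coherent n)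
  where open ≡-Reasoning

-- The generating function of the definition, with c + 1 colours so that the exponent of f₂ needs no
-- subtraction.
partitions-gf : ∀ c → partitions (suc c) ⊛ (f₁ ⊛ f₂ ^ˢ c) ≈ one
partitions-gf c = ≈[]⇒≈ λ n → let open SetoidReasoning (≈[]-setoid n) in begin
  partitions (suc c) ⊛ (f₁ ⊛ f₂ ^ˢ c)
    ≈⟨ ⊛-cong[] (partitions-≈[] (suc c) n) (⊛-cong[] (f₁-≈[] n) (^-cong[] c (evenP-≈[] n))) ⟩
  gen (partKinds (suc c) n) ⊛ (P n ⊛ evenP n ^ˢ c)
    ≈⟨ ≈⇒≈[] (⊛-congˡ (gen (partKinds (suc c) n)) (≈-sym (denominator-factor c n))) ⟩
  gen (partKinds (suc c) n) ⊛ denominator (suc c) n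
    ≈⟨ ≈⇒≈[] (gen-partKinds (suc c) n) ⟩
  one ∎

-- Congruences

nC0≡1 : ∀ n → n C 0 ≡ 1
nC0≡1 n = trans (nCk≡nC[n∸k] (z≤n {n})) (nCn≡1 n)

-- For a prime n + 1 = p the right side is a multiple of p, and Euclid's lemma moves the
-- divisibility to the binomial coefficient when k + 1 < p.
C-absorb : ∀ n k → suc k * (suc n C suc k) ≡ suc n * (n C k)
C-absorb zero    zero    = refl
C-absorb zero    (suc k) = trans (cong (suc (suc k) *_) (k>n⇒nCk≡0 (s≤s (s≤s (z≤n {k}))))) (ℕₚ.*-zeroʳ (suc (suc k)))
C-absorb (suc n) zero    = trans (ℕₚ.*-identityˡ (suc (suc n) C 1))
  (trans (nC1≡n (suc (suc n))) (sym (trans (cong (suc (suc n) *_) (nC0≡1 (suc n))) (ℕₚ.*-identityʳ (suc (suc n))))))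
C-absorb (suc n) (suc k) = begin
  suc (suc k) * (suc (suc n) C suc (suc k))
    ≡⟨ cong (suc (suc k) *_) (sym (nCk+nC[k+1]≡[n+1]C[k+1] (suc n) (suc k))) ⟩
  suc (suc k) * (x + y)
    ≡⟨ solve 3 (λ k x y → (con 2 :+ k) :* (x :+ y) := x :+ ((con 1 :+ k) :* x :+ (con 2 :+ k) :* y)) refl k x y ⟩
  x + (suc k * x + suc (suc k) * y)
    ≡⟨ cong (λ m → x + m) (cong₂ _+_ (C-absorb n k) (C-absorb n (suc k))) ⟩
  x + (suc n * (n C k) + suc n * (n C suc k))
    ≡⟨ cong (λ m → x + m) (sym (ℕₚ.*-distribˡ-+ (suc n) (n C k) (n C suc k))) ⟩
  x + suc n * (n C k + n C suc k)
    ≡⟨ cong (λ m → x + suc n * m) (nCk+nC[k+1]≡[n+1]C[k+1] n k) ⟩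
  suc (suc n) * x ∎
  where
  open ≡-Reasoning
  open ℕSolver.+-*-Solver
  x = suc n C suc k
  y = suc n C suc (suc k)

prime∣C : ∀ {p} → Prime p → ∀ k → suc k < p → p ∣ p C suc k
prime∣C {suc p} pr k 1+k<p with euclidsLemma (suc k) (suc p C suc k) pr (divides (p C k) (trans (C-absorb p k) (ℕₚ.*-comm (suc p) (p C k))))
... | inj₁ p∣1+k = contradiction (∣⇒≤ p∣1+k) (ℕₚ.<⇒≱ 1+k<p)
... | inj₂ p∣C   = p∣C

-- The sum over i < m of C(n, i) x^i. Stopping below n splits off the top term, the only one besides
-- i = 0 not controlled by `prime∣C`.
binomialSum : ℕ → ℕ → ℕ → ℕ
binomialSum x n zero    = 0
binomialSum x n (suc m) = (n C m) * x ^ m + binomialSum x n m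

binomialSum-pascal : ∀ x n m → binomialSum x (suc n) (suc m) ≡ binomialSum x n (suc m) + x * binomialSum x n m
binomialSum-pascal x n zero = trans (cong (λ c → c * 1 + 0) (trans (nC0≡1 (suc n)) (sym (nC0≡1 n))))
  (sym (trans (cong (λ z → (n C 0) * 1 + 0 + z) (ℕₚ.*-zeroʳ x)) (ℕₚ.+-identityʳ _)))
binomialSum-pascal x n (suc m) = begin
  (suc n C suc m) * (x * x ^ m) + binomialSum x (suc n) (suc m)
    ≡⟨ cong₂ (λ c s → c * (x * x ^ m) + s) (sym (nCk+nC[k+1]≡[n+1]C[k+1] n m)) (binomialSum-pascal x n m) ⟩
  (n C m + n C suc m) * (x * x ^ m) + (binomialSum x n (suc m) + x * binomialSum x n m)
    ≡⟨ solve 6 (λ c d x e s t → (c :+ d) :* (x :* e) :+ (s :+ x :* t) := d :* (x :* e) :+ s :+ x :* (c :* e :+ t)) refl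
         (n C m) (n C suc m) x (x ^ m) (binomialSum x n (suc m)) (binomialSum x n m) ⟩
  binomialSum x n (suc (suc m)) + x * binomialSum x n (suc m) ∎
  where open ≡-Reasoning
        open ℕSolver.+-*-Solver

binomial : ∀ x n → suc x ^ n ≡ binomialSum x n (suc n)
binomial x zero    = refl
binomial x (suc n) = begin
  suc x * suc x ^ n
    ≡⟨ cong (suc x *_) (binomial x n) ⟩
  binomialSum x n (suc n) + x * binomialSum x n (suc n)
    ≡⟨ cong (λ c → c * x ^ suc n + binomialSum x n (suc n) + x * binomialSum x n (suc n)) (sym (k>n⇒nCk≡0 (ℕₚ.n<1+n n))) ⟩
  binomialSum x n (suc (suc n)) + x * binomialSum x n (suc n)
    ≡⟨ sym (binomialSum-pascal x n (suc n)) ⟩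
  binomialSum x (suc n) (suc (suc n)) ∎
  where open ≡-Reasoning

binomialSum-prime : ∀ {p} → Prime p → ∀ x m → m < p → ∃ λ k → binomialSum x p (suc m) ≡ 1 + k * p
binomialSum-prime {p} pr x zero    _     = 0 , cong (λ c → c * 1 + 0) (nC0≡1 p)
binomialSum-prime {p} pr x (suc m) 1+m<p with prime∣C pr m 1+m<p | binomialSum-prime pr x m (ℕₚ.<⇒≤ 1+m<p)
... | divides c C≡cp | k , e = c * x ^ suc m + k , (begin
  (p C suc m) * x ^ suc m + binomialSum x p (suc m)
    ≡⟨ cong₂ (λ a b → a * x ^ suc m + b) C≡cp e ⟩
  c * p * x ^ suc m + (1 + k * p)
    ≡⟨ solve 4 (λ c p x k → c :* p :* x :+ (con 1 :+ k :* p) := con 1 :+ (c :* x :+ k) :* p) refl c p (x ^ suc m) k ⟩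
  1 + (c * x ^ suc m + k) * p ∎)
  where open ≡-Reasoning
        open ℕSolver.+-*-Solver

-- Induction on u through (u + 1)^p ≡ u^p + 1; the multiple of p is added on the right, so the
-- statement stays in ℕ.
fermat : ∀ {p} → Prime p → ∀ u → ∃ λ k → u ^ p ≡ u + k * p
fermat {suc p} pr zero    = 0 , refl
fermat {suc p} pr (suc u) with fermat pr u | binomialSum-prime pr u p (ℕₚ.n<1+n p)
... | k , e | l , e′ = k + l , (begin
  suc u ^ suc p
    ≡⟨ binomial u (suc p) ⟩
  (suc p C suc p) * u ^ suc p + binomialSum u (suc p) (suc p)
    ≡⟨ cong₂ _+_ (cong₂ _*_ (nCn≡1 (suc p)) e) e′ ⟩
  1 * (u + k * suc p) + (1 + l * suc p)
    ≡⟨ solve 4 (λ u k l p → con 1 :* (u :+ k :* p) :+ (con 1 :+ l :* p) := (con 1 :+ u) :+ (k :+ l) :* p) refl u k l (suc p) ⟩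
  suc u + (k + l) * suc p ∎)
  where open ≡-Reasoning
        open ℕSolver.+-*-Solver

-- Newton's recursion s(m+2) = (x + y) s(m+1) - x y s(m) for power sums, with the negative term
-- moved to the other side.
∣x+y⇒∣x^odd+y^odd : ∀ {p} x y k → p ∣ x + y → p ∣ x ^ suc (2 * k) + y ^ suc (2 * k)
∣x+y⇒∣x^odd+y^odd {p} x y zero d = subst₂ (λ m n → p ∣ m + n) (sym (ℕₚ.*-identityʳ x)) (sym (ℕₚ.*-identityʳ y)) d
∣x+y⇒∣x^odd+y^odd {p} x y (suc k) d rewrite ℕₚ.+-suc k (k + 0) =
  ∣m+n∣m⇒∣n (subst (p ∣_) split (∣m⇒∣m*n (x ^ suc m + y ^ suc m) d)) (∣n⇒∣m*n (x * y) (∣x+y⇒∣x^odd+y^odd x y k d))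
  where
  m = suc (2 * k)
  open ℕSolver.+-*-Solver
  split : (x + y) * (x ^ suc m + y ^ suc m) ≡ x * y * (x ^ m + y ^ m) + (x ^ suc (suc m) + y ^ suc (suc m))
  split = solve 4 (λ x y a b → (x :+ y) :* (x :* a :+ y :* b) := x :* y :* (a :+ b) :+ (x :* (x :* a) :+ y :* (y :* b)))
    refl x y (x ^ m) (y ^ m)

prime∤2 : ∀ {p} → Prime p → 7 ≤ p → ¬ p ∣ 2
prime∤2 pr 7≤p p∣2 = contradiction (ℕₚ.≤-trans 7≤p (∣⇒≤ p∣2)) λ { (s≤s (s≤s ())) }

prime∤3 : ∀ {p} → Prime p → 7 ≤ p → ¬ p ∣ 3
prime∤3 pr 7≤p p∣3 = contradiction (ℕₚ.≤-trans 7≤p (∣⇒≤ p∣3)) λ { (s≤s (s≤s (s≤s ()))) }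

cancel-factor : ∀ {p} m n → Prime p → ¬ p ∣ m → p ∣ m * n → p ∣ n
cancel-factor m n pr p∤m p∣mn = [ (λ p∣m → contradiction p∣m p∤m) , id ]′ (euclidsLemma m n pr p∣mn)

∣square⇒∣ : ∀ {p} u → Prime p → p ∣ u * u → p ∣ u
∣square⇒∣ u pr d = [ id , id ]′ (euclidsLemma u u pr d)

-- By Fermat, u^p v + u v^p ≡ 2uv; and u² + v² divides (u²)^m + (v²)^m for the odd number m = (p − 1)/2.
sum-of-squares : ∀ {p} k → Prime p → 7 ≤ p → p ≡ suc (2 * suc (2 * k)) → ∀ u v → p ∣ u * u + v * v → p ∣ u
sum-of-squares {p} k pr 7≤p p≡ u v d with fermat pr u | fermat pr v
-- If p divides v instead of u, it divides u² = (u² + v²) - v².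
... | a , u^p | b , v^p = [ id , (λ p∣v → ∣square⇒∣ u pr
    (∣m+n∣m⇒∣n (subst (p ∣_) (ℕₚ.+-comm (u * u) (v * v)) d) (∣m⇒∣m*n v p∣v))) ]′
    (euclidsLemma u v pr (cancel-factor 2 (u * v) pr (prime∤2 pr 7≤p) p∣2uv))
  where
  open ℕSolver.+-*-Solver
  m = suc (2 * k)
  power : ∀ w → w ^ p ≡ w * (w * w) ^ m
  power w = trans (cong (w ^_) p≡) (cong (w *_) (trans (sym (ℕₚ.^-*-assoc w 2 m)) (cong (λ z → (w * z) ^ m) (ℕₚ.*-identityʳ w))))
  expand : u * v * ((u * u) ^ m + (v * v) ^ m) ≡ (a * v + b * u) * p + 2 * (u * v)
  expand = trans (solve 4 (λ u v x y → u :* v :* (x :+ y) := (u :* x) :* v :+ (v :* y) :* u) refl u v ((u * u) ^ m) ((v * v) ^ m))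
    (trans (cong₂ (λ x y → x * v + y * u) (trans (sym (power u)) u^p) (trans (sym (power v)) v^p))
      (solve 5 (λ u v a b p → (u :+ a :* p) :* v :+ (v :+ b :* p) :* u := (a :* v :+ b :* u) :* p :+ con 2 :* (u :* v)) refl u v a b p))
  p∣2uv : p ∣ 2 * (u * v)
  p∣2uv = ∣m+n∣m⇒∣n (subst (p ∣_) expand (∣n⇒∣m*n (u * v) (∣x+y⇒∣x^odd+y^odd (u * u) (v * v) k d))) (n∣m*n (a * v + b * u))

cancel-factorᶻ : ∀ {p} m z → Prime p → ¬ p ∣ m → + p ∣ᶻ + m *ᶻ z → + p ∣ᶻ z
cancel-factorᶻ {p} m z pr p∤m d = ∣ᵤ⇒∣ (cancel-factor m ∣ z ∣ pr p∤m (subst (p ∣_) (ℤₚ.abs-* (+ m) z) (∣⇒∣ᵤ d)))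

⊛-∣ : ∀ {d} n f g → (∀ i j → i + j ≡ n → d ∣ᶻ f i *ᶻ g j) → d ∣ᶻ (f ⊛ g) n
⊛-∣ zero    f g h = h 0 0 refl
⊛-∣ (suc n) f g h = ℤᵈ.∣m∣n⇒∣m+n (h 0 (suc n) refl) (⊛-∣ n (tail f) g λ i j e → h (suc i) j (cong suc e))

-- Modulo p, f^p only involves powers of q^p, as one reads off from D(f^p) = p f^(p−1) D f.
^-prime-∣ : ∀ {p} → Prime p → ∀ f j → ¬ p ∣ j → + p ∣ᶻ (f ^ˢ p) j
^-prime-∣ {suc p} pr f j p∤j = cancel-factorᶻ j ((f ^ˢ suc p) j) pr p∤j
  (subst (+ suc p ∣ᶻ_) (sym (trans (at (D-^ f p) j) (const-⊛-at (+ suc p) (f ^ˢ p ⊛ D f) j)))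
    (ℤᵈ.∣m⇒∣m*n ((f ^ˢ p ⊛ D f) j) ℤᵈ.∣-refl))

-- It multiplies coefficient j by 24 j + 1, the square u² on the support of f₁. In the antisymmetric
-- combination giving 24 W the undifferentiated products cancel.
D₂₄ : Series → Series
D₂₄ f = const (+ 24) ⊛ D f ⊕ f

D₂₄-at : ∀ f j → D₂₄ f j ≡ + (24 * j + 1) *ᶻ f j
D₂₄-at f j = trans (cong (_+ᶻ f j) (const-⊛-at (+ 24) (D f) j))
  (trans (solve 2 (λ j x → con (+ 24) :* (j :* x) :+ x := (con (+ 24) :* j :+ con 1ℤ) :* x) refl (+ j) (f j))
    (cong (_*ᶻ f j) (trans (cong (_+ᶻ 1ℤ) (sym (ℤₚ.pos-* 24 j))) (sym (ℤₚ.pos-+ (24 * j) 1)))))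
  where open ℤSolver

D₂₄-∣ : ∀ {p} k → Prime p → 7 ≤ p → p ≡ suc (2 * suc (2 * k)) →
  ∀ {f g} → PentagonalSupport f → PentagonalSupport g → ∀ n → p ∣ 24 * n + 2 → + p ∣ᶻ (D₂₄ f ⊛ g) n
D₂₄-∣ {p} k pr 7≤p p≡ {f} {g} sf sg n d = ⊛-∣ n (D₂₄ f) g λ i j i+j≡n →
  subst (λ z → + p ∣ᶻ z *ᶻ g j) (sym (D₂₄-at f i)) (term i j i+j≡n)
  where
  term : ∀ i j → i + j ≡ n → + p ∣ᶻ + (24 * i + 1) *ᶻ f i *ᶻ g j
  term i j i+j≡n with sf i | sg j
  ... | inj₁ z | _ = subst (+ p ∣ᶻ_) (sym (cong (_*ᶻ g j) (trans (cong (+ (24 * i + 1) *ᶻ_) z) (ℤₚ.*-zeroʳ (+ (24 * i + 1)))))) (∣ᵤ⇒∣ (p ∣0))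
  ... | inj₂ _ | inj₁ z = subst (+ p ∣ᶻ_) (sym (trans (cong (+ (24 * i + 1) *ᶻ f i *ᶻ_) z) (ℤₚ.*-zeroʳ (+ (24 * i + 1) *ᶻ f i)))) (∣ᵤ⇒∣ (p ∣0))
  ... | inj₂ (u , u²) | inj₂ (v , v²) = ℤᵈ.∣m⇒∣m*n {m = + (24 * i + 1) *ᶻ f i} (g j)
      (ℤᵈ.∣m⇒∣m*n {m = + (24 * i + 1)} (f i) (∣ᵤ⇒∣
      (subst (p ∣_) (sym u²) (∣m⇒∣m*n u (sum-of-squares k pr 7≤p p≡ u v (subst (p ∣_) sum d))))))
    where
    open ℕSolver.+-*-Solver
    sum : 24 * n + 2 ≡ u * u + v * v
    sum = trans (cong (λ m → 24 * m + 2) (sym i+j≡n))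
      (trans (solve 2 (λ i j → con 24 :* (i :+ j) :+ con 2 := (con 24 :* i :+ con 1) :+ (con 24 :* j :+ con 1)) refl i j)
        (cong₂ _+_ u² v²))

wronskian-∣ : ∀ {p} k → Prime p → 7 ≤ p → p ≡ suc (2 * suc (2 * k)) →
  ∀ n → p ∣ 24 * n + 2 → + p ∣ᶻ wronskian f₁⁻ f₁ n
wronskian-∣ {p} k pr 7≤p p≡ n d = cancel-factorᶻ 24 (wronskian f₁⁻ f₁ n) pr p∤24
  (subst (+ p ∣ᶻ_) (trans (at 24W n) (const-⊛-at (+ 24) (wronskian f₁⁻ f₁) n))
    (ℤᵈ.∣m∣n⇒∣m-n
      (D₂₄-∣ k pr 7≤p p≡ (neg-support f₁-support) f₁-support n d)
      (D₂₄-∣ k pr 7≤p p≡ f₁-support (neg-support f₁-support) n d)))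
  where
  open SeriesSolver
  24W : D₂₄ f₁⁻ ⊛ f₁ ⊕ (⊖ (D₂₄ f₁ ⊛ f₁⁻)) ≈ const (+ 24) ⊛ wronskian f₁⁻ f₁
  24W = solve 4 (λ m f ṁ ḟ → (con (+ 24) :* ṁ :+ m) :* f :- (con (+ 24) :* ḟ :+ f) :* m
    := con (+ 24) :* (ṁ :* f :- m :* ḟ)) ≈-refl f₁⁻ f₁ (D f₁⁻) (D f₁)
  p∤24 : ¬ p ∣ 24
  p∤24 d₂₄ = prime∤3 pr 7≤p (cancel-factor 2 3 pr (prime∤2 pr 7≤p) (cancel-factor 2 6 pr (prime∤2 pr 7≤p) (cancel-factor 2 12 pr (prime∤2 pr 7≤p) d₂₄)))

-- The congruence for generalized cubic partitions

-- Partitions with one colour have generating function 1/f₁, so `sub₄ (partitions 1)` is 1/f₄ as an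
-- integral series. For c + 1 = p - 6 colours its exponent is 7 + c = p.
partitions-wronskian : ∀ c → two ⊛ (q ⊛ sub₂ (partitions (suc c))) ≈ sub₄ (partitions 1) ^ˢ (7 + c) ⊛ wronskian f₁⁻ f₁
partitions-wronskian c = begin
  two ⊛ (q ⊛ h)
    ≈⟨ solve 3 (λ t q h → t :* (q :* h) := t :* q :* h :* con 1ℤ) ≈-refl two q h ⟩
  two ⊛ q ⊛ h ⊛ one
    ≈⟨ ⊛-congˡ (two ⊛ q ⊛ h) (≈-sym G^p) ⟩
  two ⊛ q ⊛ h ⊛ (G ^ˢ (7 + c) ⊛ (f₄ ^ˢ 7 ⊛ f₄ ^ˢ c))
    ≈⟨ solve 6 (λ t q h G x y → t :* q :* h :* (G :* (x :* y)) := G :* (t :* q :* x) :* (y :* h)) ≈-refl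
         two q h (G ^ˢ (7 + c)) (f₄ ^ˢ 7) (f₄ ^ˢ c) ⟩
  G ^ˢ (7 + c) ⊛ (two ⊛ q ⊛ f₄ ^ˢ 7) ⊛ (f₄ ^ˢ c ⊛ h)
    ≈⟨ ⊛-congʳ (f₄ ^ˢ c ⊛ h) (⊛-congˡ (G ^ˢ (7 + c)) (≈-sym wronskian-f₁)) ⟩
  G ^ˢ (7 + c) ⊛ (W ⊛ f₂) ⊛ (f₄ ^ˢ c ⊛ h)
    ≈⟨ solve 5 (λ G W f y h → G :* (W :* f) :* (y :* h) := G :* W :* (h :* (f :* y))) ≈-refl (G ^ˢ (7 + c)) W f₂ (f₄ ^ˢ c) h ⟩
  G ^ˢ (7 + c) ⊛ W ⊛ (h ⊛ (f₂ ⊛ f₄ ^ˢ c))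
    ≈⟨ ⊛-congˡ (G ^ˢ (7 + c) ⊛ W) h-inverse ⟩
  G ^ˢ (7 + c) ⊛ W ⊛ one
    ≈⟨ ≈-trans (⊛-comm (G ^ˢ (7 + c) ⊛ W) one) (⊛-identityˡ (G ^ˢ (7 + c) ⊛ W)) ⟩
  G ^ˢ (7 + c) ⊛ W ∎
  where
  open SetoidReasoning ≈-setoid
  open SeriesSolver
  h G W : Series
  h = sub₂ (partitions (suc c))
  G = sub₄ (partitions 1)
  W = wronskian f₁⁻ f₁
  h-inverse : h ⊛ (f₂ ⊛ f₄ ^ˢ c) ≈ one
  h-inverse = ≈-trans (⊛-congˡ h (≈-sym (≈-trans (sub₂-⊛ f₁ (f₂ ^ˢ c)) (⊛-congˡ f₂ (sub₂-^ f₂ c)))))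
    (≈-trans (≈-sym (sub₂-⊛ (partitions (suc c)) (f₁ ⊛ f₂ ^ˢ c)))
      (≈-trans (sub₂-cong (partitions-gf c)) (sub₂-const 1ℤ)))
  G-inverse : G ⊛ f₄ ≈ one
  G-inverse = ≈-trans (≈-sym (sub₂-⊛ (sub₂ (partitions 1)) f₂)) (≈-trans (sub₂-cong
    (≈-trans (≈-sym (sub₂-⊛ (partitions 1) f₁)) (≈-trans (sub₂-cong
      (≈-trans (⊛-congˡ (partitions 1) (≈-trans (≈-sym (⊛-identityˡ f₁)) (⊛-comm one f₁))) (partitions-gf 0))) (sub₂-const 1ℤ))))
    (sub₂-const 1ℤ))
  G^p : G ^ˢ (7 + c) ⊛ (f₄ ^ˢ 7 ⊛ f₄ ^ˢ c) ≈ one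
  G^p = ≈-trans (⊛-congˡ (G ^ˢ (7 + c)) (≈-sym (^ˢ-homo-* f₄ 7 c)))
    (≈-trans (≈-sym (^ˢ-distrib-⊛ G f₄ (7 + c))) (≈-trans (^-cong (7 + c) G-inverse) (one^ (7 + c))))

-- Twice the wanted number is the coefficient of G^p W at 2N + 1 with G = 1/f₄. For i + j = 2N + 1,
-- either p does not divide i and the coefficient of G^p at i is a multiple of p, or p divides i and
-- then 24 j + 2 = 48 N + 26 - 24 i, so the one of W at j is.
a≡0 : ∀ c → let p = 7 + c in Prime p → ∀ k → p ≡ suc (2 * suc (2 * k)) →
  ∀ N → p ∣ 48 * N + 26 → p ∣ a (suc c) N
a≡0 c pr k p≡ N d = ∣⇒∣ᵤ (cancel-factorᶻ 2 (partitions (suc c) N) pr (prime∤2 pr 7≤p)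
  (subst (+ p ∣ᶻ_) coefficient (⊛-∣ (suc (N + N)) (G ^ˢ p) (wronskian f₁⁻ f₁) term)))
  where
  p = 7 + c
  7≤p : 7 ≤ p
  7≤p = ℕₚ.m≤m+n 7 c
  G = sub₄ (partitions 1)
  coefficient : (G ^ˢ p ⊛ wronskian f₁⁻ f₁) (suc (N + N)) ≡ + 2 *ᶻ partitions (suc c) N
  coefficient = trans (sym (at (partitions-wronskian c) (suc (N + N))))
    (trans (const-⊛-at (+ 2) (q ⊛ sub₂ (partitions (suc c))) (suc (N + N)))
      (cong (+ 2 *ᶻ_) (trans (q⊛-suc (sub₂ (partitions (suc c))) (N + N)) (sub₂-double (partitions (suc c)) N))))
  term : ∀ i j → i + j ≡ suc (N + N) → + p ∣ᶻ (G ^ˢ p) i *ᶻ wronskian f₁⁻ f₁ j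
  term i j i+j≡ with p ∣? i
  ... | no  p∤i = ℤᵈ.∣m⇒∣m*n (wronskian f₁⁻ f₁ j) (^-prime-∣ pr G i p∤i)
  ... | yes p∣i = ℤᵈ.∣n⇒∣m*n ((G ^ˢ p) i) (wronskian-∣ k pr 7≤p p≡ j
        (∣m+n∣m⇒∣n (subst (p ∣_) total d) (∣n⇒∣m*n 24 p∣i)))
    where
    open ℕSolver.+-*-Solver
    total : 48 * N + 26 ≡ 24 * i + (24 * j + 2)
    total = trans (solve 1 (λ N → con 48 :* N :+ con 26 := con 24 :* (con 1 :+ (N :+ N)) :+ con 2) refl N)
      (trans (cong (λ m → 24 * m + 2) (sym i+j≡))
        (solve 2 (λ i j → con 24 :* (i :+ j) :+ con 2 := con 24 :* i :+ (con 24 :* j :+ con 2)) refl i j))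

residue : ∀ m d r .{{_ : NonZero d}} → m % d ≡ r → m ≡ r + m / d * d
residue m d r e = trans (DivMod.m≡m%n+[m/n]*n m d) (cong (_+ m / d * d) e)

-- This is p ≡ 3 mod 4, in the form showing that (p - 1)/2 = 2k + 1 is odd.
half-odd : ∀ p → p % 8 ≡ 3 ⊎ p % 8 ≡ 7 → ∃ λ k → p ≡ suc (2 * suc (2 * k))
half-odd p (inj₁ e) = 2 * (p / 8) , trans (residue p 8 3 e)
  (solve 1 (λ x → con 3 :+ x :* con 8 := con 1 :+ con 2 :* (con 1 :+ con 2 :* (con 2 :* x))) refl (p / 8))
  where open ℕSolver.+-*-Solver
half-odd p (inj₂ e) = 1 + 2 * (p / 8) , trans (residue p 8 7 e)
  (solve 1 (λ x → con 7 :+ x :* con 8 := con 1 :+ con 2 :* (con 1 :+ con 2 :* (con 1 :+ con 2 :* x))) refl (p / 8))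
  where open ℕSolver.+-*-Solver

square-24 : ∀ {p} r s b → r * r ≡ 1 + 24 * s → p ≡ r + b * 24 → ∃ λ k → p * p ≡ suc (24 * k)
square-24 r s b r² refl = s + 2 * r * b + 24 * (b * b) , trans
  (solve 2 (λ r b → (r :+ b :* con 24) :* (r :+ b :* con 24) := r :* r :+ con 24 :* (con 2 :* r :* b :+ con 24 :* (b :* b))) refl r b)
  (trans (cong (_+ 24 * (2 * r * b + 24 * (b * b))) r²)
    (solve 3 (λ r s b → con 1 :+ con 24 :* s :+ con 24 :* (con 2 :* r :* b :+ con 24 :* (b :* b))
      := con 1 :+ con 24 :* (s :+ con 2 :* r :* b :+ con 24 :* (b :* b))) refl r s b))
  where open ℕSolver.+-*-Solver

-- It makes the division by 24 in the theorem exact.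
prime-square : ∀ {p} → Prime p → 7 ≤ p → p % 8 ≡ 3 ⊎ p % 8 ≡ 7 → ∃ λ k → p * p ≡ suc (24 * k)
prime-square {p} pr 7≤p p%8 = split p%8
  where
  open ℕSolver.+-*-Solver
  x = p / 8
  y = x / 3
  3∤p : ¬ 3 ∣ p
  3∤p 3∣p with prime⇒irreducible pr 3∣p
  ... | inj₂ refl = contradiction 7≤p λ { (s≤s (s≤s (s≤s ()))) }
  expand : ∀ {r s} → p % 8 ≡ r → x % 3 ≡ s → p ≡ (r + s * 8) + y * 24
  expand {r} {s} e e′ = trans (residue p 8 r e) (trans (cong (λ z → r + z * 8) (residue x 3 s e′))
    (solve 3 (λ r s y → r :+ (s :+ y :* con 3) :* con 8 := (r :+ s :* con 8) :+ y :* con 24) refl r s y))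
  multiple : ∀ r → p ≡ r * 3 + y * 24 → 3 ∣ p
  multiple r e = divides (r + y * 8) (trans e (solve 2 (λ r y → r :* con 3 :+ y :* con 24 := (r :+ y :* con 8) :* con 3) refl r y))
  -- The residues modulo 8 and 3 leave 3, 11, 19, 7, 15, 23 modulo 24. Here 3 and 15 would make p a
  -- multiple of 3, and 11² = 1 + 24 · 5, 19² = 1 + 24 · 15, 7² = 1 + 24 · 2, 23² = 1 + 24 · 22.
  split : p % 8 ≡ 3 ⊎ p % 8 ≡ 7 → ∃ λ k → p * p ≡ suc (24 * k)
  split h with x % 3 in e′ | DivMod.m%n<n x 3
  split (inj₁ e) | 0 | _ = contradiction (multiple 1 (expand e e′)) 3∤p
  split (inj₁ e) | 1 | _ = square-24 11 5 y refl (expand e e′)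
  split (inj₁ e) | 2 | _ = square-24 19 15 y refl (expand e e′)
  split (inj₂ e) | 0 | _ = square-24 7 2 y refl (expand e e′)
  split (inj₂ e) | 1 | _ = contradiction (multiple 5 (expand e e′)) 3∤p
  split (inj₂ e) | 2 | _ = square-24 23 22 y refl (expand e e′)
  split h | suc (suc (suc _)) | s≤s (s≤s (s≤s ()))

theorem3p2 : (p : ℕ) → Prime p → 7 ≤ p → (p % 8 ≡ 3 ⊎ p % 8 ≡ 7) →
    (n : ℕ) → p ∣ a (p ∸ 6) (p * n + (13 * (p * p ∸ 1)) / 24)
theorem3p2 p pr 7≤p p%8 n = reindex (p ∸ 7) (ℕₚ.m+[n∸m]≡n 7≤p)
  where
  open ℕSolver.+-*-Solver
  N = p * n + (13 * (p * p ∸ 1)) / 24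
  -- With p² = 1 + 24 k, the shift 13 k contributes 48 · 13 k + 26 = 26 (1 + 24 k) = 26 p².
  index : p ∣ 48 * N + 26
  index with prime-square pr 7≤p p%8
  ... | k , p² = divides (48 * n + 26 * p) (begin
    48 * (p * n + (13 * (p * p ∸ 1)) / 24) + 26
      ≡⟨ cong (λ m → 48 * (p * n + (13 * (m ∸ 1)) / 24) + 26) p² ⟩
    48 * (p * n + (13 * (24 * k)) / 24) + 26
      ≡⟨ cong (λ m → 48 * (p * n + m) + 26) (trans (cong (_/ 24) (solve 1 (λ k → con 13 :* (con 24 :* k) := con 13 :* k :* con 24) refl k))
           (DivMod.m*n/n≡m (13 * k) 24)) ⟩
    48 * (p * n + 13 * k) + 26
      ≡⟨ solve 3 (λ p n k → con 48 :* (p :* n :+ con 13 :* k) :+ con 26 := con 48 :* (p :* n) :+ con 26 :* (con 1 :+ con 24 :* k)) refl p n k ⟩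
    48 * (p * n) + 26 * suc (24 * k)
      ≡⟨ cong (λ m → 48 * (p * n) + 26 * m) (sym p²) ⟩
    48 * (p * n) + 26 * (p * p)
      ≡⟨ solve 2 (λ p n → con 48 :* (p :* n) :+ con 26 :* (p :* p) := (con 48 :* n :+ con 26 :* p) :* p) refl p n ⟩
    (48 * n + 26 * p) * p ∎)
    where open ≡-Reasoning
  -- At 7 + c in place of p, the term `p ∸ 6` computes to `suc c`.
  reindex : ∀ c → 7 + c ≡ p → p ∣ a (p ∸ 6) N
  reindex c e with half-odd p p%8
  ... | k , p≡ = subst (λ m → m ∣ a (m ∸ 6) N) e
    (a≡0 c (subst Prime (sym e) pr) k (trans e p≡) N (subst (_∣ 48 * N + 26) (sym e) index))
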